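{- For any integers $u,v>0$ and any partition $\mu$, $$D_{u,v}\,s_\mu\Big[\frac{X}{1-q}\Big]=(q^u-1)\sum_{i=1}^{|\mu|+v}q^{u\,p(\mu)_i+v-ui}\;s_{p(\mu)+ve_i}\Big[\frac{X}{1-q}\Big],$$ where $p(\mu)$ is the weak composition of length $|\mu|+v$ obtained by appending zeros to the parts of $\mu$, and $e_i$ is the $i$-th coordinate vector of length $|\mu|+v$.
   Context: Let $\Lambda$ be the ring of symmetric functions in $X=x_1+x_2+\cdots$ over $\mathbb{Q}(q)$, with plethystic notation: $p_k[E]$ replaces every variable in $E$ (including $q$ and an auxiliary $z$) by its $k$-th power, $F[E]$ substitutes $p_k\mapsto p_k[E]$, and $\Omega[E]=\exp(\sum_{k\ge1}p_k[E]/k)$. For an integer $u$, $[u]_q=(1-q^u)/(1-q)$; $t=1/q$, $[u]_t=(1-q^{ -u})/(1-q^{ -1})$, $M=(1-t)(1-q)$. For integers $u,v$, $D_{u,v}F[X]=F[X+M[u]_q/z]\,\Omega[-z[u]_tX]\big|_{z^v}$ (coefficient of $z^v$). For $\alpha\in\mathbb{Z}_{\ge0}^N$ and $\delta_N=(N-1,N-2,\dots,0)$, $s_\alpha$ denotes $0$ if $\alpha+\delta_N$ has a repeated entry, and otherwise $\epsilon\, s_\lambda$, where $\lambda$ is the partition such that sorting $\alpha+\delta_N$ decreasingly gives $\lambda+\delta_N$ and $\epsilon$ is the sign of the sorting permutation. -}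

module Defs where

open import Data.Nat as ℕ using (ℕ; zero; suc; _∸_; _<ᵇ_; _≡ᵇ_)
open import Data.Integer as ℤ using (ℤ; +_; -[1+_])
open import Data.Rational as ℚ using (ℚ; 0ℚ; 1ℚ)
open import Data.List using (List; []; _∷_; _++_; map; foldr; replicate; applyUpTo; concatMap; filter; length; reverse; zipWith)
open import Data.Nat.ListAction using (sum)
open import Data.List.Properties using (≡-dec)
open import Data.List.Relation.Unary.All using (All)
open import Data.List.Relation.Unary.Linked using (Linked)
open import Data.Product using (_×_; _,_)
open import Data.Bool using (Bool; true; false; if_then_else_; _∨_)
open import Relation.Nullary.Decidable using (⌊_⌋; does)
open import Relation.Binary.PropositionalEquality using (_≡_)

-- Polynomials in q over ℚ (coefficient lists, constant term first)

Poly : Set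
Poly = List ℚ

_+P_ : Poly → Poly → Poly
[] +P p = p
(a ∷ p) +P [] = a ∷ p
(a ∷ p) +P (b ∷ r) = (a ℚ.+ b) ∷ (p +P r)

scaleP : ℚ → Poly → Poly
scaleP c p = map (c ℚ.*_) p

_*P_ : Poly → Poly → Poly
[] *P r = []
(a ∷ p) *P r = scaleP a r +P (0ℚ ∷ (p *P r))

coeffP : ℕ → Poly → ℚ
coeffP n [] = 0ℚ
coeffP zero (a ∷ _) = a
coeffP (suc n) (_ ∷ p) = coeffP n p

_≈P_ : Poly → Poly → Set
p ≈P r = ∀ n → coeffP n p ≡ coeffP n r

adamsP : ℕ → Poly → Poly
adamsP k [] = []
adamsP k (a ∷ p) = a ∷ (replicate (k ∸ 1) 0ℚ ++ adamsP k p)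

-- The field ℚ(q) as fractions num/den (den ≠ 0 for every element built below)

record Qq : Set where
  constructor _/ₚ_
  field
    num : Poly
    den : Poly

_≈Q_ : Qq → Qq → Set
(a /ₚ b) ≈Q (c /ₚ d) = (a *P d) ≈P (c *P b)

_+Q_ : Qq → Qq → Qq
(a /ₚ b) +Q (c /ₚ d) = ((a *P d) +P (c *P b)) /ₚ (b *P d)

_*Q_ : Qq → Qq → Qq
(a /ₚ b) *Q (c /ₚ d) = (a *P c) /ₚ (b *P d)

-Q_ : Qq → Qq
-Q (a /ₚ b) = scaleP (ℚ.- 1ℚ) a /ₚ b

_-Q_ : Qq → Qq → Qq
x -Q y = x +Q (-Q y)

invQ : Qq → Qq
invQ (a /ₚ b) = b /ₚ a

_÷Q_ : Qq → Qq → Qq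
x ÷Q y = x *Q invQ y

fromℚ : ℚ → Qq
fromℚ c = (c ∷ []) /ₚ (1ℚ ∷ [])

fromℕQ : ℕ → Qq
fromℕQ n = fromℚ ((+ n) ℚ./ 1)

0Q 1Q qQ tQ : Qq
0Q = fromℚ 0ℚ
1Q = fromℚ 1ℚ
qQ = (0ℚ ∷ 1ℚ ∷ []) /ₚ (1ℚ ∷ [])
tQ = (1ℚ ∷ []) /ₚ (0ℚ ∷ 1ℚ ∷ [])

_^Q_ : Qq → ℕ → Qq
x ^Q zero = 1Q
x ^Q suc n = x *Q (x ^Q n)

qPowℤ : ℤ → Qq
qPowℤ (+ n) = qQ ^Q n
qPowℤ -[1+ n ] = tQ ^Q suc n

adamsQ : ℕ → Qq → Qq
adamsQ k (a /ₚ b) = adamsP k a /ₚ adamsP k b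

qint tint : ℕ → Qq
qint u = (1Q -Q (qQ ^Q u)) ÷Q (1Q -Q qQ)
tint u = (1Q -Q (tQ ^Q u)) ÷Q (1Q -Q tQ)

MQ : Qq
MQ = (1Q -Q tQ) *Q (1Q -Q qQ)

-- Λ over ℚ(q) in the power-sum basis: a formal sum of terms c · p_{ms},
-- where ms is the multiset (list) of indices k ≥ 1 of p_{ms} = ∏ p_k.

Λ : Set
Λ = List (Qq × List ℕ)

insertDesc : ℕ → List ℕ → List ℕ
insertDesc x [] = x ∷ []
insertDesc x (y ∷ ys) = if y <ᵇ x then x ∷ y ∷ ys else y ∷ insertDesc x ys

sortDesc : List ℕ → List ℕ
sortDesc = foldr insertDesc []

coeffΛ : List ℕ → Λ → Qq
coeffΛ lam [] = 0Q
coeffΛ lam ((c , ms) ∷ F) =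
  if does (≡-dec ℕ._≟_ (sortDesc ms) lam) then c +Q coeffΛ lam F else coeffΛ lam F

_≈Λ_ : Λ → Λ → Set
F ≈Λ G = ∀ lam → coeffΛ lam F ≈Q coeffΛ lam G

oneΛ : Λ
oneΛ = (1Q , []) ∷ []

pΛ : ℕ → Λ
pΛ k = (1Q , k ∷ []) ∷ []

_*Λ_ : Λ → Λ → Λ
F *Λ G = concatMap (λ { (c , ms) → map (λ { (d , ns) → (c *Q d , ms ++ ns) }) G }) F

scaleΛ : Qq → Λ → Λ
scaleΛ c = map (λ { (d , ms) → (c *Q d , ms) })

sumΛ : List Λ → Λ
sumΛ = foldr _++_ []

-- Λ[z, z⁻¹]: terms c · z^e · p_{ms}

R : Set
R = List (Qq × ℤ × List ℕ)

oneR : R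
oneR = (1Q , + 0 , []) ∷ []

_*R_ : R → R → R
F *R G = concatMap (λ { (c , e , ms) → map (λ { (d , f , ns) → (c *Q d , e ℤ.+ f , ms ++ ns) }) G }) F

scaleR : Qq → R → R
scaleR c = map (λ { (d , e , ms) → (c *Q d , e , ms) })

prodR : List R → R
prodR = foldr _*R_ oneR

powR : R → ℕ → R
powR E zero = oneR
powR E (suc n) = E *R powR E n

-- p_k[E]: every variable (q, z, x_i) replaced by its k-th power
adamsR : ℕ → R → R
adamsR k = map (λ { (c , e , ms) → (adamsQ k c , (+ k) ℤ.* e , map (k ℕ.*_) ms) })

pleth : Λ → R → R
pleth F E = foldr (λ { (c , ms) acc → scaleR c (prodR (map (λ j → adamsR j E) ms)) ++ acc }) [] F

coeffZ : ℤ → R → Λ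
coeffZ v [] = []
coeffZ v ((c , e , ms) ∷ G) = if does (e ℤ.≟ v) then (c , ms) ∷ coeffZ v G else coeffZ v G

-- Ω[E] = exp(Σ_k p_k[E]/k), truncated: valid in z-degrees ≤ N when every
-- term of E has z-exponent ≥ 1.
ΩTrunc : ℕ → R → R
ΩTrunc N E = foldr _++_ [] (applyUpTo (λ n → scaleR (invQ (fromℕQ (n ℕ.!))) (powR L n)) (suc N))
  where
  L : R
  L = foldr _++_ [] (applyUpTo (λ k → scaleR (invQ (fromℕQ (suc k))) (adamsR (suc k) E)) N)

plethX : Λ → Λ
plethX F = coeffZ (+ 0) (pleth F ((invQ (1Q -Q qQ) , + 0 , 1 ∷ []) ∷ []))

-- D_{u,v} F = F[X + M[u]_q / z] Ω[-z[u]_t X] |_{z^v}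
-- (Ω truncated at z-degree v + (degree bound of F), which does not affect the z^v coefficient)
D : ℕ → ℕ → Λ → Λ
D u v F = coeffZ (+ v) (pleth F E₁ *R ΩTrunc (v ℕ.+ deg) E₂)
  where
  E₁ E₂ : R
  E₁ = (1Q , + 0 , 1 ∷ []) ∷ (MQ *Q qint u , -[1+ 0 ] , []) ∷ []
  E₂ = (-Q (tint u) , + 1 , 1 ∷ []) ∷ []
  deg : ℕ
  deg = sum (map (λ { (_ , ms) → sum ms }) F)

-- [h_n, h_{n-1}, …, h_0], via Newton's identity n h_n = Σ_{k=1}^n p_k h_{n-k}
hs : ℕ → List Λ
hs zero = oneΛ ∷ []
hs (suc n) = scaleΛ (invQ (fromℕQ (suc n)))
               (sumΛ (zipWith (λ k h → pΛ (suc k) *Λ h) (applyUpTo (λ k → k) (suc n)) (hs n)))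
             ∷ hs n

headΛ : List Λ → Λ
headΛ [] = []
headΛ (h ∷ _) = h

hℤ : ℤ → Λ
hℤ (+ n) = headΛ (hs n)
hℤ -[1+ n ] = []

signΛ : ℕ → Λ → Λ
signΛ j F = if does (j ℕ.% 2 ℕ.≟ 0) then F else scaleΛ (-Q 1Q) F

skip : ℕ → ℕ → ℕ
skip j k = if k <ᵇ j then k else suc k

det : ℕ → (ℕ → ℕ → Λ) → Λ
det zero M = oneΛ
det (suc n) M = sumΛ (applyUpTo (λ j → signΛ j (M 0 j *Λ det n (λ i k → M (suc i) (skip j k)))) (suc n))

at : ℕ → List ℕ → ℕ
at n [] = 0
at zero (x ∷ _) = x
at (suc n) (_ ∷ xs) = at n xs

-- Schur function of a partition (Jacobi–Trudi): s_λ = det (h_{λ_i - i + j})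
schur : List ℕ → Λ
schur lam = det (length lam) (λ i j → hℤ ((+ at i lam) ℤ.- (+ i) ℤ.+ (+ j)))

-- s_α for a weak composition α (straightening, as in the paper)
pairs : List ℕ → List (ℕ × ℕ)
pairs [] = []
pairs (x ∷ xs) = map (λ y → (x , y)) xs ++ pairs xs

delta : ℕ → List ℕ
delta N = applyUpTo (λ i → N ∸ suc i) N

dropZerosEnd : List ℕ → List ℕ
dropZerosEnd xs = reverse (dropZ (reverse xs))
  where
  dropZ : List ℕ → List ℕ
  dropZ [] = []
  dropZ (zero ∷ ys) = dropZ ys
  dropZ (suc y ∷ ys) = suc y ∷ ys

sComp : List ℕ → Λ
sComp α =
  if hasRep then [] else signΛ inv (schur lam)
  where
  N = length α
  β = zipWith ℕ._+_ α (delta N)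
  hasRep = foldr (λ { (x , y) b → (x ≡ᵇ y) ∨ b }) false (pairs β)
  -- number of inversions w.r.t. decreasing order = parity of the sorting permutation
  inv = length (filter (λ { (x , y) → x ℕ.<? y }) (pairs β))
  lam = dropZerosEnd (zipWith _∸_ (sortDesc β) (delta N))

IsPartition : List ℕ → Set
IsPartition μ = All (λ m → 0 ℕ.< m) μ × Linked ℕ._≥_ μ

size : List ℕ → ℕ
size = sum

pad : ℕ → List ℕ → List ℕ
pad v μ = μ ++ replicate ((size μ ℕ.+ v) ∸ length μ) 0

addAt : ℕ → ℕ → List ℕ → List ℕ
addAt i v [] = []
addAt zero v (x ∷ xs) = (x ℕ.+ v) ∷ xs
addAt (suc i) v (x ∷ xs) = x ∷ addAt i v xs

{-# OPTIONS --safe #-}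
-- Put a = q^u, y = 1/(qz) and Y = X/(1-q). The ring homomorphism F ↦ F[Y + M[u]_q/((1-q)z)] sends h_n[X] to
-- h̃_n with h̃_n - a y h̃_{n-1} = h_n[Y] - y h_{n-1}[Y], because both sides have power sums p_k[Y] - y^k; and the
-- coefficients g_j of Ω[-z[u]_t X], rescaled by q^{-j}, satisfy Σ_j a^j h_{n-j}[Y] g_j = a^n h_n[Y]. Expanding the
-- Jacobi–Trudi determinant along its last row and inducting on the number of rows, the coefficient of z^v becomes
-- the sum over rows of the theorem plus a multiple of the coefficient of y^v in
-- g(y) ∏_i (1 - y σ_i)/(1 - y σ_i / a) s_μ, where σ_i raises the i-th row. By antisymmetry of the determinant in
-- its rows this remainder vanishes once at least v zero rows have been appended to μ.
module Submission where

open import Level using (0ℓ)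
open import Algebra.Bundles using (CommutativeRing; CommutativeMonoid; RawRing)
import Algebra.Construct.DirectProduct as DirectProduct
import Algebra.Properties.Semiring.Mult as SemiringMult
open import Algebra.Solver.Ring.AlmostCommutativeRing using (fromCommutativeRing; _-Raw-AlmostCommutative⟶_)
open import Data.Bool as Bool using (Bool; true; false; if_then_else_; _∨_)
import Data.Bool.Properties as Bool
open import Data.Empty using (⊥-elim)
open import Data.Integer as ℤ using (ℤ; +_; -[1+_])
import Data.Integer.Properties as ℤ
open import Data.List as List using (List; []; _∷_; _++_; map; foldr; concatMap; applyUpTo; zipWith; length; replicate; filter; reverse)
import Data.List.Properties as List
open import Data.List.Relation.Binary.Permutation.Propositional as ↭ using (_↭_)
import Data.List.Relation.Binary.Permutation.Propositional.Properties as ↭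
open import Data.List.Relation.Unary.All as All using (All; []; _∷_)
import Data.List.Relation.Unary.All.Properties as All
open import Data.Maybe using (Maybe; just; nothing)
open import Data.Nat as ℕ using (ℕ; zero; suc; z≤n; s≤s; _!; _∸_)
open import Data.Nat.ListAction using (sum)
import Data.Nat.Properties as ℕ
open import Data.Product using (_×_; _,_; proj₁; proj₂; ∃)
open import Data.Rational as ℚ using (ℚ; 0ℚ; 1ℚ)
import Data.Rational.Properties as ℚ
import Data.Rational.Unnormalised as ℚᵘ
import Data.Rational.Unnormalised.Properties as ℚᵘ
open import Data.Sum using (inj₁; inj₂)
open import Data.Unit using (⊤; tt)
open import Data.Vec as Vec using (Vec; []; _∷_; _∷ʳ_)
import Data.Vec.Properties as Vec
open import Data.Vec.Relation.Binary.Pointwise.Inductive as Pointwise using (Pointwise; []; _∷_)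
open import Data.Vec.Relation.Unary.All as VecAll using ([]; _∷_)
import Data.Vec.Relation.Unary.All.Properties as VecAll
open import Function using (_∘_)
open import Relation.Binary.Definitions using (tri<; tri≈; tri>)
open import Relation.Binary.PropositionalEquality as ≡ using (_≡_)
open import Relation.Nullary using (does; yes; no; contradiction)
open import Relation.Unary using (Pred; Decidable)
open import Defs using (skip; insertDesc; sortDesc; pairs; delta; dropZerosEnd; at; addAt; Poly; _+P_; scaleP; _*P_; coeffP; adamsP;
  Qq; _/ₚ_; _≈Q_; _+Q_; _*Q_; -Q_; invQ; 0Q; 1Q; adamsQ)

-- The choice of y rests on 1 - t = -t(1 - q), which turns M[u]_q/((1-q)z) into (a - 1)y and -z[u]_t
-- X into qz(1 - 1/a)Y. Why the remainder vanishes: let r_j be the coefficient of y^j in it, for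
-- rows β ending in M zeros. Then Σ_j a^j h_{m-j} r_j is the sum of a^w s_{(β+γ,w)} over
-- compositions γ and w ≥ 0 with w + |γ| = m. With weight 1 instead of a^w this sum is h_m s_β,
-- because it inverts the expansion along the last row. The two sums differ only in terms with w >
-- 0. If m ≤ M, then γ is too small to fill the zeros above w, and exchanges of adjacent rows show
-- that each such term equals its own negative. Since r_0 = s_β, what is left is Σ_{j≥1} a^j h_{m-j}
-- r_j = 0 for 1 ≤ m ≤ M, and this triangular system forces r_1 = ... = r_M = 0. A second obstacle
-- is the encoding. Raw fractions with possibly zero denominators do not form a ring, not even up to
-- cross-multiplication, and symmetric functions are unnormalised lists. The computation therefore
-- takes place in commutative rings built over these data, and the result is carried back by
-- forgetting the extra structure.

-- Polynomial identities with integer coefficients in an arbitrary commutative ring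

module IntegerSolver (R : CommutativeRing 0ℓ 0ℓ) where
  open CommutativeRing R
  open import Algebra.Properties.Ring ring
  open import Algebra.Properties.AbelianGroup +-abelianGroup using (⁻¹-∙-comm)
  open import Algebra.Properties.Semiring.Mult.TCOptimised semiring renaming (_×_ to _×′_)
  open import Relation.Binary.Reasoning.Setoid setoid

  fromℤ : ℤ → Carrier
  fromℤ (+ n) = n ×′ 1#
  fromℤ -[1+ n ] = - (suc n ×′ 1#)

  fromℤ-⊖ : ∀ m n → fromℤ (m ℤ.⊖ n) ≈ m ×′ 1# - n ×′ 1#
  fromℤ-⊖ m zero = sym (trans (+-congˡ -0#≈0#) (+-identityʳ _))
  fromℤ-⊖ zero (suc n) = sym (+-identityˡ _)
  fromℤ-⊖ (suc m) (suc n) = begin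
    fromℤ (suc m ℤ.⊖ suc n)                 ≡⟨ ≡.cong fromℤ (ℤ.[1+m]⊖[1+n]≡m⊖n m n) ⟩
    fromℤ (m ℤ.⊖ n)                         ≈⟨ fromℤ-⊖ m n ⟩
    m ×′ 1# - n ×′ 1#                         ≈⟨ +-congʳ (+-identityˡ _) ⟨
    (0# + m ×′ 1#) - n ×′ 1#                  ≈⟨ +-congʳ (+-congʳ (-‿inverseʳ 1#)) ⟨
    ((1# - 1#) + m ×′ 1#) - n ×′ 1#           ≈⟨ +-congʳ (+-assoc _ _ _) ⟩
    (1# + (- 1# + m ×′ 1#)) - n ×′ 1#         ≈⟨ +-congʳ (+-congˡ (+-comm _ _)) ⟩
    (1# + (m ×′ 1# + - 1#)) - n ×′ 1#         ≈⟨ +-congʳ (+-assoc _ _ _) ⟨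
    ((1# + m ×′ 1#) + - 1#) - n ×′ 1#         ≈⟨ +-assoc _ _ _ ⟩
    (1# + m ×′ 1#) + (- 1# + - (n ×′ 1#))     ≈⟨ +-cong (sym (1+× m 1#)) (trans (⁻¹-∙-comm 1# (n ×′ 1#)) (-‿cong (sym (1+× n 1#)))) ⟩
    suc m ×′ 1# - suc n ×′ 1#                 ∎

  fromℤ-+ : ∀ i j → fromℤ (i ℤ.+ j) ≈ fromℤ i + fromℤ j
  fromℤ-+ (+ m) (+ n) = ×-homo-+ 1# m n
  fromℤ-+ (+ m) -[1+ n ] = fromℤ-⊖ m (suc n)
  fromℤ-+ -[1+ m ] (+ n) = trans (fromℤ-⊖ n (suc m)) (+-comm _ _)
  fromℤ-+ -[1+ m ] -[1+ n ] = trans (-‿cong (trans (reflexive (≡.cong (λ k → suc k ×′ 1#) (≡.sym (ℕ.+-suc m n)))) (×-homo-+ 1# (suc m) (suc n)))) (sym (⁻¹-∙-comm _ _))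

  fromℤ-neg : ∀ i → fromℤ (ℤ.- i) ≈ - fromℤ i
  fromℤ-neg (+ zero) = sym -0#≈0#
  fromℤ-neg (+ suc n) = refl
  fromℤ-neg -[1+ n ] = sym (-‿involutive _)

  fromℤ-*⁺ : ∀ m j → fromℤ (+ m ℤ.* j) ≈ m ×′ 1# * fromℤ j
  fromℤ-*⁺ m (+ n) = trans (reflexive (≡.cong fromℤ (≡.sym (ℤ.pos-* m n)))) (×1-homo-* m n)
  fromℤ-*⁺ m -[1+ n ] = begin
    fromℤ (+ m ℤ.* -[1+ n ])        ≡⟨ ≡.cong fromℤ (≡.sym (ℤ.neg-distribʳ-* (+ m) (+ suc n))) ⟩
    fromℤ (ℤ.- (+ m ℤ.* + suc n))   ≈⟨ fromℤ-neg (+ m ℤ.* + suc n) ⟩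
    - fromℤ (+ m ℤ.* + suc n)       ≈⟨ -‿cong (fromℤ-*⁺ m (+ suc n)) ⟩
    - (m ×′ 1# * (suc n ×′ 1#))       ≈⟨ -‿distribʳ-* _ _ ⟩
    m ×′ 1# * - (suc n ×′ 1#)         ∎

  fromℤ-* : ∀ i j → fromℤ (i ℤ.* j) ≈ fromℤ i * fromℤ j
  fromℤ-* (+ m) j = fromℤ-*⁺ m j
  fromℤ-* -[1+ m ] j = begin
    fromℤ (-[1+ m ] ℤ.* j)          ≡⟨ ≡.cong fromℤ (≡.sym (ℤ.neg-distribˡ-* (+ suc m) j)) ⟩
    fromℤ (ℤ.- (+ suc m ℤ.* j))     ≈⟨ fromℤ-neg (+ suc m ℤ.* j) ⟩
    - fromℤ (+ suc m ℤ.* j)         ≈⟨ -‿cong (fromℤ-*⁺ (suc m) j) ⟩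
    - (suc m ×′ 1# * fromℤ j)        ≈⟨ -‿distribˡ-* _ _ ⟩
    - (suc m ×′ 1#) * fromℤ j        ∎

  private
    ℤ-rawRing : RawRing 0ℓ 0ℓ
    ℤ-rawRing = record { Carrier = ℤ ; _≈_ = _≡_ ; _+_ = ℤ._+_ ; _*_ = ℤ._*_ ; -_ = ℤ.-_ ; 0# = + 0 ; 1# = + 1 }

    homomorphism : ℤ-rawRing -Raw-AlmostCommutative⟶ fromCommutativeRing R
    homomorphism = record
      { ⟦_⟧ = fromℤ ; +-homo = fromℤ-+ ; *-homo = fromℤ-* ; -‿homo = fromℤ-neg ; 0-homo = refl ; 1-homo = refl }

    coeff≟ : ∀ i j → Maybe (fromℤ i ≈ fromℤ j)
    coeff≟ i j with i ℤ.≟ j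
    ... | yes i≡j = just (reflexive (≡.cong fromℤ i≡j))
    ... | no _ = nothing

  open import Algebra.Solver.Ring ℤ-rawRing (fromCommutativeRing R) homomorphism coeff≟ public
    using (solve; _:=_; _:+_; _:*_; _:-_; :-_; con)

-- Alternating sums and Schur functions

sucℤ predℤ : ℤ → ℤ
sucℤ (+ n) = + suc n
sucℤ -[1+ zero ] = + 0
sucℤ -[1+ suc n ] = -[1+ n ]
predℤ (+ zero) = -[1+ 0 ]
predℤ (+ suc n) = + n
predℤ -[1+ n ] = -[1+ suc n ]

suc-pred : ∀ i → sucℤ (predℤ i) ≡ i
suc-pred (+ zero) = ≡.refl
suc-pred (+ suc n) = ≡.refl
suc-pred -[1+ n ] = ≡.refl

pred-suc : ∀ i → predℤ (sucℤ i) ≡ i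
pred-suc (+ n) = ≡.refl
pred-suc -[1+ zero ] = ≡.refl
pred-suc -[1+ suc n ] = ≡.refl

module AlternatingSums (R : CommutativeRing 0ℓ 0ℓ) where
  open CommutativeRing R hiding (zero)
  open IntegerSolver R
  open import Algebra.Properties.Ring ring using (-0#≈0#; -‿distribʳ-*)
  open import Relation.Binary.Reasoning.Setoid setoid

  -- alt s p β m F = Σ_ε (-1)^|ε| F (p^|ε| m) (β with s applied where ε = 1), over ε ∈ {0,1}ⁿ.
  alt : (s p : ℤ → ℤ) → ∀ {n} → Vec ℤ n → ℤ → (ℤ → Vec ℤ n → Carrier) → Carrier
  alt s p [] m F = F m []
  alt s p (b ∷ β) m F = alt s p β m (λ k γ → F k (b ∷ γ)) - alt s p β (p m) (λ k γ → F k (s b ∷ γ))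

  module _ {s p : ℤ → ℤ} where

    alt-cong : ∀ {n} (β : Vec ℤ n) {m F G} → (∀ k γ → F k γ ≈ G k γ) → alt s p β m F ≈ alt s p β m G
    alt-cong [] F≈G = F≈G _ []
    alt-cong (b ∷ β) F≈G = +-cong (alt-cong β (λ k γ → F≈G k _)) (-‿cong (alt-cong β (λ k γ → F≈G k _)))

    alt-+ : ∀ {n} (β : Vec ℤ n) {m} F G → alt s p β m (λ k γ → F k γ + G k γ) ≈ alt s p β m F + alt s p β m G
    alt-+ [] F G = refl
    alt-+ (b ∷ β) F G = trans (+-cong (alt-+ β _ _) (-‿cong (alt-+ β _ _)))
      (solve 4 (λ x y z w → (x :+ y) :- (z :+ w) := (x :- z) :+ (y :- w)) refl _ _ _ _)

    alt-* : ∀ {n} (β : Vec ℤ n) {m} c F → alt s p β m (λ k γ → c * F k γ) ≈ c * alt s p β m F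
    alt-* [] c F = refl
    alt-* (b ∷ β) c F = trans (+-cong (alt-* β _ _) (-‿cong (alt-* β _ _)))
      (solve 3 (λ c x y → c :* x :- c :* y := c :* (x :- y)) refl _ _ _)

    alt-neg : ∀ {n} (β : Vec ℤ n) {m} F → alt s p β m (λ k γ → - F k γ) ≈ - alt s p β m F
    alt-neg [] F = refl
    alt-neg (b ∷ β) F = trans (+-cong (alt-neg β _) (-‿cong (alt-neg β _)))
      (solve 2 (λ x y → (:- x) :- (:- y) := :- (x :- y)) refl _ _)

    alt-- : ∀ {n} (β : Vec ℤ n) {m} F G → alt s p β m (λ k γ → F k γ - G k γ) ≈ alt s p β m F - alt s p β m G
    alt-- β F G = trans (alt-+ β _ _) (+-congˡ (alt-neg β _))

    alt-0 : ∀ {n} (β : Vec ℤ n) {m F} → (∀ k γ → F k γ ≈ 0#) → alt s p β m F ≈ 0#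
    alt-0 [] F≈0 = F≈0 _ []
    alt-0 (b ∷ β) F≈0 = trans (+-cong (alt-0 β (λ k γ → F≈0 k _)) (-‿cong (alt-0 β (λ k γ → F≈0 k _)))) (-‿inverseʳ 0#)

    -- The index is only ever changed by `p`, so a map commuting with `p` can be moved to the
    -- starting index.
    alt-index : ∀ {n} (β : Vec ℤ n) {m} F (f : ℤ → ℤ) → (∀ i → f (p i) ≡ p (f i)) →
      alt s p β m (λ k γ → F (f k) γ) ≈ alt s p β (f m) F
    alt-index [] F f fp = refl
    alt-index (b ∷ β) {m} F f fp = +-cong (alt-index β _ f fp)
      (-‿cong (trans (alt-index β _ f fp) (reflexive (≡.cong (λ i → alt s p β i _) (fp m)))))

    alt-∷ʳ : ∀ {n} (β : Vec ℤ n) {b m} F →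
      alt s p (β ∷ʳ b) m F ≈ alt s p β m (λ k γ → F k (γ ∷ʳ b)) - alt s p β (p m) (λ k γ → F k (γ ∷ʳ s b))
    alt-∷ʳ [] F = refl
    alt-∷ʳ (c ∷ β) F = trans (+-cong (alt-∷ʳ β _) (-‿cong (alt-∷ʳ β _)))
      (solve 4 (λ x y z w → (x :- y) :- (z :- w) := (x :- z) :- (y :- w)) refl _ _ _ _)

    -- Sign and index depend only on the number of chosen entries, not on their positions.
    alt-reverse : ∀ {n} (β : Vec ℤ n) {m} F → alt s p (Vec.reverse β) m F ≈ alt s p β m (λ k γ → F k (Vec.reverse γ))
    alt-reverse [] F = refl
    alt-reverse (b ∷ β) {m} F = begin
      alt s p (Vec.reverse (b ∷ β)) m F
        ≡⟨ ≡.cong (λ γ → alt s p γ m F) (Vec.reverse-∷ b β) ⟩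
      alt s p (Vec.reverse β ∷ʳ b) m F
        ≈⟨ alt-∷ʳ (Vec.reverse β) F ⟩
      alt s p (Vec.reverse β) m (λ k γ → F k (γ ∷ʳ b)) - alt s p (Vec.reverse β) (p m) (λ k γ → F k (γ ∷ʳ s b))
        ≈⟨ +-cong (alt-reverse β _) (-‿cong (alt-reverse β _)) ⟩
      alt s p β m (λ k γ → F k (Vec.reverse γ ∷ʳ b)) - alt s p β (p m) (λ k γ → F k (Vec.reverse γ ∷ʳ s b))
        ≈⟨ +-cong (alt-cong β (λ k γ → reflexive (≡.cong (F k) (≡.sym (Vec.reverse-∷ b γ)))))
                  (-‿cong (alt-cong β (λ k γ → reflexive (≡.cong (F k) (≡.sym (Vec.reverse-∷ (s b) γ)))))) ⟩
      alt s p (b ∷ β) m (λ k γ → F k (Vec.reverse γ)) ∎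

  -- Both sides run over the same pairs of subsets; commutation of `s` and `s′` matters at an entry
  -- chosen by both.
  alt-alt : ∀ {s p s′ p′} → (∀ i → s (s′ i) ≡ s′ (s i)) →
    ∀ {n} (β : Vec ℤ n) {m m′} (F : ℤ → ℤ → Vec ℤ n → Carrier) →
    alt s p β m (λ k γ → alt s′ p′ γ m′ (λ k′ δ → F k k′ δ)) ≈ alt s′ p′ β m′ (λ k′ γ → alt s p γ m (λ k δ → F k k′ δ))
  alt-alt ss [] F = refl
  alt-alt {s} {p} {s′} {p′} ss (b ∷ β) {m} {m′} F = begin
    alt s p β m (λ k γ → alt s′ p′ (b ∷ γ) m′ (F k)) - alt s p β (p m) (λ k γ → alt s′ p′ (s b ∷ γ) m′ (F k))
      ≈⟨ +-cong (alt-- β _ _) (-‿cong (alt-- β _ _)) ⟩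
    (X b m m′ - X (s′ b) m (p′ m′)) - (X (s b) (p m) m′ - X (s′ (s b)) (p m) (p′ m′))
      ≈⟨ +-cong (+-cong (IH b) (-‿cong (IH (s′ b)))) (-‿cong (+-cong (IH (s b)) (-‿cong (trans (IH (s′ (s b))) (reflexive (≡.cong (λ c → Y c (p m) (p′ m′)) (≡.sym (ss b)))))))) ⟩
    (Y b m m′ - Y (s′ b) m (p′ m′)) - (Y (s b) (p m) m′ - Y (s (s′ b)) (p m) (p′ m′))
      ≈⟨ solve 4 (λ x y z w → (x :- y) :- (z :- w) := (x :- z) :- (y :- w)) refl _ _ _ _ ⟩
    (Y b m m′ - Y (s b) (p m) m′) - (Y (s′ b) m (p′ m′) - Y (s (s′ b)) (p m) (p′ m′))
      ≈⟨ +-cong (alt-- β _ _) (-‿cong (alt-- β _ _)) ⟨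
    alt s′ p′ β m′ (λ k′ γ → alt s p (b ∷ γ) m (λ k δ → F k k′ δ)) - alt s′ p′ β (p′ m′) (λ k′ γ → alt s p (s′ b ∷ γ) m (λ k δ → F k k′ δ)) ∎
    where
    X Y : ℤ → ℤ → ℤ → Carrier
    X c m m′ = alt s p β m (λ k γ → alt s′ p′ γ m′ (λ k′ δ → F k k′ (c ∷ δ)))
    Y c m m′ = alt s′ p′ β m′ (λ k′ γ → alt s p γ m (λ k δ → F k k′ (c ∷ δ)))
    IH : ∀ c {m m′} → X c m m′ ≈ Y c m m′
    IH c = alt-alt ss β (λ k k′ δ → F k k′ (c ∷ δ))

  -- geom c χ n v = Σ_{j ≥ 0} c^j χ (n - j) (v + j), for χ vanishing at negative first argument.
  geom : Carrier → (ℤ → ℤ → Carrier) → ℤ → ℤ → Carrier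
  geom c χ (+ zero) v = χ (+ 0) v
  geom c χ (+ suc n) v = χ (+ suc n) v + c * geom c χ (+ n) (sucℤ v)
  geom c χ -[1+ n ] v = 0#

  -- The same sum with weights 1, c - 1, (c - 1) c, (c - 1) c², …
  quot : Carrier → (ℤ → ℤ → Carrier) → ℤ → ℤ → Carrier
  quot c χ n v = geom c χ n v - geom c χ (predℤ n) (sucℤ v)

  NegZero : {A : Set} → (ℤ → A → Carrier) → Set
  NegZero χ = ∀ n v → χ -[1+ n ] v ≈ 0#

  -- Vanishing at negative index extends the recursion to all of ℤ, which spares later arguments a
  -- case distinction at the boundary.
  geom-rec : ∀ {c χ} → NegZero χ → ∀ n v → geom c χ n v ≈ χ n v + c * geom c χ (predℤ n) (sucℤ v)
  geom-rec χ0 (+ zero) v = sym (trans (+-congˡ (zeroʳ _)) (+-identityʳ _))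
  geom-rec χ0 (+ suc n) v = refl
  geom-rec χ0 -[1+ n ] v = sym (trans (+-cong (χ0 n v) (zeroʳ _)) (+-identityʳ _))

  -- Each use of the recursion lowers `n`, and below 0 the value is fixed. Sums are recognised as
  -- `geom` by exhibiting this recursion.
  geom-unique : ∀ {c χ} (X : ℤ → ℤ → Carrier) → NegZero X →
    (∀ n v → X (+ n) v ≈ χ (+ n) v + c * X (predℤ (+ n)) (sucℤ v)) → ∀ n v → X n v ≈ geom c χ n v
  geom-unique X X0 rec (+ zero) v = trans (rec 0 v) (trans (+-congˡ (trans (*-congˡ (X0 0 _)) (zeroʳ _))) (+-identityʳ _))
  geom-unique X X0 rec (+ suc n) v = trans (rec (suc n) v) (+-congˡ (*-congˡ (geom-unique X X0 rec (+ n) (sucℤ v))))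
  geom-unique X X0 rec -[1+ n ] v = X0 n v

  geom-cong : ∀ {c χ ψ} → (∀ n v → χ n v ≈ ψ n v) → ∀ n v → geom c χ n v ≈ geom c ψ n v
  geom-cong e (+ zero) v = e _ _
  geom-cong e (+ suc n) v = +-cong (e _ _) (*-congˡ (geom-cong e (+ n) _))
  geom-cong e -[1+ n ] v = refl

  -- The second argument only grows, so nonnegative values suffice. This serves identities that are
  -- available only for nonnegative powers, such as `τ-rows-rest`.
  geom-cong⁺ : ∀ {c χ ψ} → (∀ n v → χ n (+ v) ≈ ψ n (+ v)) → ∀ n v → geom c χ n (+ v) ≈ geom c ψ n (+ v)
  geom-cong⁺ e (+ zero) v = e _ _
  geom-cong⁺ e (+ suc n) v = +-cong (e _ _) (*-congˡ (geom-cong⁺ e (+ n) _))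
  geom-cong⁺ e -[1+ n ] v = refl

  geom-+ : ∀ {c} χ ψ n v → geom c (λ i j → χ i j + ψ i j) n v ≈ geom c χ n v + geom c ψ n v
  geom-+ χ ψ (+ zero) v = refl
  geom-+ χ ψ (+ suc n) v = trans (+-congˡ (*-congˡ (geom-+ χ ψ (+ n) _)))
    (solve 5 (λ c x y z w → (x :+ y) :+ c :* (z :+ w) := (x :+ c :* z) :+ (y :+ c :* w)) refl _ _ _ _ _)
  geom-+ χ ψ -[1+ n ] v = sym (+-identityʳ _)

  geom-* : ∀ {c} d χ n v → geom c (λ i j → d * χ i j) n v ≈ d * geom c χ n v
  geom-* d χ (+ zero) v = refl
  geom-* d χ (+ suc n) v = trans (+-congˡ (*-congˡ (geom-* d χ (+ n) _)))
    (solve 4 (λ c d x z → d :* x :+ c :* (d :* z) := d :* (x :+ c :* z)) refl _ _ _ _)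
  geom-* d χ -[1+ n ] v = sym (zeroʳ _)

  geom-neg : ∀ {c} χ n v → geom c (λ i j → - χ i j) n v ≈ - geom c χ n v
  geom-neg χ (+ zero) v = refl
  geom-neg χ (+ suc n) v = trans (+-congˡ (*-congˡ (geom-neg χ (+ n) _)))
    (solve 3 (λ c x z → (:- x) :+ c :* (:- z) := :- (x :+ c :* z)) refl _ _ _)
  geom-neg χ -[1+ n ] v = sym -0#≈0#

  geom-- : ∀ {c} χ ψ n v → geom c (λ i j → χ i j - ψ i j) n v ≈ geom c χ n v - geom c ψ n v
  geom-- χ ψ n v = trans (geom-+ χ (λ i j → - ψ i j) n v) (+-congˡ (geom-neg ψ n v))

  geom-shift : ∀ {c} χ (f : ℤ → ℤ) → (∀ i → f (sucℤ i) ≡ sucℤ (f i)) → ∀ n v →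
    geom c (λ i j → χ i (f j)) n v ≈ geom c χ n (f v)
  geom-shift χ f fs (+ zero) v = refl
  geom-shift {c} χ f fs (+ suc n) v = +-congˡ (*-congˡ (trans (geom-shift χ f fs (+ n) (sucℤ v)) (reflexive (≡.cong (geom c χ (+ n)) (fs v)))))
  geom-shift χ f fs -[1+ n ] v = refl

  geom-0 : ∀ {c χ} → (∀ n v → χ n v ≈ 0#) → ∀ n v → geom c χ n v ≈ 0#
  geom-0 e n v = sym (geom-unique (λ _ _ → 0#) (λ _ _ → refl) (λ n v → sym (trans (+-cong (e _ _) (zeroʳ _)) (+-identityʳ _))) n v)

  quot-cong : ∀ {c χ ψ} → (∀ n v → χ n v ≈ ψ n v) → ∀ n v → quot c χ n v ≈ quot c ψ n v
  quot-cong e n v = +-cong (geom-cong e n v) (-‿cong (geom-cong e (predℤ n) (sucℤ v)))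

  quot-cong⁺ : ∀ {c χ ψ} → (∀ n v → χ n (+ v) ≈ ψ n (+ v)) → ∀ n v → quot c χ n (+ v) ≈ quot c ψ n (+ v)
  quot-cong⁺ e n v = +-cong (geom-cong⁺ e n v) (-‿cong (geom-cong⁺ e (predℤ n) (suc v)))

  quot-+ : ∀ {c} χ ψ n v → quot c (λ i j → χ i j + ψ i j) n v ≈ quot c χ n v + quot c ψ n v
  quot-+ χ ψ n v = trans (+-cong (geom-+ χ ψ n v) (-‿cong (geom-+ χ ψ (predℤ n) (sucℤ v))))
    (solve 4 (λ x y z w → (x :+ y) :- (z :+ w) := (x :- z) :+ (y :- w)) refl _ _ _ _)

  quot-* : ∀ {c} d χ n v → quot c (λ i j → d * χ i j) n v ≈ d * quot c χ n v
  quot-* d χ n v = trans (+-cong (geom-* d χ n v) (-‿cong (geom-* d χ (predℤ n) (sucℤ v))))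
    (solve 3 (λ d x y → d :* x :- d :* y := d :* (x :- y)) refl _ _ _)

  quot-- : ∀ {c} χ ψ n v → quot c (λ i j → χ i j - ψ i j) n v ≈ quot c χ n v - quot c ψ n v
  quot-- χ ψ n v = trans (+-cong (geom-- χ ψ n v) (-‿cong (geom-- χ ψ (predℤ n) (sucℤ v))))
    (solve 4 (λ x y z w → (x :- y) :- (z :- w) := (x :- z) :- (y :- w)) refl _ _ _ _)

  quot-shift : ∀ {c} χ (f : ℤ → ℤ) → (∀ i → f (sucℤ i) ≡ sucℤ (f i)) → ∀ n v →
    quot c (λ i j → χ i (f j)) n v ≈ quot c χ n (f v)
  quot-shift {c} χ f fs n v = +-cong (geom-shift χ f fs n v)
    (-‿cong (trans (geom-shift χ f fs (predℤ n) (sucℤ v)) (reflexive (≡.cong (geom c χ (predℤ n)) (fs v)))))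

  -- This is c(1 - x)/(1 - cx) = (c - 1)/(1 - cx) + 1, where x lowers the first index and raises the
  -- second.
  quot-geom : ∀ {c χ} → NegZero χ → ∀ n v → c * quot c χ n v ≈ (c - 1#) * geom c χ n v + χ n v
  quot-geom {c} {χ} χ0 n v = trans
    (solve 4 (λ c x y z → c :* (x :- y) := (c :* x :- (z :+ c :* y)) :+ z) refl c (geom c χ n v) (geom c χ (predℤ n) (sucℤ v)) (χ n v))
    (trans (+-congʳ (+-congˡ (-‿cong (sym (geom-rec χ0 n v)))))
    (+-congʳ (solve 2 (λ c x → c :* x :- x := (c :- con (+ 1)) :* x) refl _ _)))

  quot-rec : ∀ {c χ} → NegZero χ → ∀ n v →
    quot c χ n v - c * quot c χ (predℤ n) (sucℤ v) ≈ χ n v - χ (predℤ n) (sucℤ v)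
  quot-rec {c} {χ} χ0 n v = trans
    (+-congʳ (+-cong (geom-rec χ0 n v) (-‿cong (geom-rec χ0 (predℤ n) (sucℤ v)))))
    (solve 5 (λ c x y z w → ((x :+ c :* z) :- (y :+ c :* w)) :- c :* (z :- w) := x :- y) refl c _ _ _ _)

  -- The hypothesis says (1 - cx)X = (1 - x)χ, and 1 - cx is invertible on families that vanish at
  -- negative first index.
  quot-unique : ∀ {c χ} → NegZero χ → (X : ℤ → ℤ → Carrier) → NegZero X →
    (∀ n v → X n v - c * X (predℤ n) (sucℤ v) ≈ χ n v - χ (predℤ n) (sucℤ v)) → ∀ n v → X n v ≈ quot c χ n v
  quot-unique {c} {χ} χ0 X X0 rec n v = trans (geom-unique {c} {ψ} X X0 Xrec n v) (sym (geom-unique (quot c χ) Q0 Qrec n v))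
    where
    ψ : ℤ → ℤ → Carrier
    ψ n v = χ n v - χ (predℤ n) (sucℤ v)
    move : ∀ {x y z} → x - y ≈ z → x ≈ z + y
    move {x} {y} {z} e = trans (solve 2 (λ x y → x := (x :- y) :+ y) refl x y) (+-congʳ e)
    Xrec : ∀ n v → X (+ n) v ≈ ψ (+ n) v + c * X (predℤ (+ n)) (sucℤ v)
    Xrec n v = move (rec (+ n) v)
    Q0 : NegZero (quot c χ)
    Q0 n v = -‿inverseʳ 0#
    Qrec : ∀ n v → quot c χ (+ n) v ≈ ψ (+ n) v + c * quot c χ (predℤ (+ n)) (sucℤ v)
    Qrec n v = move (quot-rec χ0 (+ n) v)

  alt-geom : ∀ {s p c n} (β : Vec ℤ n) {m} (χ : ℤ → Vec ℤ n → ℤ → ℤ → Carrier) i j →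
    alt s p β m (λ k γ → geom c (χ k γ) i j) ≈ geom c (λ i j → alt s p β m (λ k γ → χ k γ i j)) i j
  alt-geom β χ (+ zero) j = refl
  alt-geom β χ (+ suc i) j = trans (alt-+ β _ _) (+-congˡ (trans (alt-* β _ _) (*-congˡ (alt-geom β χ (+ i) (sucℤ j)))))
  alt-geom β χ -[1+ i ] j = alt-0 β (λ k γ → refl)

  alt-quot : ∀ {s p c n} (β : Vec ℤ n) {m} (χ : ℤ → Vec ℤ n → ℤ → ℤ → Carrier) i j →
    alt s p β m (λ k γ → quot c (χ k γ) i j) ≈ quot c (λ i j → alt s p β m (λ k γ → χ k γ i j)) i j
  alt-quot β χ i j = trans (alt-- β _ _) (+-cong (alt-geom β χ i j) (-‿cong (alt-geom β χ (predℤ i) (sucℤ j))))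

  alt-pred-0 : ∀ {s n} (β : Vec ℤ n) {F} → NegZero F → ∀ m → alt s predℤ β -[1+ m ] F ≈ 0#
  alt-pred-0 [] F0 m = F0 m []
  alt-pred-0 (b ∷ β) F0 m = trans (+-cong (alt-pred-0 β (λ k γ → F0 k _) m) (-‿cong (alt-pred-0 β (λ k γ → F0 k _) (suc m)))) (-‿inverseʳ 0#)

  -- Every choice other than the empty one makes the index negative.
  alt-pred-+0 : ∀ {s n} (β : Vec ℤ n) {F} → NegZero F → alt s predℤ β (+ 0) F ≈ F (+ 0) β
  alt-pred-+0 [] F0 = refl
  alt-pred-+0 (b ∷ β) F0 = trans (+-cong (alt-pred-+0 β (λ k γ → F0 k _)) (-‿cong (alt-pred-0 β (λ k γ → F0 k _) 0)))
    (trans (+-congˡ -0#≈0#) (+-identityʳ _))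

  module Schur (h : ℤ → Carrier) where

    schurBy : (s p : ℤ → ℤ) → ∀ {n} → Vec ℤ n → Carrier
    schurBy s p [] = 1#
    schurBy s p (m ∷ β) = alt s p β m (λ k γ → h k * schurBy s p γ)

    -- The Schur function of the row lengths m ∷ β, listed from the last row to the first
    -- (expansion of the Jacobi–Trudi determinant along its last row) and
    -- from the first row to the last (expansion along its first row).
    schur↑ schur↓ : ∀ {n} → Vec ℤ n → Carrier
    schur↑ = schurBy sucℤ predℤ
    schur↓ = schurBy predℤ sucℤ

    -- Expanding along both the first row `b` and the last row `m` gives two alternating sums that
    -- commute by `alt-alt`. Choosing `m` in the outer sum lowers `m` and raises `b`, which is also
    -- the effect of choosing `b` in the other order.
    schur↓-∷ʳ : ∀ {n} (β : Vec ℤ n) m → schur↓ (β ∷ʳ m) ≈ alt sucℤ predℤ β m (λ k γ → h k * schur↓ γ)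
    schur↓-∷ʳ [] m = refl
    schur↓-∷ʳ (b ∷ β) m = begin
      alt predℤ sucℤ (β ∷ʳ m) b (λ k γ → h k * schur↓ γ)
        ≈⟨ alt-∷ʳ β _ ⟩
      alt predℤ sucℤ β b (λ k γ → h k * schur↓ (γ ∷ʳ m)) - alt predℤ sucℤ β (sucℤ b) (λ k γ → h k * schur↓ (γ ∷ʳ predℤ m))
        ≈⟨ +-cong (step b m) (-‿cong (step (sucℤ b) (predℤ m))) ⟩
      alt sucℤ predℤ β m (λ l γ → h l * schur↓ (b ∷ γ)) - alt sucℤ predℤ β (predℤ m) (λ l γ → h l * schur↓ (sucℤ b ∷ γ)) ∎
      where
      step : ∀ b m → alt predℤ sucℤ β b (λ k γ → h k * schur↓ (γ ∷ʳ m)) ≈ alt sucℤ predℤ β m (λ l γ → h l * schur↓ (b ∷ γ))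
      step b m = begin
        alt predℤ sucℤ β b (λ k γ → h k * schur↓ (γ ∷ʳ m))
          ≈⟨ alt-cong β (λ k γ → trans (*-congˡ (schur↓-∷ʳ γ m)) (sym (alt-* γ _ _))) ⟩
        alt predℤ sucℤ β b (λ k γ → alt sucℤ predℤ γ m (λ l δ → h k * (h l * schur↓ δ)))
          ≈⟨ alt-alt (λ i → ≡.trans (pred-suc i) (≡.sym (suc-pred i))) β _ ⟩
        alt sucℤ predℤ β m (λ l γ → alt predℤ sucℤ γ b (λ k δ → h k * (h l * schur↓ δ)))
          ≈⟨ alt-cong β (λ l γ → trans (alt-cong γ (λ k δ → solve 3 (λ x y z → x :* (y :* z) := y :* (x :* z)) refl _ _ _)) (alt-* γ _ _)) ⟩
        alt sucℤ predℤ β m (λ l γ → h l * schur↓ (b ∷ γ)) ∎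

    schur↑-reverse : ∀ {n} (β : Vec ℤ n) → schur↑ β ≈ schur↓ (Vec.reverse β)
    schur↑-reverse [] = refl
    schur↑-reverse (m ∷ β) = begin
      alt sucℤ predℤ β m (λ k γ → h k * schur↑ γ)
        ≈⟨ alt-cong β (λ k γ → *-congˡ (schur↑-reverse γ)) ⟩
      alt sucℤ predℤ β m (λ k γ → h k * schur↓ (Vec.reverse γ))
        ≈⟨ alt-reverse β _ ⟨
      alt sucℤ predℤ (Vec.reverse β) m (λ k γ → h k * schur↓ γ)
        ≈⟨ schur↓-∷ʳ (Vec.reverse β) m ⟨
      schur↓ (Vec.reverse β ∷ʳ m)
        ≡⟨ ≡.cong schur↓ (≡.sym (Vec.reverse-∷ m β)) ⟩
      schur↓ (Vec.reverse (m ∷ β)) ∎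

  -- The exchange rule s_(..,x,y,..) = -s_(..,y-1,x+1,..) at every pair of adjacent positions.
  -- Taking (`predℤ`, `sucℤ`) or (`sucℤ`, `predℤ`) for `s` and `p` adapts it to the two orders of
  -- listing the rows.
  Antisym : (s p : ℤ → ℤ) → ∀ {n} → (Vec ℤ n → Carrier) → Set
  Antisym s p {zero} f = ⊤
  Antisym s p {suc zero} f = ⊤
  Antisym s p {suc (suc n)} f = (∀ x y γ → f (x ∷ y ∷ γ) ≈ - f (s y ∷ p x ∷ γ)) × (∀ x → Antisym s p (λ γ → f (x ∷ γ)))

  module _ {s p : ℤ → ℤ} where

    Antisym-tail : ∀ {n} (f : Vec ℤ (suc n) → Carrier) → Antisym s p f → ∀ x → Antisym s p (λ γ → f (x ∷ γ))
    Antisym-tail {zero} f a x = tt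
    Antisym-tail {suc n} f a x = proj₂ a x

    Antisym-- : ∀ {n} {f g : Vec ℤ n → Carrier} → Antisym s p f → Antisym s p g → Antisym s p (λ γ → f γ - g γ)
    Antisym-- {zero} a b = tt
    Antisym-- {suc zero} a b = tt
    Antisym-- {suc (suc n)} a b =
      (λ x y γ → trans (+-cong (proj₁ a x y γ) (-‿cong (proj₁ b x y γ))) (solve 2 (λ x y → (:- x) :- (:- y) := :- (x :- y)) refl _ _)) ,
      λ x → Antisym-- (proj₂ a x) (proj₂ b x)

    Antisym-* : ∀ {n} {f : Vec ℤ n → Carrier} c → Antisym s p f → Antisym s p (λ γ → c * f γ)
    Antisym-* {zero} c a = tt
    Antisym-* {suc zero} c a = tt
    Antisym-* {suc (suc n)} c a =
      (λ x y γ → trans (*-congˡ (proj₁ a x y γ)) (sym (-‿distribʳ-* _ _))) , λ x → Antisym-* c (proj₂ a x)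

    module _ (sp : ∀ i → s (p i) ≡ i) (ps : ∀ i → p (s i) ≡ i) where

      -- Applying `s` to one of the two entries before the exchange amounts to applying it to the
      -- other position afterwards, since `s` commutes with `p`.
      Antisym-alt : ∀ {n} {m} {F : ℤ → Vec ℤ n → Carrier} → (∀ k → Antisym s p (F k)) → Antisym s p (λ γ → alt s p γ m F)
      Antisym-alt {zero} a = tt
      Antisym-alt {suc zero} a = tt
      Antisym-alt {suc (suc n)} {m} {F} a = swap ,
        λ x → Antisym-- (Antisym-alt (λ k → proj₂ (a k) x)) (Antisym-alt (λ k → proj₂ (a k) (s x)))
        where
        swap : ∀ x y γ → alt s p (x ∷ y ∷ γ) m F ≈ - alt s p (s y ∷ p x ∷ γ) m F
        swap x y γ = begin
          (Y x y m - Y x (s y) (p m)) - (Y (s x) y (p m) - Y (s x) (s y) (p (p m)))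
            ≈⟨ +-cong (+-cong (eq x y) (-‿cong (eq x (s y)))) (-‿cong (+-cong (eq (s x) y) (-‿cong (eq (s x) (s y))))) ⟩
          ((- Y (s y) (p x) m) - (- Y (s (s y)) (p x) (p m))) - ((- Y (s y) (p (s x)) (p m)) - (- Y (s (s y)) (p (s x)) (p (p m))))
            ≡⟨ ≡.cong (λ z → ((- Y (s y) (p x) m) - (- Y (s (s y)) (p x) (p m))) - ((- Y (s y) z (p m)) - (- Y (s (s y)) z (p (p m))))) (≡.trans (ps x) (≡.sym (sp x))) ⟩
          ((- Y (s y) (p x) m) - (- Y (s (s y)) (p x) (p m))) - ((- Y (s y) (s (p x)) (p m)) - (- Y (s (s y)) (s (p x)) (p (p m))))
            ≈⟨ solve 4 (λ x y z w → ((:- x) :- (:- y)) :- ((:- z) :- (:- w)) := :- ((x :- z) :- (y :- w))) refl _ _ _ _ ⟩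
          - ((Y (s y) (p x) m - Y (s y) (s (p x)) (p m)) - (Y (s (s y)) (p x) (p m) - Y (s (s y)) (s (p x)) (p (p m)))) ∎
          where
          Y : ℤ → ℤ → ℤ → Carrier
          Y x y m = alt s p γ m (λ k δ → F k (x ∷ y ∷ δ))
          eq : ∀ x y {m} → Y x y m ≈ - Y (s y) (p x) m
          eq x y = trans (alt-cong γ (λ k δ → proj₁ (a k) x y δ)) (alt-neg γ _)

      -- Expanding two rows gives `Z x y` minus `Z (p x) (s y)`, where `Z` is symmetric in its two
      -- indices because alternating sums commute. The exchange sends (x, y) to (s y, p x) and
      -- thereby interchanges the two terms.
      Antisym-schurBy : ∀ h {n} → Antisym s p (Schur.schurBy h s p {n})
      Antisym-schurBy h {zero} = tt
      Antisym-schurBy h {suc zero} = tt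
      Antisym-schurBy h {suc (suc n)} = swap , λ x → Antisym-alt {m = x} (λ k → Antisym-* (h k) (Antisym-schurBy h {suc n}))
        where
        open Schur h
        Z : ∀ x y → Vec ℤ n → Carrier
        Z x y γ = alt s p γ x (λ k δ → alt s p δ y (λ l ε → h k * (h l * schurBy s p ε)))
        expand : ∀ x y γ → schurBy s p (x ∷ y ∷ γ) ≈ Z x y γ - Z (p x) (s y) γ
        expand x y γ = +-cong (one x y) (-‿cong (one (p x) (s y)))
          where
          one : ∀ x y → alt s p γ x (λ k δ → h k * schurBy s p (y ∷ δ)) ≈ Z x y γ
          one x y = alt-cong γ (λ k δ → sym (alt-* δ _ _))
        Z-sym : ∀ x y γ → Z x y γ ≈ Z y x γ
        Z-sym x y γ = trans (alt-alt {s} {p} {s} {p} (λ i → ≡.refl) γ _)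
          (alt-cong γ (λ k δ → alt-cong δ (λ l ε → solve 3 (λ x y z → x :* (y :* z) := y :* (x :* z)) refl _ _ _)))
        swap : ∀ x y γ → schurBy s p (x ∷ y ∷ γ) ≈ - schurBy s p (s y ∷ p x ∷ γ)
        swap x y γ = begin
          schurBy s p (x ∷ y ∷ γ)                        ≈⟨ expand x y γ ⟩
          Z x y γ - Z (p x) (s y) γ                      ≈⟨ +-cong (Z-sym x y γ) (-‿cong (Z-sym (p x) (s y) γ)) ⟩
          Z y x γ - Z (s y) (p x) γ                      ≡⟨ ≡.cong₂ (λ i j → Z i j γ - Z (s y) (p x) γ) (≡.sym (ps y)) (≡.sym (sp x)) ⟩
          Z (p (s y)) (s (p x)) γ - Z (s y) (p x) γ      ≈⟨ solve 2 (λ x y → x :- y := :- (y :- x)) refl _ _ ⟩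
          - (Z (s y) (p x) γ - Z (p (s y)) (s (p x)) γ)  ≈⟨ -‿cong (expand (s y) (p x) γ) ⟨
          - schurBy s p (s y ∷ p x ∷ γ)                  ∎

-- Sums over compositions and their cancellation against zero rows

sucℤ≡ : ∀ i → sucℤ i ≡ ℤ.suc i
sucℤ≡ (+ n) = ≡.refl
sucℤ≡ -[1+ zero ] = ≡.refl
sucℤ≡ -[1+ suc n ] = ≡.refl

sucℤ-+ : ∀ i j → sucℤ i ℤ.+ j ≡ sucℤ (i ℤ.+ j)
sucℤ-+ i j = ≡.trans (≡.cong (ℤ._+ j) (sucℤ≡ i)) (≡.trans (ℤ.+-assoc (+ 1) i j) (≡.sym (sucℤ≡ (i ℤ.+ j))))

+-sucℤ : ∀ i j → i ℤ.+ sucℤ j ≡ sucℤ (i ℤ.+ j)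
+-sucℤ i j = ≡.trans (ℤ.+-comm i (sucℤ j)) (≡.trans (sucℤ-+ j i) (≡.cong sucℤ (ℤ.+-comm j i)))

suc-pred-comm : ∀ i → sucℤ (predℤ i) ≡ predℤ (sucℤ i)
suc-pred-comm i = ≡.trans (suc-pred i) (≡.sym (pred-suc i))

zeros : ∀ M {n} → Vec ℤ n → Vec ℤ (M ℕ.+ n)
zeros zero β = β
zeros (suc M) β = + 0 ∷ zeros M β

module CompleteSums (R : CommutativeRing 0ℓ 0ℓ) where
  open CommutativeRing R hiding (zero)
  open IntegerSolver R
  open AlternatingSums R
  open import Algebra.Properties.Ring ring using (-0#≈0#)
  open import Relation.Binary.Reasoning.Setoid setoid

  geom-pred : ∀ {c χ} → NegZero χ → ∀ n v → geom c (λ i j → χ (predℤ i) j) n v ≈ geom c χ (predℤ n) v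
  geom-pred χ0 (+ zero) v = χ0 0 v
  geom-pred χ0 (+ suc zero) v = trans (+-congˡ (trans (*-congˡ (χ0 0 _)) (zeroʳ _))) (+-identityʳ _)
  geom-pred χ0 (+ suc (suc n)) v = +-congˡ (*-congˡ (geom-pred χ0 (+ suc n) (sucℤ v)))
  geom-pred χ0 -[1+ n ] v = refl

  -- Σ_γ φ (v - |γ|) (β + γ) over γ ∈ ℕⁿ, for φ vanishing at negative first argument.
  full : ∀ {n} → ℤ → Vec ℤ n → (ℤ → Vec ℤ n → Carrier) → Carrier
  full v [] φ = φ v []
  full v (b ∷ β) φ = geom 1# (λ i j → full i β (λ w γ → φ w (j ∷ γ))) v b

  full-cong : ∀ {n v} (β : Vec ℤ n) {φ ψ} → (∀ w γ → φ w γ ≈ ψ w γ) → full v β φ ≈ full v β ψ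
  full-cong [] e = e _ []
  full-cong {v = v} (b ∷ β) e = geom-cong (λ i j → full-cong β (λ w γ → e w (j ∷ γ))) v b

  full-- : ∀ {n v} (β : Vec ℤ n) φ ψ → full v β (λ w γ → φ w γ - ψ w γ) ≈ full v β φ - full v β ψ
  full-- [] φ ψ = refl
  full-- {v = v} (b ∷ β) φ ψ = trans (geom-cong (λ i j → full-- β _ _) v b) (geom-- _ _ v b)

  full-* : ∀ {n v} (β : Vec ℤ n) c φ → full v β (λ w γ → c * φ w γ) ≈ c * full v β φ
  full-* [] c φ = refl
  full-* {v = v} (b ∷ β) c φ = trans (geom-cong (λ i j → full-* β c _) v b) (geom-* c _ v b)

  full-neg : ∀ {n} (β : Vec ℤ n) {φ} → NegZero φ → ∀ m → full -[1+ m ] β φ ≈ 0#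
  full-neg [] φ0 m = φ0 m []
  full-neg (b ∷ β) φ0 m = refl

  full-pred : ∀ {n v} (β : Vec ℤ n) {φ} → NegZero φ → full v β (λ w γ → φ (predℤ w) γ) ≈ full (predℤ v) β φ
  full-pred [] φ0 = refl
  full-pred {v = v} (b ∷ β) φ0 = trans (geom-cong (λ i j → full-pred β (λ w γ → φ0 w (j ∷ γ))) v b)
    (geom-pred (λ i j → full-neg β (λ w γ → φ0 w (j ∷ γ)) i) v b)

  -- In terms of raising operators, `alt` is ∏(1 - xσ_i) and `full` is ∏ 1/(1 - xσ_i); the factors
  -- cancel one entry at a time.
  alt-full : ∀ {n} (β : Vec ℤ n) {m φ} → NegZero φ → alt sucℤ predℤ β m (λ k γ → full k γ φ) ≈ φ m β
  alt-full [] φ0 = refl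
  alt-full (b ∷ β) {m} {φ} φ0 = begin
    alt sucℤ predℤ β m (λ k γ → full k (b ∷ γ) φ) - alt sucℤ predℤ β (predℤ m) (λ k γ → full k (sucℤ b ∷ γ) φ)
      ≈⟨ +-congˡ (-‿cong (alt-index β _ predℤ (λ i → ≡.refl))) ⟨
    alt sucℤ predℤ β m (λ k γ → full k (b ∷ γ) φ) - alt sucℤ predℤ β m (λ k γ → full (predℤ k) (sucℤ b ∷ γ) φ)
      ≈⟨ alt-- β _ _ ⟨
    alt sucℤ predℤ β m (λ k γ → full k (b ∷ γ) φ - full (predℤ k) (sucℤ b ∷ γ) φ)
      ≈⟨ alt-cong β (λ k γ → trans (+-congʳ (geom-rec (λ i j → full-neg γ (λ w δ → φ0 w (j ∷ δ)) i) k b))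
           (solve 2 (λ x y → (x :+ con (+ 1) :* y) :- y := x) refl _ _)) ⟩
    alt sucℤ predℤ β m (λ k γ → full k γ (λ w δ → φ w (b ∷ δ)))
      ≈⟨ alt-full β (λ w γ → φ0 w (b ∷ γ)) ⟩
    φ m (b ∷ β) ∎

  -- The same inverse pair in the opposite order: ψ satisfies the recursion that characterises the
  -- outermost `geom`.
  full-alt : ∀ {n} (β : Vec ℤ n) {m ψ} → NegZero ψ → full m β (λ w γ → alt sucℤ predℤ γ w ψ) ≈ ψ m β
  full-alt [] ψ0 = refl
  full-alt (b ∷ β) {m} {ψ} ψ0 = sym (geom-unique (λ i j → ψ i (j ∷ β)) (λ i j → ψ0 i (j ∷ β)) rec m b)
    where
    inner : ∀ i j → full i β (λ w γ → alt sucℤ predℤ (j ∷ γ) w ψ) ≈ ψ i (j ∷ β) - ψ (predℤ i) (sucℤ j ∷ β)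
    inner i j = trans (full-- β _ _) (+-cong (full-alt β (λ w γ → ψ0 w (j ∷ γ)))
      (-‿cong (trans (full-pred β (λ w γ → alt-pred-0 γ (λ k δ → ψ0 k (sucℤ j ∷ δ)) w)) (full-alt β (λ w γ → ψ0 w (sucℤ j ∷ γ))))))
    rec : ∀ i j → ψ (+ i) (j ∷ β) ≈ full (+ i) β (λ w γ → alt sucℤ predℤ (j ∷ γ) w ψ) + 1# * ψ (predℤ (+ i)) (sucℤ j ∷ β)
    rec i j = sym (trans (+-congʳ (inner (+ i) j)) (solve 2 (λ x y → (x :- y) :+ con (+ 1) :* y := x) refl _ _))

  -- Σ_γ f (β + γ) over γ ∈ ℕⁿ with |γ| = k.
  comp : ∀ {n} → ℕ → Vec ℤ n → (Vec ℤ n → Carrier) → Carrier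
  comp zero [] f = f []
  comp (suc k) [] f = 0#
  comp zero (b ∷ β) f = comp zero β (λ γ → f (b ∷ γ))
  comp (suc k) (b ∷ β) f = comp (suc k) β (λ γ → f (b ∷ γ)) + comp k (sucℤ b ∷ β) f

  comp-0 : ∀ {n} k (β : Vec ℤ n) {f} → (∀ γ → f γ ≈ 0#) → comp k β f ≈ 0#
  comp-0 zero [] e = e []
  comp-0 (suc k) [] e = refl
  comp-0 zero (b ∷ β) e = comp-0 zero β (λ γ → e (b ∷ γ))
  comp-0 (suc k) (b ∷ β) e = trans (+-cong (comp-0 (suc k) β (λ γ → e (b ∷ γ))) (comp-0 k (sucℤ b ∷ β) e)) (+-identityʳ 0#)

  diag : (ℕ → ℕ → Carrier) → ℕ → Carrier
  diag ψ zero = ψ 0 0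
  diag ψ (suc n) = ψ 0 (suc n) + diag (λ v k → ψ (suc v) k) n

  diag-0 : ∀ ψ n → (∀ v k → v ℕ.+ k ≡ n → ψ v k ≈ 0#) → diag ψ n ≈ 0#
  diag-0 ψ zero e = e 0 0 ≡.refl
  diag-0 ψ (suc n) e = trans (+-cong (e 0 (suc n) ≡.refl) (diag-0 _ n (λ v k p → e (suc v) k (≡.cong suc p)))) (+-identityʳ 0#)

  diag-split : ∀ ψ α β n → (∀ v → ψ v 0 ≈ α v 0) → (∀ v k → ψ v (suc k) ≈ α v (suc k) + β v k) →
    diag ψ (suc n) ≈ diag α (suc n) + diag β n
  diag-split ψ α β zero e0 es = trans (+-cong (es 0 0) (e0 1)) (solve 3 (λ x y z → (x :+ y) :+ z := (x :+ z) :+ y) refl _ _ _)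
  diag-split ψ α β (suc n) e0 es = trans (+-cong (es 0 (suc n)) (diag-split (λ v → ψ (suc v)) (λ v → α (suc v)) (λ v → β (suc v)) n (λ v → e0 (suc v)) (λ v k → es (suc v) k)))
    (solve 4 (λ x y z w → (x :+ y) :+ (z :+ w) := (x :+ z) :+ (y :+ w)) refl _ _ _ _)

  -- Groups the terms by the part `v` not distributed over β. The case v = 0 has to be isolated,
  -- since there antisymmetry gives nothing and only the weight can kill the term.
  full-diag : ∀ {n} m (β : Vec ℤ n) φ → full (+ m) β φ ≈ diag (λ v k → comp k β (φ (+ v))) m
  full-diag m [] φ = sym (base (λ v → φ (+ v)) m)
    where
    base : ∀ (φ : ℕ → Vec ℤ 0 → Carrier) m → diag (λ v k → comp k [] (φ v)) m ≈ φ m []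
    base φ zero = refl
    base φ (suc m) = trans (+-identityˡ _) (base (λ v → φ (suc v)) m)
  full-diag m (b ∷ β) φ = go m b
    where
    go : ∀ m b → geom 1# (λ i j → full i β (λ w γ → φ w (j ∷ γ))) (+ m) b ≈ diag (λ v k → comp k (b ∷ β) (φ (+ v))) m
    go zero b = full-diag 0 β _
    go (suc m) b = trans (+-cong (full-diag (suc m) β _) (trans (*-identityˡ _) (go m (sucℤ b))))
      (sym (diag-split (λ v k → comp k (b ∷ β) (φ (+ v))) (λ v k → comp k β (λ γ → φ (+ v) (b ∷ γ))) _ m (λ v → refl) (λ v k → refl)))

  module _ (torsion-free : ∀ {x} → x ≈ - x → x ≈ 0#) where

    private
      Anti : ∀ {n} → (Vec ℤ n → Carrier) → Set
      Anti = Antisym sucℤ predℤ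

    -- Here `d` is the number of leading zeros that still have to be met before the value is forced
    -- to vanish; antisymmetry is retained at each stage so that an entry differing from zero can
    -- restart the count.
    Vanishing : ℕ → ∀ {n} → (Vec ℤ n → Carrier) → Set
    Vanishing zero g = ∀ γ → g γ ≈ 0#
    Vanishing (suc d) {zero} g = ⊤
    Vanishing (suc d) {suc n} g = Anti g × Vanishing d (λ γ → g (+ 0 ∷ γ))

    Vanishing-neg : ∀ d {n} {f g : Vec ℤ n → Carrier} → (∀ γ → f γ ≈ - g γ) → Anti f → Vanishing d g → Vanishing d f
    Vanishing-neg zero e a k γ = trans (e γ) (trans (-‿cong (k γ)) -0#≈0#)
    Vanishing-neg (suc d) {zero} e a k = tt
    Vanishing-neg (suc d) {suc n} {f} e a k = a , Vanishing-neg d (λ γ → e _) (Antisym-tail f a (+ 0)) (proj₂ k)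

    -- Moving the entry m past m zeros produces two entries exchanged into one another.
    Antisym⇒Vanishing : ∀ m {n} {f : Vec ℤ (suc n) → Carrier} → Anti f → Vanishing (suc m) (λ γ → f (+ suc m ∷ γ))
    Antisym⇒Vanishing m {zero} a = tt
    Antisym⇒Vanishing zero {suc n} {f} a = Antisym-tail f a (+ 1) , λ γ → torsion-free (proj₁ a (+ 1) (+ 0) γ)
    Antisym⇒Vanishing (suc m) {suc n} {f} a = a′ ,
      Vanishing-neg (suc m) (λ γ → proj₁ a (+ suc (suc m)) (+ 0) γ) (Antisym-tail f′ a′ (+ 0))
        (Antisym⇒Vanishing m {n} {λ γ → f (+ 1 ∷ γ)} (Antisym-tail f a (+ 1)))
      where
      f′ : Vec ℤ (suc n) → Carrier
      f′ γ = f (+ suc (suc m) ∷ γ)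
      a′ : Anti f′
      a′ = Antisym-tail f a (+ suc (suc m))

    -- A pigeonhole argument: `d` zeros are still wanted, weight `k` is still to be placed, and `M`
    -- zeros are left. A zero kept in place lowers `d`. An entry raised to t + 1 uses up t + 1 of
    -- the weight and, by `Antisym⇒Vanishing`, replaces the demand by t + 1 further zeros. In both
    -- cases d + k remains at most the number of zeros left.
    comp-Vanishing : ∀ M {n} (β : Vec ℤ n) d k {g : Vec ℤ (M ℕ.+ n) → Carrier} →
      Vanishing d g → d ℕ.+ k ℕ.≤ M → comp k (zeros M β) g ≈ 0#
    comp-Vanishing M β zero k g0 le = comp-0 k (zeros M β) g0
    comp-Vanishing (suc M) β (suc d) zero (a , g0) (s≤s le) = comp-Vanishing M β d zero g0 le
    comp-Vanishing (suc M) β (suc d) (suc k) {g} (a , g0) (s≤s le) =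
      trans (+-cong (comp-Vanishing M β d (suc k) g0 le) (nonzero 0 k (ℕ.≤-trans (ℕ.m≤n+m (suc k) d) le))) (+-identityʳ 0#)
      where
      nonzero : ∀ t k → suc t ℕ.+ k ℕ.≤ M → comp k (+ suc t ∷ zeros M β) g ≈ 0#
      nonzero t zero le = comp-Vanishing M β (suc t) zero (Antisym⇒Vanishing t {f = g} a) le
      nonzero t (suc k) le = trans (+-cong (comp-Vanishing M β (suc t) (suc k) (Antisym⇒Vanishing t {f = g} a) le)
        (nonzero (suc t) k (ℕ.≤-trans (ℕ.≤-reflexive (≡.cong suc (≡.sym (ℕ.+-suc t k)))) le))) (+-identityʳ 0#)

    -- The weight kills v = 0. A positive first entry v asks for v zeros while only m - v is
    -- distributed over the `M` available ones, so the bound m ≤ M is exactly what `comp-Vanishing`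
    -- requires.
    full-zeros : ∀ M {n} (β : Vec ℤ n) (w : ℤ → Carrier) {f : Vec ℤ (suc (M ℕ.+ n)) → Carrier} →
      w (+ 0) ≈ 0# → Anti f → ∀ {m} → m ℕ.≤ M → full (+ m) (zeros M β) (λ v γ → w v * f (v ∷ γ)) ≈ 0#
    full-zeros M β w {f} w0 a {m} m≤M = trans (full-diag m (zeros M β) _) (diag-0 _ m zero-term)
      where
      zero-term : ∀ v k → v ℕ.+ k ≡ m → comp k (zeros M β) (λ γ → w (+ v) * f (+ v ∷ γ)) ≈ 0#
      zero-term zero k e = comp-0 k (zeros M β) (λ γ → trans (*-congʳ w0) (zeroˡ _))
      zero-term (suc v) k e = comp-Vanishing M β (suc v) k
        (Antisym⇒Vanishing v {f = λ γ → w (+ suc v) * f γ} (Antisym-* (w (+ suc v)) a)) (ℕ.≤-trans (ℕ.≤-reflexive e) m≤M)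

-- The vertex operator on Schur functions

module VertexOperator (R : CommutativeRing 0ℓ 0ℓ) where
  open CommutativeRing R hiding (zero)
  open AlternatingSums R
  open CompleteSums R

  -- The data in abstract form: `h` for h_n[Y], `g` for the rescaled coefficients of Ω, and `pw i`
  -- for a^i with i any integer. In generating functions `h-g` reads h(x)g(ax) = h(ax).
  module Rows
    (torsion-free : ∀ {x} → x ≈ - x → x ≈ 0#)
    (a a⁻¹ : Carrier) (a*a⁻¹ : a * a⁻¹ ≈ 1#)
    (h g : ℤ → Carrier) (h-neg : ∀ n → h -[1+ n ] ≈ 0#) (g-neg : ∀ n → g -[1+ n ] ≈ 0#)
    (h0 : h (+ 0) ≈ 1#) (g0 : g (+ 0) ≈ 1#)
    (pw : ℤ → Carrier) (pw-0 : pw (+ 0) ≈ 1#) (pw-suc : ∀ i → pw (sucℤ i) ≈ a * pw i)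
    (h-g : ∀ n → geom a (λ i j → h i * g j) (+ n) (+ 0) ≈ pw (+ n) * h (+ n))
    where

    open IntegerSolver R
    open Schur h
    open import Algebra.Properties.Ring ring using (-0#≈0#)
    open import Relation.Binary.Reasoning.Setoid setoid

    private
      up : ∀ {n} → Vec ℤ n → ℤ → (ℤ → Vec ℤ n → Carrier) → Carrier
      up = alt sucℤ predℤ

      h*-neg : ∀ {A : Set} (F : ℤ → A → Carrier) → NegZero (λ i j → h i * F i j)
      h*-neg F n v = trans (*-congʳ (h-neg n)) (zeroˡ _)

      cancel : ∀ x → a * (a⁻¹ * x) ≈ x
      cancel x = trans (sym (*-assoc _ _ _)) (trans (*-congʳ a*a⁻¹) (*-identityˡ x))

      cancel′ : ∀ x → a⁻¹ * (a * x) ≈ x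
      cancel′ x = trans (sym (*-assoc _ _ _)) (trans (*-congʳ (trans (*-comm _ _) a*a⁻¹)) (*-identityˡ x))

    pw⁻ : ℕ → Carrier
    pw⁻ zero = 1#
    pw⁻ (suc n) = a⁻¹ * pw⁻ n

    rows : ∀ {n} → ℤ → Vec ℤ n → (Vec ℤ n → Carrier) → Carrier
    rows v [] f = 0#
    rows {suc n} v (b ∷ β) f = (a - 1#) * (a⁻¹ * (pw b * pw⁻ n)) * f (b ℤ.+ v ∷ β) + rows v β (λ γ → f (b ∷ γ))

    -- The coefficient of y^v in g(y) ∏_i (1 - y σ_i)/(1 - y σ_i / a) f(β), where σ_i raises the i-th entry.
    rest : ∀ {n} → ℤ → Vec ℤ n → (Vec ℤ n → Carrier) → Carrier
    rest v [] f = g v * f []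
    rest v (b ∷ β) f = quot a⁻¹ (λ i j → rest i β (λ γ → f (j ∷ γ))) v b

    rest-neg : ∀ {n} (β : Vec ℤ n) f m → rest -[1+ m ] β f ≈ 0#
    rest-neg [] f m = trans (*-congʳ (g-neg m)) (zeroˡ _)
    rest-neg (b ∷ β) f m = -‿inverseʳ 0#

    rest-* : ∀ {n v} (β : Vec ℤ n) c f → rest v β (λ γ → c * f γ) ≈ c * rest v β f
    rest-* [] c f = solve 3 (λ x c f → x :* (c :* f) := c :* (x :* f)) refl _ _ _
    rest-* {v = v} (b ∷ β) c f = trans (quot-cong (λ i j → rest-* β c _) v b) (quot-* c _ v b)

    rest-- : ∀ {n v} (β : Vec ℤ n) f f′ → rest v β (λ γ → f γ - f′ γ) ≈ rest v β f - rest v β f′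
    rest-- [] f f′ = solve 3 (λ x y z → x :* (y :- z) := x :* y :- x :* z) refl _ _ _
    rest-- {v = v} (b ∷ β) f f′ = trans (quot-cong (λ i j → rest-- β _ _) v b) (quot-- _ _ v b)

    rest-0 : ∀ {n} (β : Vec ℤ n) f → rest (+ 0) β f ≈ f β
    rest-0 [] f = trans (*-congʳ g0) (*-identityˡ _)
    rest-0 (b ∷ β) f = trans (+-cong (rest-0 β _) -0#≈0#) (+-identityʳ _)

    -- Both operations are polynomials or series in the raising operators σ_i, which commute.
    up-rest : ∀ {n v} (β : Vec ℤ n) {m} F → up β m (λ k γ → rest v γ (F k)) ≈ rest v β (λ γ → up γ m F)
    up-rest [] F = refl
    up-rest {v = v} (b ∷ β) {m} F = begin
      up β m (λ k γ → rest v (b ∷ γ) (F k)) - up β (predℤ m) (λ k γ → rest v (sucℤ b ∷ γ) (F k))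
        ≈⟨ +-cong (part b) (-‿cong (trans (part (sucℤ b)) (sym (quot-shift _ sucℤ (λ i → ≡.refl) v b)))) ⟩
      quot a⁻¹ (λ i j → rest i β (λ γ → up γ m (λ k δ → F k (j ∷ δ)))) v b
        - quot a⁻¹ (λ i j → rest i β (λ γ → up γ (predℤ m) (λ k δ → F k (sucℤ j ∷ δ)))) v b
        ≈⟨ quot-- _ _ v b ⟨
      quot a⁻¹ (λ i j → rest i β (λ γ → up γ m (λ k δ → F k (j ∷ δ))) - rest i β (λ γ → up γ (predℤ m) (λ k δ → F k (sucℤ j ∷ δ)))) v b
        ≈⟨ quot-cong (λ i j → rest-- β _ _) v b ⟨
      rest v (b ∷ β) (λ γ → up γ m F) ∎
      where
      part : ∀ b {m} → up β m (λ k γ → rest v (b ∷ γ) (F k)) ≈ quot a⁻¹ (λ i j → rest i β (λ γ → up γ m (λ k δ → F k (j ∷ δ)))) v b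
      part b = trans (alt-quot β _ v b) (quot-cong (λ i j → up-rest β _) v b)

    -- Lowering the argument of χ costs one step of the sum, hence a factor `a`; the boundary term
    -- is a value of χ at -1.
    geom-reindex : ∀ (χ : ℤ → Carrier) → (∀ n → χ -[1+ n ] ≈ 0#) → ∀ n →
      geom a (λ i j → h i * χ (predℤ j)) n (+ 0) ≈ a * geom a (λ i j → h i * χ j) (predℤ n) (+ 0)
    geom-reindex χ χ0 (+ zero) = trans (*-congˡ (χ0 0)) (trans (zeroʳ _) (sym (zeroʳ _)))
    geom-reindex χ χ0 (+ suc n) = trans (+-cong (trans (*-congˡ (χ0 0)) (zeroʳ _))
      (*-congˡ (geom-shift (λ i j → h i * χ j) predℤ (λ i → ≡.sym (suc-pred-comm i)) (+ n) (+ 1)))) (+-identityˡ _)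
    geom-reindex χ χ0 -[1+ n ] = sym (zeroʳ _)

    private
      weighted : ∀ {n} → (Vec ℤ n → Carrier) → ℤ → Vec ℤ n → Carrier
      weighted f w γ = pw w * up γ w (λ k δ → h k * f δ)

      up-h-neg : ∀ {n} (f : Vec ℤ n → Carrier) → NegZero (λ w γ → up γ w (λ k δ → h k * f δ))
      up-h-neg f w γ = alt-pred-0 γ (h*-neg (λ k → f)) w

      weighted-neg : ∀ {n} (f : Vec ℤ n → Carrier) → NegZero (weighted f)
      weighted-neg f w γ = trans (*-congˡ (up-h-neg f w γ)) (zeroʳ _)

    -- Put y = ax in the series defining `rest` and multiply by h(x). By `h-g` the factor h(x)g(ax)
    -- becomes h(ax), the numerators ∏(1 - axσ_i) turn it into `weighted`, and the denominators ∏
    -- 1/(1 - xσ_i) become the sum `full`.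
    geom-rest : ∀ {n} (β : Vec ℤ n) f m → geom a (λ i j → h i * rest j β f) m (+ 0) ≈ full m β (weighted f)
    geom-rest [] f (+ n) = begin
      geom a (λ i j → h i * (g j * f [])) (+ n) (+ 0)
        ≈⟨ geom-cong (λ i j → solve 3 (λ x y z → x :* (y :* z) := z :* (x :* y)) refl _ _ _) (+ n) (+ 0) ⟩
      geom a (λ i j → f [] * (h i * g j)) (+ n) (+ 0)
        ≈⟨ geom-* (f []) _ (+ n) (+ 0) ⟩
      f [] * geom a (λ i j → h i * g j) (+ n) (+ 0)
        ≈⟨ *-congˡ (h-g n) ⟩
      f [] * (pw (+ n) * h (+ n))
        ≈⟨ solve 3 (λ x y z → z :* (x :* y) := x :* (y :* z)) refl _ _ _ ⟩
      pw (+ n) * (h (+ n) * f []) ∎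
    geom-rest [] f -[1+ n ] = sym (weighted-neg f n [])
    geom-rest (b ∷ β) f m = trans (geom-unique Z (λ n j → refl) rec m b) (geom-cong (λ i j → sym (inner i j)) m b)
      where
      ψ : ℤ → ℤ → Carrier
      ψ v j = rest v β (λ γ → f (j ∷ γ))
      ψ0 : NegZero ψ
      ψ0 n j = rest-neg β _ n
      Z ρ : ℤ → ℤ → Carrier
      Z n j = geom a (λ i v → h i * quot a⁻¹ ψ v j) n (+ 0)
      ρ n j = geom a (λ i v → h i * ψ v j) n (+ 0)
      inner : ∀ i j → full i β (λ w γ → weighted f w (j ∷ γ)) ≈ ρ i j - a * ρ (predℤ i) (sucℤ j)
      inner i j = begin
        full i β (λ w γ → weighted f w (j ∷ γ))
          ≈⟨ full-cong β (λ w γ → trans (solve 3 (λ c x y → c :* (x :- y) := c :* x :- c :* y) refl _ _ _)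
               (+-congˡ (-‿cong (trans (*-congʳ (trans (reflexive (≡.cong pw (≡.sym (suc-pred w)))) (pw-suc (predℤ w)))) (*-assoc _ _ _))))) ⟩
        full i β (λ w γ → weighted (λ γ → f (j ∷ γ)) w γ - a * weighted (λ γ → f (sucℤ j ∷ γ)) (predℤ w) γ)
          ≈⟨ full-- β _ _ ⟩
        full i β (weighted (λ γ → f (j ∷ γ))) - full i β (λ w γ → a * weighted (λ γ → f (sucℤ j ∷ γ)) (predℤ w) γ)
          ≈⟨ +-congˡ (-‿cong (trans (full-* β a _) (*-congˡ (full-pred β (weighted-neg _))))) ⟩
        full i β (weighted (λ γ → f (j ∷ γ))) - a * full (predℤ i) β (weighted (λ γ → f (sucℤ j ∷ γ)))
          ≈⟨ +-cong (geom-rest β _ i) (-‿cong (*-congˡ (geom-rest β _ (predℤ i)))) ⟨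
        ρ i j - a * ρ (predℤ i) (sucℤ j) ∎
      -- The factor `a` from reindexing cancels the ratio `a⁻¹` of `quot`, which leaves ratio 1, the
      -- one used by `full`.
      rec : ∀ n j → Z (+ n) j ≈ (ρ (+ n) j - a * ρ (predℤ (+ n)) (sucℤ j)) + 1# * Z (predℤ (+ n)) (sucℤ j)
      rec n j = begin
        Z (+ n) j
          ≈⟨ geom-cong (λ i v → trans (*-congˡ (trans (solve 2 (λ x y → x := (x :- y) :+ y) refl _ _) (+-congʳ (quot-rec ψ0 v j))))
               (solve 5 (λ c x y z w → c :* ((x :- y) :+ z :* w) := (c :* x :- c :* y) :+ z :* (c :* w)) refl _ _ _ _ _)) (+ n) (+ 0) ⟩
        geom a (λ i v → (h i * ψ v j - h i * ψ (predℤ v) (sucℤ j)) + a⁻¹ * (h i * quot a⁻¹ ψ (predℤ v) (sucℤ j))) (+ n) (+ 0)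
          ≈⟨ trans (geom-+ (λ i v → h i * ψ v j - h i * ψ (predℤ v) (sucℤ j)) _ (+ n) (+ 0)) (+-cong (geom-- _ _ (+ n) (+ 0)) (geom-* a⁻¹ _ (+ n) (+ 0))) ⟩
        (ρ (+ n) j - geom a (λ i v → h i * ψ (predℤ v) (sucℤ j)) (+ n) (+ 0))
          + a⁻¹ * geom a (λ i v → h i * quot a⁻¹ ψ (predℤ v) (sucℤ j)) (+ n) (+ 0)
          ≈⟨ +-cong (+-congˡ (-‿cong (geom-reindex (λ v → ψ v (sucℤ j)) (λ n → ψ0 n _) (+ n))))
               (trans (*-congˡ (geom-reindex (λ v → quot a⁻¹ ψ v (sucℤ j)) (λ n → -‿inverseʳ 0#) (+ n))) (trans (cancel′ _) (sym (*-identityˡ _)))) ⟩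
        (ρ (+ n) j - a * ρ (predℤ (+ n)) (sucℤ j)) + 1# * Z (predℤ (+ n)) (sucℤ j) ∎

    module _ {n} (β : Vec ℤ n) (f : Vec ℤ n → Carrier) where

      private
        χ : ℤ → ℤ → Carrier
        χ v m = up β m (λ k γ → h k * rest v γ f)

        χ-neg : NegZero χ
        χ-neg v m = alt-0 β (λ k γ → trans (*-congˡ (rest-neg γ f v)) (zeroʳ _))

        inner : ℤ → ℤ → Carrier
        inner v m = up β m (λ k γ → geom a (λ i j → h i * rest j γ f) k v)

        inner-suc : ∀ v m → inner v (sucℤ m) ≈ χ v (sucℤ m) + a * inner (sucℤ v) m
        inner-suc v m = begin
          up β (sucℤ m) (λ k γ → geom a (λ i j → h i * rest j γ f) k v)
            ≈⟨ alt-index β _ sucℤ suc-pred-comm ⟨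
          up β m (λ k γ → geom a (λ i j → h i * rest j γ f) (sucℤ k) v)
            ≈⟨ alt-cong β (λ k γ → trans (geom-rec (h*-neg (λ i j → rest j γ f)) (sucℤ k) v)
                 (+-congˡ (*-congˡ (reflexive (≡.cong (λ i → geom a (λ i j → h i * rest j γ f) i (sucℤ v)) (pred-suc k)))))) ⟩
          up β m (λ k γ → h (sucℤ k) * rest v γ f + a * geom a (λ i j → h i * rest j γ f) k (sucℤ v))
            ≈⟨ trans (alt-+ β _ _) (+-cong (alt-index β _ sucℤ suc-pred-comm) (alt-* β a _)) ⟩
          χ v (sucℤ m) + a * inner (sucℤ v) m ∎

        -- Induction on `v`, in which `inner-suc` trades a higher power of y for a longer row `m`.
        -- At v = 0 the inner sums are `full` by `geom-rest`, and `alt-full` undoes them.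
        inner-eq : ∀ v m → inner (+ v) m ≈ pw m * up β (m ℤ.+ + v) (λ k γ → h k * f γ) - a⁻¹ * geom a⁻¹ χ (predℤ (+ v)) (sucℤ m)
        inner-eq zero m = begin
          inner (+ 0) m
            ≈⟨ alt-cong β (λ k γ → geom-rest γ f k) ⟩
          up β m (λ k γ → full k γ (weighted f))
            ≈⟨ alt-full β (weighted-neg f) ⟩
          weighted f m β
            ≡⟨ ≡.cong (λ i → pw m * up β i (λ k γ → h k * f γ)) (≡.sym (ℤ.+-identityʳ m)) ⟩
          pw m * up β (m ℤ.+ + 0) (λ k γ → h k * f γ)
            ≈⟨ solve 2 (λ x y → x := x :- y :* con (+ 0)) refl _ _ ⟩
          pw m * up β (m ℤ.+ + 0) (λ k γ → h k * f γ) - a⁻¹ * 0# ∎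
        inner-eq (suc v) m = begin
          inner (+ suc v) m
            ≈⟨ cancel′ _ ⟨
          a⁻¹ * (a * inner (+ suc v) m)
            ≈⟨ *-congˡ (trans (solve 2 (λ x y → y := (x :+ y) :- x) refl _ _) (+-congʳ (sym (inner-suc (+ v) m)))) ⟩
          a⁻¹ * (inner (+ v) (sucℤ m) - χ (+ v) (sucℤ m))
            ≈⟨ *-congˡ (+-congʳ (trans (inner-eq v (sucℤ m)) (+-congʳ (trans (*-congʳ (pw-suc m)) (*-assoc _ _ _))))) ⟩
          a⁻¹ * ((a * (pw m * U (sucℤ m ℤ.+ + v)) - a⁻¹ * geom a⁻¹ χ (predℤ (+ v)) (sucℤ (sucℤ m))) - χ (+ v) (sucℤ m))
            ≈⟨ solve 5 (λ c a x y z → c :* ((a :* x :- y) :- z) := c :* (a :* x) :- c :* (z :+ y)) refl _ _ _ _ _ ⟩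
          a⁻¹ * (a * (pw m * U (sucℤ m ℤ.+ + v))) - a⁻¹ * (χ (+ v) (sucℤ m) + a⁻¹ * geom a⁻¹ χ (predℤ (+ v)) (sucℤ (sucℤ m)))
            ≈⟨ +-cong (trans (cancel′ _) (reflexive (≡.cong (λ i → pw m * U i) (≡.trans (sucℤ-+ m (+ v)) (≡.sym (+-sucℤ m (+ v)))))))
                 (-‿cong (*-congˡ (sym (geom-rec χ-neg (+ v) (sucℤ m))))) ⟩
          pw m * U (m ℤ.+ + suc v) - a⁻¹ * geom a⁻¹ χ (+ v) (sucℤ m) ∎
          where
          U : ℤ → Carrier
          U i = up β i (λ k γ → h k * f γ)

      -- By `quot-geom` the left side is (a - 1) times `inner` plus χ. The main term of `inner` is
      -- the new row `m` raised by `v`. The correction in `inner-eq` combines with χ, again by c(1 -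
      -- x)/(1 - cx) but with c = 1/a, into the remainder with `m` adjoined to β.
      up-quot-rest : ∀ v m → a * up β m (λ k γ → quot a (λ i j → h i * rest j γ f) k (+ v)) ≈
        (a - 1#) * (pw m * up β (m ℤ.+ + v) (λ k γ → h k * f γ)) + quot a⁻¹ (λ i j → rest i β (λ γ → up γ j (λ k δ → h k * f δ))) (+ v) m
      up-quot-rest v m = begin
        a * up β m (λ k γ → quot a (λ i j → h i * rest j γ f) k (+ v))
          ≈⟨ alt-* β a _ ⟨
        up β m (λ k γ → a * quot a (λ i j → h i * rest j γ f) k (+ v))
          ≈⟨ alt-cong β (λ k γ → quot-geom (h*-neg (λ i j → rest j γ f)) k (+ v)) ⟩
        up β m (λ k γ → (a - 1#) * geom a (λ i j → h i * rest j γ f) k (+ v) + h k * rest (+ v) γ f)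
          ≈⟨ trans (alt-+ β _ _) (+-congʳ (trans (alt-* β _ _) (*-congˡ (inner-eq v m)))) ⟩
        (a - 1#) * (P - a⁻¹ * G) + χ (+ v) m
          ≈⟨ trans (solve 5 (λ a a⁻¹ P G X → (a :- con (+ 1)) :* (P :- a⁻¹ :* G) :+ X := (a :- con (+ 1)) :* P :+ ((X :+ a⁻¹ :* G) :- a :* (a⁻¹ :* G))) refl _ _ _ _ _)
               (+-congˡ (+-cong (sym (geom-rec χ-neg (+ v) m)) (-‿cong (cancel G)))) ⟩
        (a - 1#) * P + quot a⁻¹ χ (+ v) m
          ≈⟨ +-congˡ (quot-cong (λ i j → trans (alt-cong β (λ k γ → sym (rest-* γ _ _))) (up-rest β _)) (+ v) m) ⟩
        (a - 1#) * P + quot a⁻¹ (λ i j → rest i β (λ γ → up γ j (λ k δ → h k * f δ))) (+ v) m ∎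
        where
        P G : Carrier
        P = pw m * up β (m ℤ.+ + v) (λ k γ → h k * f γ)
        G = geom a⁻¹ χ (predℤ (+ v)) (sucℤ m)

    rows-- : ∀ {n v} (β : Vec ℤ n) f f′ → rows v β (λ γ → f γ - f′ γ) ≈ rows v β f - rows v β f′
    rows-- [] f f′ = sym (-‿inverseʳ 0#)
    rows-- (b ∷ β) f f′ = trans (+-congˡ (rows-- β _ _))
      (solve 5 (λ c x y z w → c :* (x :- y) :+ (z :- w) := (c :* x :+ z) :- (c :* y :+ w)) refl _ _ _ _ _)

    -- A longer row `b` has its coefficient multiplied by `a` through `pw`. Hence the two choices
    -- for `b` in the alternating sum differ by exactly the combination in `quot-rec`, and the
    -- fraction reduces to its numerator, the difference that `up` takes at `b + v`.
    up-quot-rows : ∀ {n} (β : Vec ℤ n) f v m →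
      up β m (λ k γ → quot a (λ i j → h i * rows j γ f) k v) ≈ rows v β (λ γ → up γ m (λ k δ → h k * f δ))
    up-quot-rows [] f v m = trans (+-cong (geom-0 (λ i j → zeroʳ _) m v) (-‿cong (geom-0 (λ i j → zeroʳ _) (predℤ m) (sucℤ v)))) (-‿inverseʳ 0#)
    up-quot-rows {suc n} (b ∷ β) f v m = begin
      up β m (λ k γ → quot a (λ i j → h i * rows j (b ∷ γ) f) k v) - up β (predℤ m) (λ k γ → quot a (λ i j → h i * rows j (sucℤ b ∷ γ) f) k v)
        ≈⟨ +-cong (split b m) (-‿cong (split (sucℤ b) (predℤ m))) ⟩
      (up β m (λ k γ → head b γ k v) + tail b m) - (up β (predℤ m) (λ k γ → head (sucℤ b) γ k v) + tail (sucℤ b) (predℤ m))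
        ≈⟨ solve 4 (λ x y z w → (x :+ y) :- (z :+ w) := (x :- z) :+ (y :- w)) refl _ _ _ _ ⟩
      (up β m (λ k γ → head b γ k v) - up β (predℤ m) (λ k γ → head (sucℤ b) γ k v)) + (tail b m - tail (sucℤ b) (predℤ m))
        ≈⟨ +-cong heads (sym (rows-- β _ _)) ⟩
      rows v (b ∷ β) (λ γ → up γ m (λ k δ → h k * f δ)) ∎
      where
      coef : ℤ → Carrier
      coef b = (a - 1#) * (a⁻¹ * (pw b * pw⁻ n))
      term : ℤ → Vec ℤ n → ℤ → ℤ → Carrier
      term b γ i j = h i * f (b ℤ.+ j ∷ γ)
      head : ℤ → Vec ℤ n → ℤ → ℤ → Carrier
      head b γ k v = coef b * quot a (term b γ) k v
      tail : ℤ → ℤ → Carrier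
      tail b m = rows v β (λ γ → up γ m (λ k δ → h k * f (b ∷ δ)))
      split : ∀ b m → up β m (λ k γ → quot a (λ i j → h i * rows j (b ∷ γ) f) k v) ≈ up β m (λ k γ → head b γ k v) + tail b m
      split b m = trans (alt-cong β (λ k γ → trans
          (quot-cong (λ i j → solve 4 (λ x c y z → x :* (c :* y :+ z) := c :* (x :* y) :+ x :* z) refl _ _ _ _) k v)
          (trans (quot-+ (λ i j → coef b * term b γ i j) _ k v) (+-congʳ (quot-* (coef b) (term b γ) k v)))))
        (trans (alt-+ β _ _) (+-congˡ (up-quot-rows β (λ γ → f (b ∷ γ)) v m)))
      coef-suc : coef (sucℤ b) ≈ coef b * a
      coef-suc = trans (*-congˡ (*-congˡ (*-congʳ (pw-suc b))))
        (solve 5 (λ u a⁻¹ a p q → u :* (a⁻¹ :* ((a :* p) :* q)) := (u :* (a⁻¹ :* (p :* q))) :* a) refl _ _ _ _ _)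
      shifted : ∀ k γ → head (sucℤ b) γ (predℤ k) v ≈ coef b * (a * quot a (term b γ) (predℤ k) (sucℤ v))
      shifted k γ = trans (*-cong coef-suc (trans (quot-cong (λ i j → reflexive (≡.cong (λ c → h i * f (c ∷ γ)) (≡.trans (sucℤ-+ b j) (≡.sym (+-sucℤ b j))))) (predℤ k) v)
        (quot-shift (term b γ) sucℤ (λ i → ≡.refl) (predℤ k) v))) (*-assoc _ _ _)
      heads : up β m (λ k γ → head b γ k v) - up β (predℤ m) (λ k γ → head (sucℤ b) γ k v) ≈ coef b * up (b ℤ.+ v ∷ β) m (λ k δ → h k * f δ)
      heads = begin
        up β m (λ k γ → head b γ k v) - up β (predℤ m) (λ k γ → head (sucℤ b) γ k v)
          ≈⟨ +-congˡ (-‿cong (sym (alt-index β (λ k γ → head (sucℤ b) γ k v) predℤ (λ i → ≡.refl)))) ⟩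
        up β m (λ k γ → head b γ k v) - up β m (λ k γ → head (sucℤ b) γ (predℤ k) v)
          ≈⟨ alt-- β _ _ ⟨
        up β m (λ k γ → head b γ k v - head (sucℤ b) γ (predℤ k) v)
          ≈⟨ alt-cong β (λ k γ → trans (+-congˡ (-‿cong (shifted k γ))) (trans (solve 3 (λ c x y → c :* x :- c :* y := c :* (x :- y)) refl _ _ _)
               (*-congˡ (quot-rec (h*-neg (λ i j → f (b ℤ.+ j ∷ γ))) k v)))) ⟩
        up β m (λ k γ → coef b * (term b γ k v - term b γ (predℤ k) (sucℤ v)))
          ≈⟨ trans (alt-* β _ _) (*-congˡ (alt-- β _ _)) ⟩
        coef b * (up β m (λ k γ → term b γ k v) - up β m (λ k γ → term b γ (predℤ k) (sucℤ v)))
          ≈⟨ *-congˡ (+-congˡ (-‿cong (trans (alt-index β (λ k γ → term b γ k (sucℤ v)) predℤ (λ i → ≡.refl))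
               (alt-cong β (λ k γ → reflexive (≡.cong (λ c → h k * f (c ∷ γ)) (+-sucℤ b v))))))) ⟩
        coef b * up (b ℤ.+ v ∷ β) m (λ k δ → h k * f δ) ∎

    module _ (τ : ∀ {n} → ℤ → Vec ℤ n → Carrier)
      (τ-[] : ∀ v → τ v [] ≈ g v)
      (τ-∷ : ∀ {n} v m (β : Vec ℤ n) → τ v (m ∷ β) ≈ up β m (λ k γ → quot a (λ i j → h i * τ j γ) k v)) where

      -- Induction on the number of rows: the terms already raised are reproduced by `up-quot-rows`,
      -- while the old remainder yields one new raised term and a new remainder, at the price of one
      -- factor 1/a.
      τ-rows-rest : ∀ {n} v (β : Vec ℤ n) → τ (+ v) β ≈ rows (+ v) β schur↑ + pw⁻ n * rest (+ v) β schur↑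
      τ-rows-rest v [] = trans (τ-[] (+ v)) (solve 1 (λ x → x := con (+ 0) :+ con (+ 1) :* (x :* con (+ 1))) refl _)
      τ-rows-rest {suc n} v (m ∷ β) = begin
        τ (+ v) (m ∷ β)
          ≈⟨ τ-∷ (+ v) m β ⟩
        up β m (λ k γ → quot a (λ i j → h i * τ j γ) k (+ v))
          ≈⟨ alt-cong β (λ k γ → trans (quot-cong⁺ (λ i j → trans (*-congˡ (τ-rows-rest j γ))
               (solve 4 (λ x y c z → x :* (y :+ c :* z) := x :* y :+ c :* (x :* z)) refl _ _ _ _)) k v)
               (trans (quot-+ (λ i j → h i * rows j γ schur↑) _ k (+ v)) (+-congˡ (quot-* (pw⁻ n) _ k (+ v))))) ⟩
        up β m (λ k γ → quot a (λ i j → h i * rows j γ schur↑) k (+ v) + pw⁻ n * quot a (λ i j → h i * rest j γ schur↑) k (+ v))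
          ≈⟨ trans (alt-+ β _ _) (+-cong (up-quot-rows β schur↑ (+ v) m) (alt-* β (pw⁻ n) _)) ⟩
        rows (+ v) β (λ γ → schur↑ (m ∷ γ)) + pw⁻ n * L
          ≈⟨ +-congˡ (*-congˡ (trans (sym (cancel′ L)) (*-congˡ (up-quot-rest β schur↑ v m)))) ⟩
        rows (+ v) β (λ γ → schur↑ (m ∷ γ)) + pw⁻ n * (a⁻¹ * ((a - 1#) * (pw m * schur↑ (m ℤ.+ + v ∷ β)) + rest (+ v) (m ∷ β) schur↑))
          ≈⟨ solve 7 (λ x c a⁻¹ u p s r → x :+ c :* (a⁻¹ :* (u :* (p :* s) :+ r)) := (u :* (a⁻¹ :* (p :* c)) :* s :+ x) :+ (a⁻¹ :* c) :* r) refl _ _ _ _ _ _ _ ⟩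
        rows (+ v) (m ∷ β) schur↑ + pw⁻ (suc n) * rest (+ v) (m ∷ β) schur↑ ∎
        where
        L : Carrier
        L = up β m (λ k γ → quot a (λ i j → h i * rest j γ schur↑) k (+ v))

      -- All terms but the last vanish, and the last one carries a^n h_0. Of this coefficient only
      -- cancellability is recorded, which holds because `a` is invertible.
      geom-last : ∀ (r : ℤ → Carrier) n v → (∀ j → j ℕ.< n → r (+ (v ℕ.+ j)) ≈ 0#) →
        Data.Product.Σ Carrier (λ c → (∀ x → c * x ≈ 0# → x ≈ 0#) × geom a (λ i j → h i * r j) (+ n) (+ v) ≈ c * r (+ (v ℕ.+ n)))
      geom-last r zero v r0 = 1# , (λ x e → trans (sym (*-identityˡ x)) e) , *-cong h0 (reflexive (≡.cong (λ k → r (+ k)) (≡.sym (ℕ.+-identityʳ v))))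
      geom-last r (suc n) v r0 with geom-last r n (suc v) (λ j j<n → trans (reflexive (≡.cong (λ k → r (+ k)) (≡.sym (ℕ.+-suc v j)))) (r0 (suc j) (s≤s j<n)))
      ... | c , inj , e = a * c , (λ x e → inj x (trans (sym (cancel′ _)) (trans (*-congˡ (trans (sym (*-assoc _ _ _)) e)) (zeroʳ _)))) ,
        trans (+-cong (trans (*-congˡ (trans (reflexive (≡.cong (λ k → r (+ k)) (≡.sym (ℕ.+-identityʳ v)))) (r0 0 (s≤s z≤n)))) (zeroʳ _)) (*-congˡ e))
          (trans (+-identityˡ _) (trans (sym (*-assoc _ _ _)) (*-congˡ (reflexive (≡.cong (λ k → r (+ k)) (≡.sym (ℕ.+-suc v n)))))))

      module _ (M : ℕ) {n} (β : Vec ℤ n) where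

        private
          β′ : Vec ℤ (M ℕ.+ n)
          β′ = zeros M β
          r : ℤ → Carrier
          r v = rest v β′ schur↑

        -- Replacing the weight `pw w` by 1 is harmless: the difference vanishes at w = 0 and
        -- `full-zeros` removes the other terms. With weight 1, `full` inverts the expansion that
        -- defines `schur↑`.
        geom-rest-zeros : ∀ {m} → m ℕ.≤ M → geom a (λ i j → h i * r j) (+ m) (+ 0) ≈ h (+ m) * schur↑ β′
        geom-rest-zeros {m} m≤M = begin
          geom a (λ i j → h i * r j) (+ m) (+ 0)
            ≈⟨ geom-rest β′ schur↑ (+ m) ⟩
          full (+ m) β′ (λ w γ → pw w * schur↑ (w ∷ γ))
            ≈⟨ solve 2 (λ x y → x := (x :- y) :+ y) refl _ _ ⟩
          (full (+ m) β′ (λ w γ → pw w * schur↑ (w ∷ γ)) - full (+ m) β′ (λ w γ → schur↑ (w ∷ γ))) + full (+ m) β′ (λ w γ → schur↑ (w ∷ γ))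
            ≈⟨ +-congʳ (trans (sym (full-- β′ _ _)) (full-cong β′ (λ w γ → solve 2 (λ x y → x :* y :- y := (x :- con (+ 1)) :* y) refl _ _))) ⟩
          full (+ m) β′ (λ w γ → (pw w - 1#) * schur↑ (w ∷ γ)) + full (+ m) β′ (λ w γ → schur↑ (w ∷ γ))
            ≈⟨ +-congʳ (full-zeros torsion-free M β (λ w → pw w - 1#) {schur↑} (trans (+-congʳ pw-0) (-‿inverseʳ 1#)) (Antisym-schurBy suc-pred pred-suc h) m≤M) ⟩
          0# + full (+ m) β′ (λ w γ → schur↑ (w ∷ γ))
            ≈⟨ trans (+-identityˡ _) (full-alt β′ (h*-neg (λ k → schur↑))) ⟩
          h (+ m) * schur↑ β′ ∎

        -- Strong induction. In the sum of `geom-rest-zeros` the term j = 0 already equals the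
        -- right-hand side, and the induction hypothesis leaves only the last of the other terms.
        rest-zeros : ∀ v → suc v ℕ.≤ M → r (+ suc v) ≈ 0#
        rest-zeros v v<M = <-rec (λ v → suc v ℕ.≤ M → r (+ suc v) ≈ 0#) step v v<M
          where
          open import Data.Nat.Induction using (<-rec)
          step : ∀ v → (∀ {j} → j ℕ.< v → suc j ℕ.≤ M → r (+ suc j) ≈ 0#) → suc v ℕ.≤ M → r (+ suc v) ≈ 0#
          step v IH v<M with geom-last r v 1 (λ j j<v → IH j<v (ℕ.≤-trans (ℕ.m≤n⇒m≤1+n j<v) v<M))
          ... | c , inj , e = inj _ (begin
            c * r (+ suc v)                                  ≈⟨ e ⟨
            geom a (λ i j → h i * r j) (+ v) (+ 1)           ≈⟨ cancel′ _ ⟨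
            a⁻¹ * (a * geom a (λ i j → h i * r j) (+ v) (+ 1))
              ≈⟨ *-congˡ (solve 2 (λ x y → y := (x :+ y) :- x) refl (h (+ suc v) * r (+ 0)) _) ⟩
            a⁻¹ * (geom a (λ i j → h i * r j) (+ suc v) (+ 0) - h (+ suc v) * r (+ 0))
              ≈⟨ *-congˡ (+-cong (geom-rest-zeros v<M) (-‿cong (*-congˡ (rest-0 β′ schur↑)))) ⟩
            a⁻¹ * (h (+ suc v) * schur↑ β′ - h (+ suc v) * schur↑ β′)
              ≈⟨ trans (*-congˡ (-‿inverseʳ _)) (zeroʳ _) ⟩
            0# ∎)

        τ-zeros : ∀ v → suc v ℕ.≤ M → τ (+ suc v) β′ ≈ rows (+ suc v) β′ schur↑
        τ-zeros v v<M = trans (τ-rows-rest (suc v) β′) (trans (+-congˡ (trans (*-congˡ (rest-zeros v v<M)) (zeroʳ _))) (+-identityʳ _))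

-- Omitting and inserting a position

skip-suc : ∀ j k → skip (suc j) (suc k) ≡ suc (skip j k)
skip-suc j k with k ℕ.<ᵇ j
... | true = ≡.refl
... | false = ≡.refl

_◁_ : Bool → (ℕ → Bool) → ℕ → Bool
(b ◁ η) zero = b
(b ◁ η) (suc k) = η k

-- Complementary to `skip j`, which enumerates the positions other than `j`.
insert : ℕ → Bool → (ℕ → Bool) → ℕ → Bool
insert zero b η = b ◁ η
insert (suc j) b η = η 0 ◁ insert j b (η ∘ suc)

insert-at : ∀ j b η → insert j b η j ≡ b
insert-at zero b η = ≡.refl
insert-at (suc j) b η = insert-at j b (η ∘ suc)

insert-skip : ∀ j b η k → insert j b η (skip j k) ≡ η k
insert-skip zero b η k = ≡.refl
insert-skip (suc j) b η zero = ≡.refl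
insert-skip (suc j) b η (suc k) = ≡.trans (≡.cong (insert (suc j) b η) (skip-suc j k)) (insert-skip j b (η ∘ suc) k)

skip-≥ : ∀ {j k} → j ℕ.≤ k → skip j k ≡ suc k
skip-≥ {zero} z≤n = ≡.refl
skip-≥ {suc j} {suc k} (s≤s le) = ≡.trans (skip-suc j k) (≡.cong suc (skip-≥ le))

skip-< : ∀ {j k} → k ℕ.< j → skip j k ≡ k
skip-< {suc j} {zero} lt = ≡.refl
skip-< {suc j} {suc k} (s≤s lt) = ≡.trans (skip-suc j k) (≡.cong suc (skip-< lt))

-- Determinants and the Jacobi–Trudi formula

module Determinants (R : CommutativeRing 0ℓ 0ℓ) where
  open CommutativeRing R hiding (zero)
  open IntegerSolver R
  open AlternatingSums R
  open import Relation.Binary.Reasoning.Setoid setoid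

  opaque
    sum< : ℕ → (ℕ → Carrier) → Carrier
    sum< zero f = 0#
    sum< (suc n) f = f 0 + sum< n (λ j → f (suc j))

    sum<-cong : ∀ n {f g} → (∀ j → j ℕ.< n → f j ≈ g j) → sum< n f ≈ sum< n g
    sum<-cong zero e = refl
    sum<-cong (suc n) e = +-cong (e 0 (s≤s z≤n)) (sum<-cong n (λ j j<n → e (suc j) (s≤s j<n)))

    sum<-+ : ∀ n f g → sum< n (λ j → f j + g j) ≈ sum< n f + sum< n g
    sum<-+ zero f g = sym (+-identityʳ 0#)
    sum<-+ (suc n) f g = trans (+-congˡ (sum<-+ n _ _)) (solve 4 (λ x y z w → (x :+ y) :+ (z :+ w) := (x :+ z) :+ (y :+ w)) refl _ _ _ _)

    sum<-* : ∀ n c f → sum< n (λ j → c * f j) ≈ c * sum< n f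
    sum<-* zero c f = sym (zeroʳ c)
    sum<-* (suc n) c f = trans (+-congˡ (sum<-* n c _)) (sym (distribˡ c _ _))

    sum<-0 : ∀ n f → (∀ j → j ℕ.< n → f j ≈ 0#) → sum< n f ≈ 0#
    sum<-0 zero f e = refl
    sum<-0 (suc n) f e = trans (+-cong (e 0 (s≤s z≤n)) (sum<-0 n _ (λ j j<n → e (suc j) (s≤s j<n)))) (+-identityʳ 0#)

    sum<-two : ∀ n f k → suc k ℕ.< n → f k + f (suc k) ≈ 0# →
      (∀ j → j ℕ.< k → f j ≈ 0#) → (∀ j → suc k ℕ.< j → j ℕ.< n → f j ≈ 0#) → sum< n f ≈ 0#
    sum<-two (suc (suc n)) f zero lt e below above = trans (sym (+-assoc _ _ _))
      (trans (+-cong e (sum<-0 n _ (λ j j<n → above (suc (suc j)) (s≤s (s≤s z≤n)) (s≤s (s≤s j<n))))) (+-identityʳ 0#))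
    sum<-two (suc n) f (suc k) (s≤s lt) e below above = trans (+-cong (below 0 (s≤s z≤n))
      (sum<-two n _ k lt e (λ j j<k → below (suc j) (s≤s j<k)) (λ j k<j j<n → above (suc j) (s≤s k<j) (s≤s j<n)))) (+-identityʳ 0#)

    sum<-suc : ∀ n f → sum< (suc n) f ≈ f 0 + sum< n (λ j → f (suc j))
    sum<-suc n f = refl

    sum<-zero : ∀ f → sum< 0 f ≈ 0#
    sum<-zero f = refl

  sign : ℕ → Carrier
  sign zero = 1#
  sign (suc j) = - sign j

  Row : Set
  Row = ℕ → Carrier

  Rows≈ : ∀ {n} → Vec Row n → Vec Row n → Set
  Rows≈ = Pointwise (λ r r′ → ∀ k → r k ≈ r′ k)

  Rows-refl : ∀ {n} {rs : Vec Row n} → Rows≈ rs rs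
  Rows-refl = Pointwise.refl (λ k → refl)

  dropColumn : ∀ {n} → ℕ → Vec Row n → Vec Row n
  dropColumn j = Vec.map (λ r k → r (skip j k))

  determinant : ∀ {n} → Vec Row n → Carrier
  determinant [] = 1#
  determinant {suc n} (r ∷ rs) = sum< (suc n) (λ j → sign j * (r j * determinant (dropColumn j rs)))

  determinant-cong : ∀ {n} {rs rs′ : Vec Row n} → Rows≈ rs rs′ → determinant rs ≈ determinant rs′
  determinant-cong [] = refl
  determinant-cong {suc n} (r≈ ∷ rs≈) = sum<-cong (suc n) (λ j _ →
    *-congˡ (*-cong (r≈ j) (determinant-cong (Pointwise.map⁺ (λ e k → e (skip j k)) rs≈))))

  private
    skip-equal : ∀ (r : Row) k → r k ≈ r (suc k) → ∀ i → r (skip k i) ≈ r (skip (suc k) i)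
    skip-equal r zero e zero = sym e
    skip-equal r zero e (suc i) = refl
    skip-equal r (suc k) e zero = refl
    skip-equal r (suc k) e (suc i) = begin
      r (skip (suc k) (suc i))         ≡⟨ ≡.cong r (skip-suc k i) ⟩
      r (suc (skip k i))               ≈⟨ skip-equal (r ∘ suc) k e i ⟩
      r (suc (skip (suc k) i))         ≡⟨ ≡.cong r (skip-suc (suc k) i) ⟨
      r (skip (suc (suc k)) (suc i))   ∎

  -- In the expansion along the first row, the terms k and k + 1 have equal minors and opposite
  -- signs. Every other term has a minor that again contains two equal adjacent columns.
  determinant-equal : ∀ {n} (rs : Vec Row n) k → suc k ℕ.< n → VecAll.All (λ r → r k ≈ r (suc k)) rs → determinant rs ≈ 0#
  determinant-equal {suc n} (r ∷ rs) k lt (e ∷ es) = sum<-two (suc n) _ k lt adjacent below above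
    where
    adjacent : sign k * (r k * determinant (dropColumn k rs)) + - sign k * (r (suc k) * determinant (dropColumn (suc k) rs)) ≈ 0#
    adjacent = trans (+-congˡ (*-congˡ (*-cong (sym e) (determinant-cong (columns rs es)))))
      (solve 2 (λ x y → x :* y :+ (:- x) :* y := con (+ 0)) refl _ _)
      where
      columns : ∀ {n} (rs : Vec Row n) → VecAll.All (λ r → r k ≈ r (suc k)) rs → Rows≈ (dropColumn (suc k) rs) (dropColumn k rs)
      columns [] [] = []
      columns (r ∷ rs) (e ∷ es) = (λ i → sym (skip-equal r k e i)) ∷ columns rs es
    vanish : ∀ {j} k′ → suc k′ ℕ.< n → skip j k′ ≡ k → skip j (suc k′) ≡ suc k → sign j * (r j * determinant (dropColumn j rs)) ≈ 0#
    vanish {j} k′ lt p q = trans (*-congˡ (trans (*-congˡ (determinant-equal (dropColumn j rs) k′ lt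
      (VecAll.map⁺ (VecAll.map (λ {r} e → trans (reflexive (≡.cong r p)) (trans e (reflexive (≡.cong r (≡.sym q))))) es)))) (zeroʳ _))) (zeroʳ _)
    below : ∀ j → j ℕ.< k → sign j * (r j * determinant (dropColumn j rs)) ≈ 0#
    below j (s≤s {n = k′} j≤k′) = vanish k′ (ℕ.≤-pred lt) (skip-≥ j≤k′) (skip-≥ (ℕ.m≤n⇒m≤1+n j≤k′))
    above : ∀ j → suc k ℕ.< j → j ℕ.< suc n → sign j * (r j * determinant (dropColumn j rs)) ≈ 0#
    above j lt′ (s≤s j≤n) = vanish k (ℕ.≤-trans lt′ j≤n) (skip-< (ℕ.<⇒≤ lt′)) (skip-< lt′)

  -- Choices of rows, respectively columns, of P + x Q; the weight argument records the degree in x.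
  rowChoices : ∀ {n} → Vec (Row × Row) n → (ℕ → Vec Row n → Carrier) → Carrier
  rowChoices [] F = F 0 []
  rowChoices ((P , Q) ∷ rs) F = rowChoices rs (λ k v → F k (P ∷ v)) + rowChoices rs (λ k v → F (suc k) (Q ∷ v))

  columnChoices : ℕ → (ℕ → (ℕ → Bool) → Carrier) → Carrier
  columnChoices zero G = G 0 (λ _ → false)
  columnChoices (suc n) G = columnChoices n (λ k η → G k (false ◁ η)) + columnChoices n (λ k η → G (suc k) (true ◁ η))

  rowChoices-cong : ∀ {n} (rs : Vec (Row × Row) n) {F G} → (∀ k v → F k v ≈ G k v) → rowChoices rs F ≈ rowChoices rs G
  rowChoices-cong [] e = e 0 []
  rowChoices-cong (_ ∷ rs) e = +-cong (rowChoices-cong rs (λ k v → e k _)) (rowChoices-cong rs (λ k v → e (suc k) _))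

  rowChoices-* : ∀ {n} (rs : Vec (Row × Row) n) c F → rowChoices rs (λ k v → c * F k v) ≈ c * rowChoices rs F
  rowChoices-* [] c F = refl
  rowChoices-* (_ ∷ rs) c F = trans (+-cong (rowChoices-* rs c _) (rowChoices-* rs c _)) (sym (distribˡ c _ _))

  rowChoices-+ : ∀ {n} (rs : Vec (Row × Row) n) F G → rowChoices rs (λ k v → F k v + G k v) ≈ rowChoices rs F + rowChoices rs G
  rowChoices-+ [] F G = refl
  rowChoices-+ (_ ∷ rs) F G = trans (+-cong (rowChoices-+ rs _ _) (rowChoices-+ rs _ _))
    (solve 4 (λ x y z w → (x :+ y) :+ (z :+ w) := (x :+ z) :+ (y :+ w)) refl _ _ _ _)

  rowChoices-0 : ∀ {n} (rs : Vec (Row × Row) n) → rowChoices rs (λ k v → 0#) ≈ 0#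
  rowChoices-0 [] = refl
  rowChoices-0 (_ ∷ rs) = trans (+-cong (rowChoices-0 rs) (rowChoices-0 rs)) (+-identityʳ 0#)

  rowChoices-sum : ∀ {n} (rs : Vec (Row × Row) n) m F → rowChoices rs (λ k v → sum< m (λ j → F j k v)) ≈ sum< m (λ j → rowChoices rs (F j))
  rowChoices-sum rs zero F = trans (rowChoices-cong rs (λ k v → sum<-zero _)) (trans (rowChoices-0 rs) (sym (sum<-zero _)))
  rowChoices-sum rs (suc m) F = trans (rowChoices-cong rs (λ k v → sum<-suc m _)) (trans (rowChoices-+ rs (F 0) _)
    (trans (+-congˡ (rowChoices-sum rs m (λ j → F (suc j)))) (sym (sum<-suc m _))))

  rowChoices-map : ∀ {n} (f : Row → Row) (rs : Vec (Row × Row) n) F →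
    rowChoices rs (λ k v → F k (Vec.map f v)) ≡ rowChoices (Vec.map (λ (P , Q) → f P , f Q) rs) F
  rowChoices-map f [] F = ≡.refl
  rowChoices-map f (_ ∷ rs) F = ≡.cong₂ _+_ (rowChoices-map f rs _) (rowChoices-map f rs _)

  columnChoices-cong : ∀ n {F G} → (∀ k η → F k η ≈ G k η) → columnChoices n F ≈ columnChoices n G
  columnChoices-cong zero e = e 0 _
  columnChoices-cong (suc n) e = +-cong (columnChoices-cong n (λ k η → e k _)) (columnChoices-cong n (λ k η → e (suc k) _))

  columnChoices-* : ∀ n c F → columnChoices n (λ k η → c * F k η) ≈ c * columnChoices n F
  columnChoices-* zero c F = refl
  columnChoices-* (suc n) c F = trans (+-cong (columnChoices-* n c _) (columnChoices-* n c _)) (sym (distribˡ c _ _))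

  columnChoices-+ : ∀ n F G → columnChoices n (λ k η → F k η + G k η) ≈ columnChoices n F + columnChoices n G
  columnChoices-+ zero F G = refl
  columnChoices-+ (suc n) F G = trans (+-cong (columnChoices-+ n _ _) (columnChoices-+ n _ _))
    (solve 4 (λ x y z w → (x :+ y) :+ (z :+ w) := (x :+ z) :+ (y :+ w)) refl _ _ _ _)

  columnChoices-0 : ∀ n → columnChoices n (λ k η → 0#) ≈ 0#
  columnChoices-0 zero = refl
  columnChoices-0 (suc n) = trans (+-cong (columnChoices-0 n) (columnChoices-0 n)) (+-identityʳ 0#)

  columnChoices-sum : ∀ n m F → columnChoices n (λ k η → sum< m (λ j → F j k η)) ≈ sum< m (λ j → columnChoices n (F j))
  columnChoices-sum n zero F = trans (columnChoices-cong n (λ k η → sum<-zero _)) (trans (columnChoices-0 n) (sym (sum<-zero _)))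
  columnChoices-sum n (suc m) F = trans (columnChoices-cong n (λ k η → sum<-suc m _)) (trans (columnChoices-+ n (F 0) _)
    (trans (+-congˡ (columnChoices-sum n m (λ j → F (suc j)))) (sym (sum<-suc m _))))

  Extensional : (ℕ → (ℕ → Bool) → Carrier) → Set
  Extensional G = ∀ k {η θ} → (∀ i → η i ≡ θ i) → G k η ≈ G k θ

  ◁-cong : ∀ b {η θ : ℕ → Bool} → (∀ i → η i ≡ θ i) → ∀ i → (b ◁ η) i ≡ (b ◁ θ) i
  ◁-cong b e zero = ≡.refl
  ◁-cong b e (suc i) = e i

  columnChoices-insert : ∀ n j {G} → Extensional G → j ℕ.≤ n → columnChoices (suc n) G ≈
    columnChoices n (λ k η → G k (insert j false η)) + columnChoices n (λ k η → G (suc k) (insert j true η))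
  columnChoices-insert n zero ext le = refl
  columnChoices-insert (suc n) (suc j) ext (s≤s le) = trans
    (+-cong (columnChoices-insert n j (λ k e → ext k (◁-cong false e)) le) (columnChoices-insert n j (λ k e → ext (suc k) (◁-cong true e)) le))
    (solve 4 (λ x y z w → (x :+ y) :+ (z :+ w) := (x :+ z) :+ (y :+ w)) refl _ _ _ _)

  mix : (ℕ → Bool) → Row × Row → Row
  mix η (P , Q) k = if η k then Q k else P k

  -- Both sides weight the coefficients of x^k in det(P + xQ) by `w k`: once the determinant is
  -- expanded by multilinearity in the rows, once in the columns.
  rows-columns : ∀ {n} (rs : Vec (Row × Row) n) (w : ℕ → Carrier) →
    rowChoices rs (λ k v → w k * determinant v) ≈ columnChoices n (λ k η → w k * determinant (Vec.map (mix η) rs))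
  rows-columns [] w = refl
  rows-columns {suc n} ((P , Q) ∷ rs) w = begin
    rowChoices rs (λ k v → w k * determinant (P ∷ v)) + rowChoices rs (λ k v → w (suc k) * determinant (Q ∷ v))
      ≈⟨ +-cong (firstRow P w) (firstRow Q (λ k → w (suc k))) ⟩
    sum< (suc n) (λ j → sign j * (P j * minor j w)) + sum< (suc n) (λ j → sign j * (Q j * minor j (λ k → w (suc k))))
      ≈⟨ sum<-+ (suc n) _ _ ⟨
    sum< (suc n) (λ j → sign j * (P j * minor j w) + sign j * (Q j * minor j (λ k → w (suc k))))
      ≈⟨ sum<-cong (suc n) (λ { j (s≤s j≤n) → sym (column j j≤n) }) ⟩
    sum< (suc n) (λ j → columnChoices (suc n) (G j))
      ≈⟨ columnChoices-sum (suc n) (suc n) G ⟨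
    columnChoices (suc n) (λ k η → sum< (suc n) (λ j → G j k η))
      ≈⟨ columnChoices-cong (suc n) (λ k η → trans (sum<-cong (suc n) (λ j _ → solve 4 (λ s w x y → s :* (w :* (x :* y)) := w :* (s :* (x :* y))) refl
             (sign j) (w k) (mix η (P , Q) j) (determinant (dropColumn j (Vec.map (mix η) rs))))) (sum<-* (suc n) (w k) _)) ⟩
    columnChoices (suc n) (λ k η → w k * determinant (Vec.map (mix η) ((P , Q) ∷ rs))) ∎
    where
    drop² : ℕ → ∀ {n} → Vec (Row × Row) n → Vec (Row × Row) n
    drop² j = Vec.map (λ (P , Q) → (λ k → P (skip j k)) , (λ k → Q (skip j k)))
    minor : ℕ → (ℕ → Carrier) → Carrier
    minor j w = columnChoices n (λ k η → w k * determinant (Vec.map (mix η) (drop² j rs)))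
    firstRow : ∀ P w → rowChoices rs (λ k v → w k * determinant (P ∷ v)) ≈ sum< (suc n) (λ j → sign j * (P j * minor j w))
    firstRow P w = begin
      rowChoices rs (λ k v → w k * sum< (suc n) (λ j → sign j * (P j * determinant (dropColumn j v))))
        ≈⟨ rowChoices-cong rs (λ k v → trans (sym (sum<-* (suc n) (w k) _)) (sum<-cong (suc n) (λ j _ →
             solve 4 (λ w s x y → w :* (s :* (x :* y)) := (s :* x) :* (w :* y)) refl _ _ _ _))) ⟩
      rowChoices rs (λ k v → sum< (suc n) (λ j → (sign j * P j) * (w k * determinant (dropColumn j v))))
        ≈⟨ rowChoices-sum rs (suc n) _ ⟩
      sum< (suc n) (λ j → rowChoices rs (λ k v → (sign j * P j) * (w k * determinant (dropColumn j v))))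
        ≈⟨ sum<-cong (suc n) (λ j _ → trans (rowChoices-* rs _ _) (trans (*-congˡ (trans
             (reflexive (rowChoices-map (λ r k → r (skip j k)) rs (λ k v → w k * determinant v))) (rows-columns (drop² j rs) w))) (*-assoc _ _ _))) ⟩
      sum< (suc n) (λ j → sign j * (P j * minor j w)) ∎
    G : ℕ → ℕ → (ℕ → Bool) → Carrier
    G j k η = sign j * (w k * (mix η (P , Q) j * determinant (dropColumn j (Vec.map (mix η) rs))))
    mix-cong : ∀ {η θ} → (∀ i → η i ≡ θ i) → ∀ r k → mix η r k ≈ mix θ r k
    mix-cong e (P , Q) k = reflexive (≡.cong (λ b → if b then Q k else P k) (e k))
    G-ext : ∀ j → Extensional (G j)
    G-ext j k {η} {θ} e = *-congˡ (*-congˡ (*-cong (mix-cong e (P , Q) j) (determinant-cong (Pointwise.map⁺ (λ e k → e (skip j k)) (all rs)))))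
      where
      all : ∀ {n} (rs : Vec (Row × Row) n) → Rows≈ (Vec.map (mix η) rs) (Vec.map (mix θ) rs)
      all [] = []
      all (r ∷ rs) = mix-cong e r ∷ all rs
    inserted : ∀ j b η → Rows≈ (dropColumn j (Vec.map (mix (insert j b η)) rs)) (Vec.map (mix η) (drop² j rs))
    inserted j b η = all rs
      where
      all : ∀ {n} (rs : Vec (Row × Row) n) → Rows≈ (dropColumn j (Vec.map (mix (insert j b η)) rs)) (Vec.map (mix η) (drop² j rs))
      all [] = []
      all ((P , Q) ∷ rs) = (λ k → reflexive (≡.cong (λ b → if b then Q (skip j k) else P (skip j k)) (insert-skip j b η k))) ∷ all rs
    -- The choice made at column `j` decides whether the first-row entry comes from `P` or `Q`; the
    -- choices at the other columns concern only the minor.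
    column : ∀ j → j ℕ.≤ n → columnChoices (suc n) (G j) ≈ sign j * (P j * minor j w) + sign j * (Q j * minor j (λ k → w (suc k)))
    column j j≤n = trans (columnChoices-insert n j (G-ext j) j≤n) (+-cong (part false P w ≡.refl) (part true Q (λ k → w (suc k)) ≡.refl))
      where
      part : ∀ b X (u : ℕ → Carrier) → (if b then Q else P) ≡ X →
        columnChoices n (λ k η → sign j * (u k * (mix (insert j b η) (P , Q) j * determinant (dropColumn j (Vec.map (mix (insert j b η)) rs))))) ≈ sign j * (X j * minor j u)
      part b X u e = trans (columnChoices-cong n (λ k η → trans (*-congˡ (*-congˡ (*-cong (entry b X e η) (determinant-cong (inserted j b η)))))
          (solve 4 (λ s u x y → s :* (u :* (x :* y)) := (s :* x) :* (u :* y)) refl _ _ _ _)))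
        (trans (columnChoices-* n _ _) (*-assoc _ _ _))
        where
        entry : ∀ b X → (if b then Q else P) ≡ X → ∀ η → mix (insert j b η) (P , Q) j ≈ X j
        entry false X e η rewrite insert-at j false η = reflexive (≡.cong (λ r → r j) e)
        entry true X e η rewrite insert-at j true η = reflexive (≡.cong (λ r → r j) e)

  -- Only the choices of the form true … true false … false avoid equal adjacent columns.
  columnChoices-threshold : ∀ n {G} → Extensional G →
    (∀ k η i → suc i ℕ.< n → η i ≡ false → η (suc i) ≡ true → G k η ≈ 0#) →
    columnChoices n G ≈ sum< (suc n) (λ j → G j (λ k → k ℕ.<ᵇ j))
  columnChoices-threshold zero ext van = trans (ext 0 (λ i → ≡.refl)) (sym (trans (sum<-suc 0 _) (trans (+-congˡ (sum<-zero _)) (+-identityʳ _))))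
  columnChoices-threshold (suc n) {G} ext van = trans (+-cong first second) (sym (sum<-suc (suc n) _))
    where
    first : columnChoices n (λ k η → G k (false ◁ η)) ≈ G 0 (λ k → k ℕ.<ᵇ 0)
    first = trans (columnChoices-threshold n (λ k e → ext k (◁-cong false e)) (λ k η i lt p q → van k _ (suc i) (s≤s lt) p q))
      (trans (sum<-suc n _) (trans (+-cong (ext 0 (λ { zero → ≡.refl ; (suc i) → ≡.refl })) (sum<-0 n _ (λ j j<n → van (suc j) _ 0 (s≤s (ℕ.≤-trans (s≤s z≤n) j<n)) ≡.refl ≡.refl))) (+-identityʳ _)))
    second : columnChoices n (λ k η → G (suc k) (true ◁ η)) ≈ sum< (suc n) (λ j → G (suc j) (λ k → k ℕ.<ᵇ suc j))
    second = trans (columnChoices-threshold n (λ k e → ext (suc k) (◁-cong true e)) (λ k η i lt p q → van (suc k) _ (suc i) (s≤s lt) p q))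
      (sum<-cong (suc n) (λ j _ → ext (suc j) {true ◁ (λ k → k ℕ.<ᵇ j)} (λ { zero → ≡.refl ; (suc i) → ≡.refl })))

  withShift : Row → Row × Row
  withShift r = (λ k → r (suc k)) , r

  -- Column k of a mixture is column k or k + 1 of `rs`, for the values true and false. Passing from
  -- false to true repeats a column, so the surviving mixtures are true on the first j columns and
  -- false afterwards: exactly column j is omitted, and the degree is j.
  rowChoices-shift : ∀ {n} (rs : Vec Row n) (w : ℕ → Carrier) →
    rowChoices (Vec.map withShift rs) (λ k v → w k * determinant v) ≈ sum< (suc n) (λ j → w j * determinant (dropColumn j rs))
  rowChoices-shift {n} rs w = trans (rows-columns (Vec.map withShift rs) w) (trans
    (columnChoices-threshold n (λ k e → *-congˡ (determinant-cong (ext rs e))) (λ k η i lt p q →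
      trans (*-congˡ (determinant-equal _ i lt (equal rs η i p q))) (zeroʳ _)))
    (sum<-cong (suc n) (λ j _ → *-congˡ (determinant-cong (thresholds rs j)))))
    where
    ext : ∀ {n} (rs : Vec Row n) {η θ : ℕ → Bool} → (∀ i → η i ≡ θ i) → Rows≈ (Vec.map (mix η) (Vec.map withShift rs)) (Vec.map (mix θ) (Vec.map withShift rs))
    ext [] e = []
    ext (r ∷ rs) e = (λ k → reflexive (≡.cong (λ b → if b then r k else r (suc k)) (e k))) ∷ ext rs e
    equal : ∀ {n} (rs : Vec Row n) η i → η i ≡ false → η (suc i) ≡ true → VecAll.All (λ r → r i ≈ r (suc i)) (Vec.map (mix η) (Vec.map withShift rs))
    equal [] η i p q = []
    equal (r ∷ rs) η i p q = trans (reflexive (≡.cong (λ b → if b then r i else r (suc i)) p))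
      (sym (reflexive (≡.cong (λ b → if b then r (suc i) else r (suc (suc i))) q))) ∷ equal rs η i p q
    threshold : ∀ (r : Row) j k → mix (λ k → k ℕ.<ᵇ j) (withShift r) k ≈ r (skip j k)
    threshold r j k with k ℕ.<ᵇ j
    ... | true = refl
    ... | false = refl
    thresholds : ∀ {n} (rs : Vec Row n) j → Rows≈ (Vec.map (mix (λ k → k ℕ.<ᵇ j)) (Vec.map withShift rs)) (dropColumn j rs)
    thresholds [] j = []
    thresholds (r ∷ rs) j = threshold r j ∷ thresholds rs j

  module _ (h : ℤ → Carrier) where
    open Schur h

    hRow : ℤ → Row
    hRow c zero = h c
    hRow c (suc j) = hRow (sucℤ c) j

    hRows : (ℤ → ℤ) → ∀ {n} → Vec ℤ n → Vec Row n
    hRows f [] = []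
    hRows f (m ∷ β) = hRow (f m) ∷ hRows (predℤ ∘ f) β

    -- Choosing the unshifted version of a row lowers its length by one and moves the first row to
    -- its next entry. These are the two effects of a choice in `alt predℤ sucℤ`, and `sign k`
    -- supplies its signs.
    rowChoices-alt : ∀ {n} (f : ℤ → ℤ) → (∀ i → f (predℤ i) ≡ predℤ (f i)) → (β : Vec ℤ n) → ∀ m
      (F : Vec Row n → Carrier) → (∀ {rs rs′} → Rows≈ rs rs′ → F rs ≈ F rs′) →
      rowChoices (Vec.map withShift (hRows (predℤ ∘ f) β)) (λ k v → sign k * hRow m k * F v) ≈
      alt predℤ sucℤ β m (λ k γ → h k * F (hRows f γ))
    rowChoices-alt f fp [] m F F-cong = *-congʳ (*-identityˡ _)
    rowChoices-alt f fp (b ∷ β) m F F-cong = +-cong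
      (trans (rowChoices-alt (predℤ ∘ f) (λ i → ≡.cong predℤ (fp i)) β m _ (λ e → F-cong ((λ k → refl) ∷ e)))
        (alt-cong β (λ k γ → *-congˡ (F-cong ((λ k → reflexive (≡.cong (λ i → hRow i k) (suc-pred (f b)))) ∷ Rows-refl)))))
      (begin
        rowChoices rs (λ k v → - sign k * hRow (sucℤ m) k * F (hRow (predℤ (f b)) ∷ v))
          ≈⟨ rowChoices-cong rs (λ k v → solve 3 (λ x y z → (:- x) :* y :* z := (:- con (+ 1)) :* (x :* y :* z)) refl _ _ _) ⟩
        rowChoices rs (λ k v → - 1# * (sign k * hRow (sucℤ m) k * F (hRow (predℤ (f b)) ∷ v)))
          ≈⟨ rowChoices-* rs _ _ ⟩
        - 1# * rowChoices rs (λ k v → sign k * hRow (sucℤ m) k * F (hRow (predℤ (f b)) ∷ v))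
          ≈⟨ *-congˡ (rowChoices-alt (predℤ ∘ f) (λ i → ≡.cong predℤ (fp i)) β (sucℤ m) _ (λ e → F-cong ((λ k → refl) ∷ e))) ⟩
        - 1# * alt predℤ sucℤ β (sucℤ m) (λ k γ → h k * F (hRow (predℤ (f b)) ∷ hRows (predℤ ∘ f) γ))
          ≈⟨ solve 1 (λ x → (:- con (+ 1)) :* x := :- x) refl _ ⟩
        - alt predℤ sucℤ β (sucℤ m) (λ k γ → h k * F (hRow (predℤ (f b)) ∷ hRows (predℤ ∘ f) γ))
          ≈⟨ -‿cong (alt-cong β (λ k γ → *-congˡ (F-cong ((λ k → reflexive (≡.cong (λ i → hRow i k) (≡.sym (fp b)))) ∷ Rows-refl)))) ⟩
        - alt predℤ sucℤ β (sucℤ m) (λ k γ → h k * F (hRows f (predℤ b ∷ γ))) ∎)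
      where
      rs = Vec.map withShift (hRows (predℤ ∘ (predℤ ∘ f)) β)

    jacobiTrudi : ∀ {n} (β : Vec ℤ n) → determinant (hRows (λ i → i) β) ≈ schur↓ β
    jacobiTrudi [] = refl
    jacobiTrudi {suc n} (m ∷ β) = begin
      sum< (suc n) (λ j → sign j * (hRow m j * determinant (dropColumn j (hRows predℤ β))))
        ≈⟨ sum<-cong (suc n) (λ j _ → sym (*-assoc _ _ _)) ⟩
      sum< (suc n) (λ j → sign j * hRow m j * determinant (dropColumn j (hRows predℤ β)))
        ≈⟨ rowChoices-shift (hRows predℤ β) (λ j → sign j * hRow m j) ⟨
      rowChoices (Vec.map withShift (hRows predℤ β)) (λ k v → sign k * hRow m k * determinant v)
        ≈⟨ rowChoices-alt (λ i → i) (λ i → ≡.refl) β m determinant determinant-cong ⟩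
      alt predℤ sucℤ β m (λ k γ → h k * determinant (hRows (λ i → i) γ))
        ≈⟨ alt-cong β (λ k γ → *-congˡ (jacobiTrudi γ)) ⟩
      schur↓ (m ∷ β) ∎

-- Straightening of compositions

suc-⊖-suc : ∀ m n → sucℤ (m ℤ.⊖ suc n) ≡ m ℤ.⊖ n
suc-⊖ : ∀ m n → sucℤ (m ℤ.⊖ n) ≡ suc m ℤ.⊖ n
suc-⊖-suc zero zero = ≡.refl
suc-⊖-suc zero (suc n) = ≡.refl
suc-⊖-suc (suc m) n = ≡.trans (≡.cong sucℤ (ℤ.[1+m]⊖[1+n]≡m⊖n m n)) (suc-⊖ m n)
suc-⊖ m zero = ≡.refl
suc-⊖ m (suc n) = ≡.trans (suc-⊖-suc m n) (≡.sym (ℤ.[1+m]⊖[1+n]≡m⊖n m n))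

pred-⊖ : ∀ m n → predℤ (m ℤ.⊖ n) ≡ m ℤ.⊖ suc n
pred-⊖ m n = ≡.trans (≡.cong predℤ (≡.sym (suc-⊖-suc m n))) (pred-suc _)

-- Vectors of arbitrary length, so that equalities need not match the lengths definitionally.
Vecℤ : Set
Vecℤ = ∃ (Vec ℤ)

infixr 5 _∷′_
_∷′_ : ℤ → Vecℤ → Vecℤ
x ∷′ (n , v) = suc n , x ∷ v

-- Subtracts δ again. In these coordinates the twisted exchange of adjacent rows becomes a plain
-- transposition of list entries. Integer values are needed since an unsorted list may give negative
-- rows.
shifted : (xs : List ℕ) → Vec ℤ (length xs)
shifted [] = []
shifted (x ∷ xs) = (x ℤ.⊖ length xs) ∷ shifted xs

toVec : (xs : List ℕ) → Vec ℤ (length xs)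
toVec [] = []
toVec (x ∷ xs) = + x ∷ toVec xs

toVec-∷ʳ : ∀ xs x → _≡_ {A = Vecℤ} (_ , toVec (xs ++ x ∷ [])) (_ , toVec xs ∷ʳ + x)
toVec-∷ʳ [] x = ≡.refl
toVec-∷ʳ (y ∷ xs) x = ≡.cong (+ y ∷′_) (toVec-∷ʳ xs x)

reverse-zeros : ∀ M xs → _≡_ {A = Vecℤ} (_ , Vec.reverse (zeros M (Vec.reverse (toVec xs)))) (_ , toVec (xs ++ replicate M 0))
reverse-zeros zero xs = ≡.trans (≡.cong (_ ,_) (Vec.reverse-involutive (toVec xs))) (≡.cong (λ ys → _ , toVec ys) (≡.sym (List.++-identityʳ xs)))
reverse-zeros (suc M) xs = begin
  (_ , Vec.reverse (+ 0 ∷ zeros M (Vec.reverse (toVec xs))))    ≡⟨ ≡.cong (_ ,_) (Vec.reverse-∷ (+ 0) (zeros M (Vec.reverse (toVec xs)))) ⟩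
  (_ , Vec.reverse (zeros M (Vec.reverse (toVec xs))) ∷ʳ + 0)   ≡⟨ ≡.cong (λ (n , v) → suc n , v ∷ʳ + 0) (reverse-zeros M xs) ⟩
  (_ , toVec (xs ++ replicate M 0) ∷ʳ + 0)                      ≡⟨ toVec-∷ʳ (xs ++ replicate M 0) 0 ⟨
  (_ , toVec ((xs ++ replicate M 0) ++ 0 ∷ []))                 ≡⟨ ≡.cong (λ ys → _ , toVec ys) (List.++-assoc xs (replicate M 0) (0 ∷ [])) ⟩
  (_ , toVec (xs ++ (replicate M 0 ++ 0 ∷ [])))                 ≡⟨ ≡.cong (λ ys → _ , toVec (xs ++ ys)) (snoc M) ⟩
  (_ , toVec (xs ++ replicate (suc M) 0))                       ∎
  where
  open ≡.≡-Reasoning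
  snoc : ∀ M → replicate M 0 ++ 0 ∷ [] ≡ replicate (suc M) 0
  snoc zero = ≡.refl
  snoc (suc M) = ≡.cong (0 ∷_) (snoc M)

length-zipWith-delta : ∀ α → length (zipWith ℕ._+_ α (delta (length α))) ≡ length α
length-zipWith-delta [] = ≡.refl
length-zipWith-delta (x ∷ α) = ≡.cong suc (length-zipWith-delta α)

shifted-delta : ∀ α → _≡_ {A = Vecℤ} (_ , shifted (zipWith ℕ._+_ α (delta (length α)))) (_ , toVec α)
shifted-delta [] = ≡.refl
shifted-delta (x ∷ α) = ≡.cong₂ _∷′_ head (shifted-delta α)
  where
  head : (x ℕ.+ length α) ℤ.⊖ length (zipWith ℕ._+_ α (delta (length α))) ≡ + x
  head = ≡.trans (≡.cong ((x ℕ.+ length α) ℤ.⊖_) (length-zipWith-delta α))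
    (≡.trans (ℤ.⊖-≥ (ℕ.m≤n+m (length α) x)) (≡.cong +_ (ℕ.m+n∸n≡m x (length α))))

Strict : List ℕ → Set
Strict [] = ⊤
Strict (x ∷ xs) = All (ℕ._< x) xs × Strict xs

occurs : ℕ → List ℕ → Bool
occurs x [] = false
occurs x (y ∷ ys) = (x ℕ.≡ᵇ y) ∨ occurs x ys

repeats : List ℕ → Bool
repeats [] = false
repeats (x ∷ xs) = occurs x xs ∨ repeats xs

above : ℕ → List ℕ → ℕ
above x [] = 0
above x (y ∷ ys) = (if x ℕ.<ᵇ y then 1 else 0) ℕ.+ above x ys

inversions : List ℕ → ℕ
inversions [] = 0
inversions (x ∷ xs) = above x xs ℕ.+ inversions xs

-- Stated for every function with the right values, because the one folded over in `sComp` is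
-- anonymous; the same holds for the predicate in `filter-pairs`.
foldr-pairs : ∀ (f : ℕ × ℕ → Bool → Bool) → (∀ x y b → f (x , y) b ≡ (x ℕ.≡ᵇ y) ∨ b) → ∀ xs → foldr f false (pairs xs) ≡ repeats xs
foldr-pairs f e [] = ≡.refl
foldr-pairs f e (x ∷ xs) = ≡.trans (List.foldr-++ f false (List.map (x ,_) xs) (pairs xs))
  (≡.trans (≡.cong (λ b → foldr f b (List.map (x ,_) xs)) (foldr-pairs f e xs)) (row xs (repeats xs)))
  where
  row : ∀ ys b → foldr f b (List.map (x ,_) ys) ≡ occurs x ys ∨ b
  row [] b = ≡.refl
  row (y ∷ ys) b = ≡.trans (e x y _) (≡.trans (≡.cong ((x ℕ.≡ᵇ y) ∨_) (row ys b)) (≡.sym (Bool.∨-assoc (x ℕ.≡ᵇ y) (occurs x ys) b)))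

filter-pairs : ∀ {P : Pred (ℕ × ℕ) 0ℓ} (P? : Decidable P) → (∀ x y → does (P? (x , y)) ≡ (x ℕ.<ᵇ y)) →
  ∀ xs → length (filter P? (pairs xs)) ≡ inversions xs
filter-pairs P? e [] = ≡.refl
filter-pairs P? e (x ∷ xs) = ≡.trans (≡.cong length (List.filter-++ P? (List.map (x ,_) xs) (pairs xs)))
  (≡.trans (List.length-++ (filter P? (List.map (x ,_) xs))) (≡.cong₂ ℕ._+_ (row xs) (filter-pairs P? e xs)))
  where
  row : ∀ ys → length (filter P? (List.map (x ,_) ys)) ≡ above x ys
  row [] = ≡.refl
  row (y ∷ ys) with does (P? (x , y)) | e x y
  ... | true | p rewrite ≡.sym p = ≡.cong suc (row ys)
  ... | false | p rewrite ≡.sym p = row ys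

occurs-insertDesc : ∀ x y ys → occurs x (insertDesc y ys) ≡ occurs x (y ∷ ys)
occurs-insertDesc x y [] = ≡.refl
occurs-insertDesc x y (z ∷ ys) with z ℕ.<ᵇ y
... | true = ≡.refl
... | false = ≡.trans (≡.cong ((x ℕ.≡ᵇ z) ∨_) (occurs-insertDesc x y ys)) (swap (x ℕ.≡ᵇ z) (x ℕ.≡ᵇ y) (occurs x ys))
  where
  swap : ∀ a b c → a ∨ (b ∨ c) ≡ b ∨ (a ∨ c)
  swap true true c = ≡.refl
  swap true false c = ≡.refl
  swap false b c = ≡.refl

occurs-sortDesc : ∀ x ys → occurs x (sortDesc ys) ≡ occurs x ys
occurs-sortDesc x [] = ≡.refl
occurs-sortDesc x (y ∷ ys) = ≡.trans (occurs-insertDesc x y (sortDesc ys)) (≡.cong ((x ℕ.≡ᵇ y) ∨_) (occurs-sortDesc x ys))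

above-insertDesc : ∀ x y ys → above x (insertDesc y ys) ≡ above x (y ∷ ys)
above-insertDesc x y [] = ≡.refl
above-insertDesc x y (z ∷ ys) with z ℕ.<ᵇ y
... | true = ≡.refl
... | false = ≡.trans (≡.cong (i ℕ.+_) (above-insertDesc x y ys))
  (≡.trans (≡.sym (ℕ.+-assoc i j (above x ys))) (≡.trans (≡.cong (ℕ._+ above x ys) (ℕ.+-comm i j)) (ℕ.+-assoc j i (above x ys))))
  where
  i j : ℕ
  i = if x ℕ.<ᵇ z then 1 else 0
  j = if x ℕ.<ᵇ y then 1 else 0

above-sortDesc : ∀ x ys → above x (sortDesc ys) ≡ above x ys
above-sortDesc x [] = ≡.refl
above-sortDesc x (y ∷ ys) = ≡.trans (above-insertDesc x y (sortDesc ys)) (≡.cong ((if x ℕ.<ᵇ y then 1 else 0) ℕ.+_) (above-sortDesc x ys))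

length-insertDesc : ∀ x ys → length (insertDesc x ys) ≡ suc (length ys)
length-insertDesc x [] = ≡.refl
length-insertDesc x (y ∷ ys) with y ℕ.<ᵇ x
... | true = ≡.refl
... | false = ≡.cong suc (length-insertDesc x ys)

length-sortDesc : ∀ xs → length (sortDesc xs) ≡ length xs
length-sortDesc [] = ≡.refl
length-sortDesc (x ∷ xs) = ≡.trans (length-insertDesc x (sortDesc xs)) (≡.cong suc (length-sortDesc xs))

∨-false : ∀ {a b} → a ∨ b ≡ false → a ≡ false × b ≡ false
∨-false {false} {false} e = ≡.refl , ≡.refl

<ᵇ-true : ∀ {x y} → x ℕ.< y → (x ℕ.<ᵇ y) ≡ true
<ᵇ-true {x} {y} lt with x ℕ.<ᵇ y in eq
... | true = ≡.refl
... | false = ⊥-elim (≡.subst Bool.T eq (ℕ.<⇒<ᵇ lt))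

<ᵇ-false : ∀ {x y} → y ℕ.≤ x → (x ℕ.<ᵇ y) ≡ false
<ᵇ-false {x} {y} le with x ℕ.<ᵇ y in eq
... | false = ≡.refl
... | true = ⊥-elim (ℕ.<⇒≱ (ℕ.<ᵇ⇒< x y (≡.subst Bool.T (≡.sym eq) tt)) le)

<ᵇ-true⇒< : ∀ {x y} → (x ℕ.<ᵇ y) ≡ true → x ℕ.< y
<ᵇ-true⇒< {x} {y} e = ℕ.<ᵇ⇒< x y (≡.subst Bool.T (≡.sym e) tt)

<ᵇ-false⇒> : ∀ {x y} → (y ℕ.<ᵇ x) ≡ false → (x ℕ.≡ᵇ y) ≡ false → x ℕ.< y
<ᵇ-false⇒> {x} {y} p q = ℕ.≤∧≢⇒< (ℕ.≮⇒≥ (λ lt → absurd (≡.trans (≡.sym (<ᵇ-true lt)) p)))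
  (λ x≡y → ≡.subst Bool.T q (ℕ.≡⇒≡ᵇ x y x≡y))
  where
  absurd : true ≡ false → _
  absurd ()

All-insertDesc : ∀ {P : Pred ℕ 0ℓ} x ys → P x → All P ys → All P (insertDesc x ys)
All-insertDesc x [] px [] = px ∷ []
All-insertDesc x (y ∷ ys) px (py ∷ pys) with y ℕ.<ᵇ x
... | true = px ∷ py ∷ pys
... | false = py ∷ All-insertDesc x ys px pys

Strict-insertDesc : ∀ x ys → occurs x ys ≡ false → Strict ys → Strict (insertDesc x ys)
Strict-insertDesc x [] o s = [] , tt
Strict-insertDesc x (y ∷ ys) o (ys<y , s) with y ℕ.<ᵇ x in eq
... | true = (<ᵇ-true⇒< eq ∷ All.map (λ lt → ℕ.<-trans lt (<ᵇ-true⇒< eq)) ys<y) , ys<y , s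
... | false = All-insertDesc x ys (<ᵇ-false⇒> eq (proj₁ (∨-false o))) ys<y , Strict-insertDesc x ys (proj₂ (∨-false {x ℕ.≡ᵇ y} o)) s

Strict-sortDesc : ∀ xs → repeats xs ≡ false → Strict (sortDesc xs)
Strict-sortDesc [] r = tt
Strict-sortDesc (x ∷ xs) r = Strict-insertDesc x (sortDesc xs)
  (≡.trans (occurs-sortDesc x xs) (proj₁ (∨-false r))) (Strict-sortDesc xs (proj₂ (∨-false {occurs x xs} r)))

Strict⇒length≤ : ∀ {x} xs → All (ℕ._< x) xs → Strict xs → length xs ℕ.≤ x
Strict⇒length≤ [] _ _ = z≤n
Strict⇒length≤ (y ∷ ys) (y<x ∷ _) (ys<y , s) = ℕ.≤-trans (s≤s (Strict⇒length≤ ys ys<y s)) y<x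

-- An entry of a strictly decreasing list is at least the number of entries after it, so the
-- truncated subtraction of δ loses nothing.
shifted-Strict : ∀ xs → Strict xs → _≡_ {A = Vecℤ} (_ , shifted xs) (_ , toVec (zipWith _∸_ xs (delta (length xs))))
shifted-Strict [] s = ≡.refl
shifted-Strict (x ∷ xs) (xs<x , s) = ≡.cong₂ _∷′_ (ℤ.⊖-≥ (Strict⇒length≤ xs xs<x s)) (shifted-Strict xs s)

dropZeros : List ℕ → List ℕ
dropZeros [] = []
dropZeros (zero ∷ ys) = dropZeros ys
dropZeros (suc y ∷ ys) = suc y ∷ ys

dropZeros-unique : ∀ (f : List ℕ → List ℕ) → f [] ≡ [] → (∀ ys → f (0 ∷ ys) ≡ f ys) → (∀ y ys → f (suc y ∷ ys) ≡ reverse (suc y ∷ ys)) →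
  ∀ ys → f ys ≡ reverse (dropZeros ys)
dropZeros-unique f e₁ e₂ e₃ [] = e₁
dropZeros-unique f e₁ e₂ e₃ (zero ∷ ys) = ≡.trans (e₂ ys) (dropZeros-unique f e₁ e₂ e₃ ys)
dropZeros-unique f e₁ e₂ e₃ (suc y ∷ ys) = e₃ y ys

-- The local function of dropZerosEnd cannot be named; unification recovers it.
mutual
  dropLocal : List ℕ → List ℕ → List ℕ
  dropLocal = _

  dropZerosEnd≡ : ∀ xs → dropZerosEnd xs ≡ reverse (dropZeros (reverse xs))
  dropZerosEnd≡ xs with reverse xs
  ... | ys = dropZeros-unique (dropLocal xs) ≡.refl (λ _ → ≡.refl) (λ _ _ → ≡.refl) ys

module Straightening (R : CommutativeRing 0ℓ 0ℓ) where
  open CommutativeRing R hiding (zero)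

  module TorsionFree (torsion-free : ∀ {x} → x ≈ - x → x ≈ 0#) where
    open IntegerSolver R
    open AlternatingSums R
    open Determinants R using (sign)
    open import Algebra.Properties.Ring ring using (-0#≈0#)
    open import Relation.Binary.Reasoning.Setoid setoid

    Family : Set
    Family = ∀ {n} → Vec ℤ n → Carrier

    Alternating : Family → Set
    Alternating F = ∀ {n} → Antisym predℤ sucℤ (F {n})

    -- Absorbs a first entry into the function, so that inductions on the list can keep modifying
    -- its tail. The amount subtracted depends on the tail's length, which is why a `Family` covers
    -- all lengths.
    cons : ℕ → Family → Family
    cons x F {n} v = F ((x ℤ.⊖ n) ∷ v)

    cons-Alternating : ∀ x (F : Family) → Alternating F → Alternating (cons x F)
    cons-Alternating x F a {n} = Antisym-tail F (a {suc n}) (x ℤ.⊖ n)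

    shifted-swap : ∀ (F : Family) → Alternating F → ∀ x y zs → F (shifted (x ∷ y ∷ zs)) ≈ - F (shifted (y ∷ x ∷ zs))
    shifted-swap F a x y zs = trans (proj₁ (a {suc (suc (length zs))}) _ _ _)
      (-‿cong (reflexive (≡.cong₂ (λ i j → F (i ∷ j ∷ shifted zs)) (pred-⊖ y (length zs)) (suc-⊖-suc x (length zs)))))

    -- Exchanges bring `x` next to its copy, where the value equals its own negative.
    shifted-occurs : ∀ (F : Family) → Alternating F → ∀ x ys → occurs x ys ≡ true → F (shifted (x ∷ ys)) ≈ 0#
    shifted-occurs F a x (y ∷ ys) o with x ℕ.≡ᵇ y in eq
    ... | true = torsion-free (trans (shifted-swap F a x y ys) (-‿cong (reflexive (≡.cong₂ (λ i j → F (shifted (i ∷ j ∷ ys))) (≡.sym x≡y) x≡y))))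
      where
      x≡y : x ≡ y
      x≡y = ℕ.≡ᵇ⇒≡ x y (≡.subst Bool.T (≡.sym eq) tt)
    ... | false = trans (shifted-swap F a x y ys) (trans (-‿cong (shifted-occurs (cons y F) (cons-Alternating y F a) x ys o)) -0#≈0#)

    shifted-repeats : ∀ (F : Family) → Alternating F → ∀ xs → repeats xs ≡ true → F (shifted xs) ≈ 0#
    shifted-repeats F a (x ∷ xs) r with occurs x xs in eq
    ... | true = shifted-occurs F a x xs eq
    ... | false = shifted-repeats (cons x F) (cons-Alternating x F a) xs r

    above-max : ∀ x ys → All (ℕ._< x) ys → above x ys ≡ 0
    above-max x [] [] = ≡.refl
    above-max x (y ∷ ys) (y<x ∷ ys<x) rewrite <ᵇ-false (ℕ.<⇒≤ y<x) = above-max x ys ys<x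

    -- Each larger entry that `x` passes costs one exchange, hence one sign. Strictness guarantees
    -- that no larger entry remains once the insertion stops, so the number of exchanges is
    -- `above x ys`.
    shifted-insertDesc : ∀ (F : Family) → Alternating F → ∀ x ys → occurs x ys ≡ false → Strict ys →
      F (shifted (x ∷ ys)) ≈ sign (above x ys) * F (shifted (insertDesc x ys))
    shifted-insertDesc F a x [] o s = sym (*-identityˡ _)
    shifted-insertDesc F a x (y ∷ ys) o (ys<y , s) with y ℕ.<ᵇ x in eq
    ... | true = sym (trans (*-congʳ (reflexive (≡.cong sign (above-max x (y ∷ ys) (y<x ∷ All.map (λ lt → ℕ.<-trans lt y<x) ys<y))))) (*-identityˡ _))
      where
      y<x : y ℕ.< x
      y<x = <ᵇ-true⇒< eq
    ... | false = begin
      F (shifted (x ∷ y ∷ ys))                                          ≈⟨ shifted-swap F a x y ys ⟩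
      - cons y F (shifted (x ∷ ys))                                     ≈⟨ -‿cong (shifted-insertDesc (cons y F) (cons-Alternating y F a) x ys (proj₂ (∨-false {x ℕ.≡ᵇ y} o)) s) ⟩
      - (sign (above x ys) * F (shifted (y ∷ insertDesc x ys)))         ≈⟨ solve 2 (λ x y → :- (x :* y) := (:- x) :* y) refl _ _ ⟩
      - sign (above x ys) * F (shifted (y ∷ insertDesc x ys))           ≡⟨ ≡.cong (λ k → sign k * F (shifted (y ∷ insertDesc x ys))) above-∷ ⟨
      sign (above x (y ∷ ys)) * F (shifted (y ∷ insertDesc x ys))       ∎
      where
      above-∷ : above x (y ∷ ys) ≡ suc (above x ys)
      above-∷ = ≡.cong (λ b → (if b then 1 else 0) ℕ.+ above x ys) (<ᵇ-true (<ᵇ-false⇒> {x} {y} eq (proj₁ (∨-false o))))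

    sign-+ : ∀ m n → sign (m ℕ.+ n) ≈ sign m * sign n
    sign-+ zero n = sym (*-identityˡ _)
    sign-+ (suc m) n = trans (-‿cong (sign-+ m n)) (solve 2 (λ x y → :- (x :* y) := (:- x) :* y) refl _ _)

    shifted-sortDesc : ∀ (F : Family) → Alternating F → ∀ xs → repeats xs ≡ false →
      F (shifted xs) ≈ sign (inversions xs) * F (shifted (sortDesc xs))
    shifted-sortDesc F a [] r = sym (*-identityˡ _)
    shifted-sortDesc F a (x ∷ xs) r = begin
      cons x F (shifted xs)
        ≈⟨ shifted-sortDesc (cons x F) (cons-Alternating x F a) xs r′ ⟩
      sign (inversions xs) * F ((x ℤ.⊖ length (sortDesc xs)) ∷ shifted (sortDesc xs))
        ≈⟨ *-congˡ (shifted-insertDesc F a x (sortDesc xs) (≡.trans (occurs-sortDesc x xs) (proj₁ (∨-false r))) (Strict-sortDesc xs r′)) ⟩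
      sign (inversions xs) * (sign (above x (sortDesc xs)) * F (shifted (insertDesc x (sortDesc xs))))
        ≈⟨ solve 3 (λ x y z → x :* (y :* z) := (y :* x) :* z) refl _ _ _ ⟩
      (sign (above x (sortDesc xs)) * sign (inversions xs)) * F (shifted (insertDesc x (sortDesc xs)))
        ≈⟨ *-congʳ (trans (*-congʳ (reflexive (≡.cong sign (above-sortDesc x xs)))) (sym (sign-+ (above x xs) (inversions xs)))) ⟩
      sign (inversions (x ∷ xs)) * F (shifted (sortDesc (x ∷ xs))) ∎
      where
      r′ : repeats xs ≡ false
      r′ = proj₂ (∨-false {occurs x xs} r)

    module _ (h : ℤ → Carrier) (h-neg : ∀ n → h -[1+ n ] ≈ 0#) (h0 : h (+ 0) ≈ 1#) where
      open Schur h

      private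
        S : Vecℤ → Carrier
        S (_ , v) = schur↓ v

        S-Alternating : Alternating schur↓
        S-Alternating = Antisym-schurBy pred-suc suc-pred h

      schur↓-trailing-zero : ∀ xs → schur↓ (toVec (xs ++ 0 ∷ [])) ≈ schur↓ (toVec xs)
      schur↓-trailing-zero xs = begin
        schur↓ (toVec (xs ++ 0 ∷ []))                                ≡⟨ ≡.cong S (toVec-∷ʳ xs 0) ⟩
        schur↓ (toVec xs ∷ʳ + 0)                                     ≈⟨ schur↓-∷ʳ (toVec xs) (+ 0) ⟩
        alt sucℤ predℤ (toVec xs) (+ 0) (λ k γ → h k * schur↓ γ)     ≈⟨ alt-pred-+0 (toVec xs) (λ n v → trans (*-congʳ (h-neg n)) (zeroˡ _)) ⟩
        h (+ 0) * schur↓ (toVec xs)                                  ≈⟨ trans (*-congʳ h0) (*-identityˡ _) ⟩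
        schur↓ (toVec xs)                                            ∎

      schur↓-dropZerosEnd : ∀ xs → schur↓ (toVec (dropZerosEnd xs)) ≈ schur↓ (toVec xs)
      schur↓-dropZerosEnd xs = trans (reflexive (≡.cong (λ ys → schur↓ (toVec ys)) (dropZerosEnd≡ xs)))
        (trans (go (reverse xs)) (reflexive (≡.cong (λ ys → schur↓ (toVec ys)) (List.reverse-involutive xs))))
        where
        go : ∀ ys → schur↓ (toVec (reverse (dropZeros ys))) ≈ schur↓ (toVec (reverse ys))
        go [] = refl
        go (zero ∷ ys) = trans (go ys) (trans (sym (schur↓-trailing-zero (reverse ys)))
          (reflexive (≡.cong (λ ys → schur↓ (toVec ys)) (≡.sym (List.unfold-reverse 0 ys)))))
        go (suc y ∷ ys) = refl

      module _ (α : List ℕ) where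
        private
          β : List ℕ
          β = zipWith ℕ._+_ α (delta (length α))

        schur↓-repeats : repeats β ≡ true → schur↓ (toVec α) ≈ 0#
        schur↓-repeats r = trans (reflexive (≡.cong S (≡.sym (shifted-delta α)))) (shifted-repeats schur↓ S-Alternating β r)

        schur↓-straighten : repeats β ≡ false →
          schur↓ (toVec α) ≈ sign (inversions β) * schur↓ (toVec (dropZerosEnd (zipWith _∸_ (sortDesc β) (delta (length α)))))
        schur↓-straighten r = begin
          schur↓ (toVec α)
            ≡⟨ ≡.cong S (≡.sym (shifted-delta α)) ⟩
          schur↓ (shifted β)
            ≈⟨ shifted-sortDesc schur↓ S-Alternating β r ⟩
          sign (inversions β) * schur↓ (shifted (sortDesc β))
            ≡⟨ ≡.cong (λ v → sign (inversions β) * S v) (shifted-Strict (sortDesc β) (Strict-sortDesc β r)) ⟩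
          sign (inversions β) * schur↓ (toVec (zipWith _∸_ (sortDesc β) (delta (length (sortDesc β)))))
            ≡⟨ ≡.cong (λ n → sign (inversions β) * schur↓ (toVec (zipWith _∸_ (sortDesc β) (delta n)))) (≡.trans (length-sortDesc β) (length-zipWith-delta α)) ⟩
          sign (inversions β) * schur↓ (toVec (zipWith _∸_ (sortDesc β) (delta (length α))))
            ≈⟨ *-congˡ (schur↓-dropZerosEnd (zipWith _∸_ (sortDesc β) (delta (length α)))) ⟨
          sign (inversions β) * schur↓ (toVec (dropZerosEnd (zipWith _∸_ (sortDesc β) (delta (length α))))) ∎

-- Power series and monoid algebras

module PowerSeries (R : CommutativeRing 0ℓ 0ℓ) where
  open CommutativeRing R hiding (zero)
  open IntegerSolver R

  Series : Set
  Series = ℕ → Carrier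

  infix 4 _≋_
  _≋_ : Series → Series → Set
  f ≋ g = ∀ n → f n ≈ g n

  tail : Series → Series
  tail f n = f (suc n)

  const : Carrier → Series
  const c zero = c
  const c (suc n) = 0#

  infixl 7 _⊛_
  _⊛_ : Series → Series → Series
  (f ⊛ g) zero = f 0 * g 0
  (f ⊛ g) (suc n) = f 0 * g (suc n) + (tail f ⊛ g) n

  ⊛-cong : ∀ {f f′ g g′} → f ≋ f′ → g ≋ g′ → f ⊛ g ≋ f′ ⊛ g′
  ⊛-cong e d zero = *-cong (e 0) (d 0)
  ⊛-cong e d (suc n) = +-cong (*-cong (e 0) (d (suc n))) (⊛-cong (λ i → e (suc i)) d n)

  ⊛-distribʳ : ∀ f g h → (λ i → g i + h i) ⊛ f ≋ λ n → (g ⊛ f) n + (h ⊛ f) n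
  ⊛-distribʳ f g h zero = distribʳ _ _ _
  ⊛-distribʳ f g h (suc n) = trans (+-congˡ (⊛-distribʳ f (tail g) (tail h) n))
    (solve 5 (λ f g h x y → (g :+ h) :* f :+ (x :+ y) := (g :* f :+ x) :+ (h :* f :+ y)) refl _ _ _ _ _)

  ⊛-scale : ∀ c f g → (λ i → c * f i) ⊛ g ≋ λ n → c * (f ⊛ g) n
  ⊛-scale c f g zero = *-assoc _ _ _
  ⊛-scale c f g (suc n) = trans (+-congˡ (⊛-scale c (tail f) g n))
    (solve 4 (λ c x y z → (c :* x) :* y :+ c :* z := c :* (x :* y :+ z)) refl _ _ _ _)

  ⊛-zero : ∀ {f} g → (∀ n → f n ≈ 0#) → ∀ n → (f ⊛ g) n ≈ 0#
  ⊛-zero g e zero = trans (*-congʳ (e 0)) (zeroˡ _)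
  ⊛-zero g e (suc n) = trans (+-cong (trans (*-congʳ (e 0)) (zeroˡ _)) (⊛-zero g (λ i → e (suc i)) n)) (+-identityʳ _)

  -- The product is defined by peeling the left factor; peeling the right one as well is what yields
  -- commutativity.
  ⊛-suc : ∀ f g n → (f ⊛ g) (suc n) ≈ (f ⊛ tail g) n + f (suc n) * g 0
  ⊛-suc f g zero = refl
  ⊛-suc f g (suc n) = trans (+-congˡ (⊛-suc (tail f) g n)) (sym (+-assoc _ _ _))

  ⊛-comm : ∀ f g → f ⊛ g ≋ g ⊛ f
  ⊛-comm f g zero = *-comm _ _
  ⊛-comm f g (suc n) = trans (+-cong (*-comm _ _) (⊛-comm (tail f) g n)) (trans (+-comm _ _) (sym (⊛-suc g f n)))

  ⊛-assoc : ∀ f g h → (f ⊛ g) ⊛ h ≋ f ⊛ (g ⊛ h)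
  ⊛-assoc f g h zero = *-assoc _ _ _
  ⊛-assoc f g h (suc n) = trans (+-congˡ (trans (⊛-distribʳ h (λ i → f 0 * g (suc i)) (tail f ⊛ g) n)
      (+-cong (⊛-scale (f 0) (tail g) h n) (⊛-assoc (tail f) g h n))))
    (solve 5 (λ a b c x y → (a :* b) :* c :+ (a :* x :+ y) := a :* (b :* c :+ x) :+ y) refl _ _ _ _ _)

  ⊛-identityˡ : ∀ f → const 1# ⊛ f ≋ f
  ⊛-identityˡ f zero = *-identityˡ _
  ⊛-identityˡ f (suc n) = trans (+-cong (*-identityˡ _) (⊛-zero f (λ _ → refl) n)) (+-identityʳ _)

  seriesRing : CommutativeRing 0ℓ 0ℓ
  seriesRing = record
    { Carrier = Series ; _≈_ = _≋_ ; _+_ = λ f g n → f n + g n ; _*_ = _⊛_ ; -_ = λ f n → - f n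
    ; 0# = λ _ → 0# ; 1# = const 1#
    ; isCommutativeRing = record
      { isRing = record
        { +-isAbelianGroup = record
          { isGroup = record
            { isMonoid = record
              { isSemigroup = record
                { isMagma = record
                  { isEquivalence = record { refl = λ _ → refl ; sym = λ e n → sym (e n) ; trans = λ e d n → trans (e n) (d n) }
                  ; ∙-cong = λ e d n → +-cong (e n) (d n) }
                ; assoc = λ f g h n → +-assoc _ _ _ }
              ; identity = (λ f n → +-identityˡ _) , (λ f n → +-identityʳ _) }
            ; inverse = (λ f n → -‿inverseˡ _) , (λ f n → -‿inverseʳ _)
            ; ⁻¹-cong = λ e n → -‿cong (e n) }
          ; comm = λ f g n → +-comm _ _ }
        ; *-cong = ⊛-cong
        ; *-assoc = ⊛-assoc
        ; *-identity = ⊛-identityˡ , λ f n → trans (⊛-comm f (const 1#) n) (⊛-identityˡ f n)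
        ; distrib = (λ f g h n → trans (⊛-comm f (λ i → g i + h i) n) (trans (⊛-distribʳ f g h n) (+-cong (⊛-comm g f n) (⊛-comm h f n))))
          , ⊛-distribʳ }
      ; *-comm = ⊛-comm } }

  X : Series
  X zero = 0#
  X (suc n) = const 1# n

  X⊛ : ∀ f n → (X ⊛ f) (suc n) ≈ f n
  X⊛ f n = trans (+-cong (zeroˡ _) (⊛-identityˡ f n)) (+-identityˡ _)

  const-⊛ : ∀ c f n → (const c ⊛ f) n ≈ c * f n
  const-⊛ c f zero = refl
  const-⊛ c f (suc n) = trans (+-congˡ (⊛-zero f (λ _ → refl) n)) (+-identityʳ _)

-- Finite sums of monomials k · m with k in a ring and m in a commutative monoid; two sums are
-- equal when they agree under every functional on monomials.
module MonoidAlgebra (K : CommutativeRing 0ℓ 0ℓ) (M : CommutativeMonoid 0ℓ 0ℓ) where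
  open CommutativeRing K hiding (zero)
  open IntegerSolver K
  private module M = CommutativeMonoid M
  open import Algebra.Properties.Ring ring using (-0#≈0#)

  Sum : Set
  Sum = List (Carrier × M.Carrier)

  record Functional : Set where
    field
      on : M.Carrier → Carrier
      on-cong : ∀ {m n} → m M.≈ n → on m ≈ on n
  open Functional public

  pair : Sum → (M.Carrier → Carrier) → Carrier
  pair [] φ = 0#
  pair ((c , m) ∷ F) φ = c * φ m + pair F φ

  infix 4 _≈ₛ_
  record _≈ₛ_ (F G : Sum) : Set where
    constructor agree
    field under : ∀ (φ : Functional) → pair F (on φ) ≈ pair G (on φ)
  open _≈ₛ_ public

  pair-cong : ∀ F {φ ψ} → (∀ m → φ m ≈ ψ m) → pair F φ ≈ pair F ψ
  pair-cong [] e = refl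
  pair-cong ((c , m) ∷ F) e = +-cong (*-congˡ (e m)) (pair-cong F e)

  pair-++ : ∀ F G φ → pair (F ++ G) φ ≈ pair F φ + pair G φ
  pair-++ [] G φ = sym (+-identityˡ _)
  pair-++ (_ ∷ F) G φ = trans (+-congˡ (pair-++ F G φ)) (sym (+-assoc _ _ _))

  pair-+ : ∀ F φ ψ → pair F (λ m → φ m + ψ m) ≈ pair F φ + pair F ψ
  pair-+ [] φ ψ = sym (+-identityˡ _)
  pair-+ ((c , m) ∷ F) φ ψ = trans (+-congˡ (pair-+ F φ ψ))
    (solve 5 (λ c x y z w → c :* (x :+ y) :+ (z :+ w) := (c :* x :+ z) :+ (c :* y :+ w)) refl _ _ _ _ _)

  pair-* : ∀ F k φ → pair F (λ m → k * φ m) ≈ k * pair F φ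
  pair-* [] k φ = sym (zeroʳ k)
  pair-* ((c , m) ∷ F) k φ = trans (+-congˡ (pair-* F k φ))
    (solve 4 (λ c k x y → c :* (k :* x) :+ k :* y := k :* (c :* x :+ y)) refl _ _ _ _)

  pair-0 : ∀ F → pair F (λ _ → 0#) ≈ 0#
  pair-0 [] = refl
  pair-0 ((c , m) ∷ F) = trans (+-cong (zeroʳ c) (pair-0 F)) (+-identityʳ _)

  scale : Carrier → Sum → Sum
  scale k = map (λ (c , m) → k * c , m)

  pair-scale : ∀ k F φ → pair (scale k F) φ ≈ k * pair F φ
  pair-scale k [] φ = sym (zeroʳ k)
  pair-scale k ((c , m) ∷ F) φ = trans (+-congˡ (pair-scale k F φ))
    (solve 4 (λ c k x y → (k :* c) :* x :+ k :* y := k :* (c :* x :+ y)) refl _ _ _ _)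

  timesTerm : Carrier × M.Carrier → Sum → Sum
  timesTerm (c , m) = map (λ (d , n) → c * d , m M.∙ n)

  infixl 7 _·_
  _·_ : Sum → Sum → Sum
  F · G = concatMap (λ t → timesTerm t G) F

  pair-timesTerm : ∀ c m G φ → pair (timesTerm (c , m) G) φ ≈ c * pair G (λ n → φ (m M.∙ n))
  pair-timesTerm c m [] φ = sym (zeroʳ c)
  pair-timesTerm c m ((d , n) ∷ G) φ = trans (+-congˡ (pair-timesTerm c m G φ))
    (solve 4 (λ c k x y → (k :* c) :* x :+ k :* y := k :* (c :* x :+ y)) refl _ _ _ _)

  pair-· : ∀ F G φ → pair (F · G) φ ≈ pair F (λ m → pair G (λ n → φ (m M.∙ n)))
  pair-· [] G φ = refl
  pair-· ((c , m) ∷ F) G φ = trans (pair-++ (timesTerm (c , m) G) (F · G) φ) (+-cong (pair-timesTerm c m G φ) (pair-· F G φ))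

  pair-swap : ∀ F G (φ : M.Carrier → M.Carrier → Carrier) → pair F (λ m → pair G (φ m)) ≈ pair G (λ n → pair F (λ m → φ m n))
  pair-swap [] G φ = sym (pair-0 G)
  pair-swap ((c , m) ∷ F) G φ = trans (+-congˡ (pair-swap F G φ))
    (trans (+-congʳ (sym (pair-* G c (φ m)))) (sym (pair-+ G (λ n → c * φ m n) (λ n → pair F (λ m → φ m n)))))

  negate : Sum → Sum
  negate = map (λ (c , m) → - c , m)

  pair-negate : ∀ F φ → pair (negate F) φ ≈ - pair F φ
  pair-negate [] φ = sym -0#≈0#
  pair-negate ((c , m) ∷ F) φ = trans (+-congˡ (pair-negate F φ))
    (solve 3 (λ c x y → (:- c) :* x :+ (:- y) := :- (c :* x :+ y)) refl _ _ _)

  shiftBy : M.Carrier → Functional → Functional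
  shiftBy m φ = record { on = λ n → on φ (m M.∙ n) ; on-cong = λ e → on-cong φ (M.∙-congˡ e) }

  ·-cong : ∀ {F F′ G G′} → F ≈ₛ F′ → G ≈ₛ G′ → F · G ≈ₛ F′ · G′
  ·-cong {F} {F′} {G} {G′} e d = agree λ φ → trans (pair-· F G (on φ)) (trans
    (under e (record { on = λ m → pair G (λ n → on φ (m M.∙ n)) ; on-cong = λ p → pair-cong G (λ n → on-cong φ (M.∙-congʳ p)) }))
    (trans (pair-cong F′ (λ m → under d (shiftBy m φ))) (sym (pair-· F′ G′ (on φ)))))

  algebra : CommutativeRing 0ℓ 0ℓ
  algebra = record
    { Carrier = Sum ; _≈_ = _≈ₛ_ ; _+_ = _++_ ; _*_ = _·_ ; -_ = negate ; 0# = [] ; 1# = (1# , M.ε) ∷ []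
    ; isCommutativeRing = record
      { isRing = record
        { +-isAbelianGroup = record
          { isGroup = record
            { isMonoid = record
              { isSemigroup = record
                { isMagma = record
                  { isEquivalence = record { refl = agree λ φ → refl ; sym = λ e → agree λ φ → sym (under e φ)
                                           ; trans = λ e d → agree λ φ → trans (under e φ) (under d φ) }
                  ; ∙-cong = λ {F} {F′} {G} {G′} e d → agree λ φ → trans (pair-++ F G _) (trans (+-cong (under e φ) (under d φ)) (sym (pair-++ F′ G′ _))) }
                ; assoc = λ F G H → agree λ φ → trans (trans (pair-++ (F ++ G) H _) (+-congʳ (pair-++ F G _)))
                    (trans (+-assoc _ _ _) (sym (trans (pair-++ F (G ++ H) _) (+-congˡ (pair-++ G H _))))) }
              ; identity = (λ F → agree λ φ → refl) , (λ F → agree λ φ → trans (pair-++ F [] _) (+-identityʳ _)) }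
            ; inverse = (λ F → agree λ φ → trans (pair-++ (negate F) F _) (trans (+-congʳ (pair-negate F _)) (-‿inverseˡ _)))
                      , (λ F → agree λ φ → trans (pair-++ F (negate F) _) (trans (+-congˡ (pair-negate F _)) (-‿inverseʳ _)))
            ; ⁻¹-cong = λ {F} {G} e → agree λ φ → trans (pair-negate F _) (trans (-‿cong (under e φ)) (sym (pair-negate G _))) }
          ; comm = λ F G → agree λ φ → trans (pair-++ F G _) (trans (+-comm _ _) (sym (pair-++ G F _))) }
        ; *-cong = ·-cong
        ; *-assoc = λ F G H → agree λ φ → trans (pair-· (F · G) H _) (trans (pair-· F G _) (sym (trans (pair-· F (G · H) _)
            (pair-cong F (λ l → trans (pair-· G H _) (pair-cong G (λ m → pair-cong H (λ n → on-cong φ (M.sym (M.assoc l m n))))))))))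
        ; *-identity = (λ F → agree λ φ → trans (pair-· ((1# , M.ε) ∷ []) F _) (trans (+-identityʳ _) (trans (*-identityˡ _)
              (pair-cong F (λ m → on-cong φ (M.identityˡ m))))))
          , (λ F → agree λ φ → trans (pair-· F ((1# , M.ε) ∷ []) _) (pair-cong F (λ m → trans (+-identityʳ _) (trans (*-identityˡ _)
              (on-cong φ (M.identityʳ m))))))
        ; distrib = (λ F G H → agree λ φ → trans (pair-· F (G ++ H) _) (trans (pair-cong F (λ m → pair-++ G H _))
              (trans (pair-+ F _ _) (sym (trans (pair-++ (F · G) (F · H) _) (+-cong (pair-· F G _) (pair-· F H _)))))))
          , (λ F G H → agree λ φ → trans (pair-· (G ++ H) F _) (trans (pair-++ G H _)
              (sym (trans (pair-++ (G · F) (H · F) _) (+-cong (pair-· G F _) (pair-· H F _)))))) }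
      ; *-comm = λ F G → agree λ φ → trans (pair-· F G _) (trans (pair-cong F (λ m → pair-cong G (λ n → on-cong φ (M.comm m n))))
          (trans (pair-swap F G (λ m n → on φ (n M.∙ m))) (sym (pair-· G F _)))) } }

-- Rational functions

module Fractions (P : CommutativeRing 0ℓ 0ℓ) where
  open CommutativeRing P hiding (zero)

  -- Polynomials are compared through their images under `c` in a commutative ring. `Good` is a
  -- multiplicative class of polynomials with cancellable image, and it supplies the admissible
  -- denominators.
  module Denominators (c : Poly → Carrier)
    (c-+ : ∀ p r → c (p +P r) ≈ c p + c r) (c-* : ∀ p r → c (p *P r) ≈ c p * c r)
    (c-neg : ∀ p → c (scaleP (ℚ.- 1ℚ) p) ≈ - c p) (c-0 : c (0ℚ ∷ []) ≈ 0#) (c-1 : c (1ℚ ∷ []) ≈ 1#)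
    (Good : Poly → Set) (good-* : ∀ {p r} → Good p → Good r → Good (p *P r)) (good-1 : Good (1ℚ ∷ []))
    (good-cancel : ∀ {p} → Good p → ∀ {x} → c p * x ≈ 0# → x ≈ 0#) where

    open IntegerSolver P
    open import Algebra.Properties.Ring ring using (x∙y⁻¹≈ε⇒x≈y)

    record Fraction : Set where
      constructor fraction
      field
        frac : Qq
        good : Good (Qq.den frac)
    open Fraction public

    n d : Fraction → Carrier
    n x = c (Qq.num (frac x))
    d x = c (Qq.den (frac x))

    infix 4 _≈F_
    record _≈F_ (x y : Fraction) : Set where
      constructor cross
      field crossed : n x * d y ≈ n y * d x
    open _≈F_ public

    infixl 6 _+F_
    infixl 7 _*F_

    opaque
      _+F_ _*F_ : Fraction → Fraction → Fraction
      x +F y = fraction (frac x +Q frac y) (good-* (good x) (good y))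
      x *F y = fraction (frac x *Q frac y) (good-* (good x) (good y))

      -F_ : Fraction → Fraction
      -F x = fraction (-Q (frac x)) (good x)

      0F 1F : Fraction
      0F = fraction 0Q good-1
      1F = fraction 1Q good-1

      frac-+ : ∀ x y → frac (x +F y) ≡ frac x +Q frac y
      frac-+ x y = ≡.refl

      frac-* : ∀ x y → frac (x *F y) ≡ frac x *Q frac y
      frac-* x y = ≡.refl

      frac-neg : ∀ x → frac (-F x) ≡ -Q (frac x)
      frac-neg x = ≡.refl

      frac-0 : frac 0F ≡ 0Q
      frac-0 = ≡.refl

      frac-1 : frac 1F ≡ 1Q
      frac-1 = ≡.refl

      n-+ : ∀ x y → n (x +F y) ≈ n x * d y + n y * d x
      n-+ x y = trans (c-+ (Qq.num (frac x) *P Qq.den (frac y)) (Qq.num (frac y) *P Qq.den (frac x))) (+-cong (c-* (Qq.num (frac x)) _) (c-* (Qq.num (frac y)) _))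

      d-+ : ∀ x y → d (x +F y) ≈ d x * d y
      d-+ x y = c-* (Qq.den (frac x)) _

      n-* : ∀ x y → n (x *F y) ≈ n x * n y
      n-* x y = c-* (Qq.num (frac x)) _

      d-* : ∀ x y → d (x *F y) ≈ d x * d y
      d-* x y = c-* (Qq.den (frac x)) _

      n-neg : ∀ x → n (-F x) ≈ - n x
      n-neg x = c-neg (Qq.num (frac x))

      d-neg : ∀ x → d (-F x) ≈ d x
      d-neg x = refl

      n-0 : n 0F ≈ 0#
      n-0 = c-0

      n-1 : n 1F ≈ 1#
      n-1 = c-1

      d-0 : d 0F ≈ 1#
      d-0 = c-1

      d-1 : d 1F ≈ 1#
      d-1 = c-1

    cross-via : ∀ {x y a b a′ b′} → n x ≈ a → d x ≈ b → n y ≈ a′ → d y ≈ b′ → a * b′ ≈ a′ * b → x ≈F y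
    cross-via p q r s e = cross (trans (*-cong p s) (trans e (sym (*-cong r q))))

    -- The denominator of `y` has to be cancelled. For raw fractions it could be zero, and
    -- transitivity would fail.
    ≈F-trans : ∀ {x y z} → x ≈F y → y ≈F z → x ≈F z
    ≈F-trans {x} {y} {z} (cross e) (cross e′) = cross (x∙y⁻¹≈ε⇒x≈y _ _ (good-cancel (good y) (trans
      (solve 5 (λ nx dx dy nz dz → dy :* (nx :* dz :- nz :* dx) := (nx :* dy) :* dz :- (nz :* dy) :* dx) refl (n x) (d x) (d y) (n z) (d z))
      (trans (+-cong (*-congʳ e) (-‿cong (*-congʳ (sym e′))))
      (solve 4 (λ ny dx dy dz → (ny :* dx) :* dz :- (ny :* dz) :* dx := con (+ 0)) refl (n y) (d x) (d y) (d z))))))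

    +F-cong : ∀ {x x′ y y′} → x ≈F x′ → y ≈F y′ → x +F y ≈F x′ +F y′
    +F-cong {x} {x′} {y} {y′} (cross e) (cross e′) = cross-via (n-+ x y) (d-+ x y) (n-+ x′ y′) (d-+ x′ y′)
      (trans (solve 6 (λ nx dx ny dy dx′ dy′ → (nx :* dy :+ ny :* dx) :* (dx′ :* dy′) := (nx :* dx′) :* (dy :* dy′) :+ (ny :* dy′) :* (dx :* dx′)) refl _ _ _ _ _ _)
      (trans (+-cong (*-congʳ e) (*-congʳ e′))
      (solve 6 (λ nx′ dx ny′ dy dx′ dy′ → (nx′ :* dx) :* (dy :* dy′) :+ (ny′ :* dy) :* (dx :* dx′) := (nx′ :* dy′ :+ ny′ :* dx′) :* (dx :* dy)) refl _ _ _ _ _ _)))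

    *F-cong : ∀ {x x′ y y′} → x ≈F x′ → y ≈F y′ → x *F y ≈F x′ *F y′
    *F-cong {x} {x′} {y} {y′} (cross e) (cross e′) = cross-via (n-* x y) (d-* x y) (n-* x′ y′) (d-* x′ y′)
      (trans (solve 4 (λ nx ny dx′ dy′ → (nx :* ny) :* (dx′ :* dy′) := (nx :* dx′) :* (ny :* dy′)) refl _ _ _ _)
      (trans (*-cong e e′) (solve 4 (λ nx ny dx′ dy′ → (nx :* dx′) :* (ny :* dy′) := (nx :* ny) :* (dx′ :* dy′)) refl _ _ _ _)))

    +F-comm : ∀ x y → x +F y ≈F y +F x
    +F-comm x y = cross-via (n-+ x y) (d-+ x y) (n-+ y x) (d-+ y x)
      (solve 4 (λ nx dx ny dy → (nx :* dy :+ ny :* dx) :* (dy :* dx) := (ny :* dx :+ nx :* dy) :* (dx :* dy)) refl _ _ _ _)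

    *F-comm : ∀ x y → x *F y ≈F y *F x
    *F-comm x y = cross-via (n-* x y) (d-* x y) (n-* y x) (d-* y x)
      (solve 4 (λ nx dx ny dy → (nx :* ny) :* (dy :* dx) := (ny :* nx) :* (dx :* dy)) refl _ _ _ _)

    +F-identityˡ : ∀ x → 0F +F x ≈F x
    +F-identityˡ x = cross-via (trans (n-+ 0F x) (+-cong (*-congʳ n-0) (*-congˡ d-0))) (trans (d-+ 0F x) (*-congʳ d-0)) refl refl
      (solve 2 (λ nx dx → (con (+ 0) :* dx :+ nx :* con (+ 1)) :* dx := nx :* (con (+ 1) :* dx)) refl _ _)

    *F-identityˡ : ∀ x → 1F *F x ≈F x
    *F-identityˡ x = cross-via (trans (n-* 1F x) (*-congʳ n-1)) (trans (d-* 1F x) (*-congʳ d-1)) refl refl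
      (solve 2 (λ nx dx → (con (+ 1) :* nx) :* dx := nx :* (con (+ 1) :* dx)) refl _ _)

    -F-inverseˡ : ∀ x → (-F x) +F x ≈F 0F
    -F-inverseˡ x = cross-via (trans (n-+ (-F x) x) (+-cong (*-congʳ (n-neg x)) (*-congˡ (d-neg x)))) (trans (d-+ (-F x) x) (*-congʳ (d-neg x))) n-0 d-0
      (solve 2 (λ nx dx → ((:- nx) :* dx :+ nx :* dx) :* con (+ 1) := con (+ 0) :* (dx :* dx)) refl _ _)

    +F-assoc : ∀ x y z → (x +F y) +F z ≈F x +F (y +F z)
    +F-assoc x y z = cross-via (trans (n-+ (x +F y) z) (+-cong (*-congʳ (n-+ x y)) (*-congˡ (d-+ x y)))) (trans (d-+ (x +F y) z) (*-congʳ (d-+ x y)))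
      (trans (n-+ x (y +F z)) (+-cong (*-congˡ (d-+ y z)) (*-congʳ (n-+ y z)))) (trans (d-+ x (y +F z)) (*-congˡ (d-+ y z)))
      (solve 6 (λ nx dx ny dy nz dz → ((nx :* dy :+ ny :* dx) :* dz :+ nz :* (dx :* dy)) :* (dx :* (dy :* dz)) :=
                                      (nx :* (dy :* dz) :+ (ny :* dz :+ nz :* dy) :* dx) :* ((dx :* dy) :* dz)) refl _ _ _ _ _ _)

    *F-assoc : ∀ x y z → (x *F y) *F z ≈F x *F (y *F z)
    *F-assoc x y z = cross-via (trans (n-* (x *F y) z) (*-congʳ (n-* x y))) (trans (d-* (x *F y) z) (*-congʳ (d-* x y)))
      (trans (n-* x (y *F z)) (*-congˡ (n-* y z))) (trans (d-* x (y *F z)) (*-congˡ (d-* y z)))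
      (solve 6 (λ nx dx ny dy nz dz → ((nx :* ny) :* nz) :* (dx :* (dy :* dz)) := (nx :* (ny :* nz)) :* ((dx :* dy) :* dz)) refl _ _ _ _ _ _)

    distribʳF : ∀ x y z → (y +F z) *F x ≈F (y *F x) +F (z *F x)
    distribʳF x y z = cross-via (trans (n-* (y +F z) x) (*-congʳ (n-+ y z))) (trans (d-* (y +F z) x) (*-congʳ (d-+ y z)))
      (trans (n-+ (y *F x) (z *F x)) (+-cong (*-cong (n-* y x) (d-* z x)) (*-cong (n-* z x) (d-* y x))))
      (trans (d-+ (y *F x) (z *F x)) (*-cong (d-* y x) (d-* z x)))
      (solve 6 (λ nx dx ny dy nz dz → ((ny :* dz :+ nz :* dy) :* nx) :* ((dy :* dx) :* (dz :* dx)) :=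
                                      ((ny :* nx) :* (dz :* dx) :+ (nz :* nx) :* (dy :* dx)) :* ((dy :* dz) :* dx)) refl _ _ _ _ _ _)

    fractionRing : CommutativeRing 0ℓ 0ℓ
    fractionRing = record
      { Carrier = Fraction ; _≈_ = _≈F_ ; _+_ = _+F_ ; _*_ = _*F_ ; -_ = -F_ ; 0# = 0F ; 1# = 1F
      ; isCommutativeRing = record
        { isRing = record
          { +-isAbelianGroup = record
            { isGroup = record
              { isMonoid = record
                { isSemigroup = record
                  { isMagma = record
                    { isEquivalence = record { refl = cross refl ; sym = λ e → cross (sym (crossed e)) ; trans = ≈F-trans }
                    ; ∙-cong = +F-cong }
                  ; assoc = +F-assoc }
                ; identity = +F-identityˡ , λ x → ≈F-trans (+F-comm x 0F) (+F-identityˡ x) }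
              ; inverse = -F-inverseˡ , (λ x → ≈F-trans (+F-comm x (-F x)) (-F-inverseˡ x))
              ; ⁻¹-cong = λ {x} {y} e → cross-via (n-neg x) (d-neg x) (n-neg y) (d-neg y) (trans (solve 2 (λ x y → (:- x) :* y := :- (x :* y)) refl _ _)
                  (trans (-‿cong (crossed e)) (solve 2 (λ x y → :- (x :* y) := (:- x) :* y) refl _ _))) }
            ; comm = +F-comm }
          ; *-cong = *F-cong
          ; *-assoc = *F-assoc
          ; *-identity = *F-identityˡ , λ x → ≈F-trans (*F-comm x 1F) (*F-identityˡ x)
          ; distrib = (λ x y z → ≈F-trans (*F-comm x (y +F z)) (≈F-trans (distribʳF x y z) (+F-cong (*F-comm y x) (*F-comm z x)))) , distribʳF }
        ; *-comm = *F-comm } }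

    opaque
      invF : ∀ x → Good (Qq.num (frac x)) → Fraction
      invF x g = fraction (invQ (frac x)) g

      frac-inv : ∀ x g → frac (invF x g) ≡ invQ (frac x)
      frac-inv x g = ≡.refl

      invF-inverse : ∀ x g → x *F invF x g ≈F 1F
      invF-inverse x g = cross-via (n-* x (invF x g)) (d-* x (invF x g)) n-1 d-1
        (solve 2 (λ x y → (x :* y) :* con (+ 1) := con (+ 1) :* (y :* x)) refl _ _)

-- Polynomials in q as power series over ℚ

ℚ-series : CommutativeRing 0ℓ 0ℓ
ℚ-series = PowerSeries.seriesRing ℚ.+-*-commutativeRing

module PolynomialSeries where
  open CommutativeRing ℚ-series hiding (zero)
  open PowerSeries ℚ.+-*-commutativeRing using (X; X⊛; const; const-⊛; Series)
  open import Relation.Binary.Reasoning.Setoid setoid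

  -- Coefficient lists that differ in trailing zeros have the same series, and for series the ring
  -- laws are already established.
  coef : Poly → Series
  coef p k = coeffP k p

  coef-+ : ∀ p r → coef (p +P r) ≈ coef p + coef r
  coef-+ [] r k = ≡.sym (ℚ.+-identityˡ _)
  coef-+ (a ∷ p) [] k = ≡.sym (ℚ.+-identityʳ _)
  coef-+ (a ∷ p) (b ∷ r) zero = ≡.refl
  coef-+ (a ∷ p) (b ∷ r) (suc k) = coef-+ p r k

  coef-scale : ∀ a p → coef (scaleP a p) ≈ const a * coef p
  coef-scale a p k = ≡.trans (go p k) (≡.sym (const-⊛ a (coef p) k))
    where
    go : ∀ p k → coeffP k (scaleP a p) ≡ a ℚ.* coeffP k p
    go [] k = ≡.sym (ℚ.*-zeroʳ a)
    go (b ∷ p) zero = ≡.refl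
    go (b ∷ p) (suc k) = go p k

  coef-[] : coef [] ≈ 0#
  coef-[] k = ≡.refl

  coef-∷ : ∀ a p → coef (a ∷ p) ≈ const a + X * coef p
  coef-∷ a p zero = ≡.sym (≡.trans (≡.cong (a ℚ.+_) (ℚ.*-zeroˡ (coeffP 0 p))) (ℚ.+-identityʳ a))
  coef-∷ a p (suc k) = ≡.sym (≡.trans (ℚ.+-identityˡ _) (X⊛ (coef p) k))

  const-0 : const 0ℚ ≈ 0#
  const-0 zero = ≡.refl
  const-0 (suc k) = ≡.refl

  coef-0∷ : ∀ p → coef (0ℚ ∷ p) ≈ X * coef p
  coef-0∷ p = trans (coef-∷ 0ℚ p) (trans (+-congʳ const-0) (+-identityˡ _))

  coef-* : ∀ p r → coef (p *P r) ≈ coef p * coef r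
  coef-* [] r = sym (zeroˡ (coef r))
  coef-* (a ∷ p) r = begin
    coef (scaleP a r +P (0ℚ ∷ (p *P r)))            ≈⟨ coef-+ (scaleP a r) _ ⟩
    coef (scaleP a r) + coef (0ℚ ∷ (p *P r))        ≈⟨ +-cong (coef-scale a r) (trans (coef-0∷ (p *P r)) (*-congˡ {X} (coef-* p r))) ⟩
    const a * coef r + X * (coef p * coef r)        ≈⟨ +-congˡ {const a * coef r} (*-assoc X (coef p) (coef r)) ⟨
    const a * coef r + (X * coef p) * coef r        ≈⟨ distribʳ (coef r) (const a) (X * coef p) ⟨
    (const a + X * coef p) * coef r                 ≈⟨ *-congʳ {coef r} (coef-∷ a p) ⟨
    coef (a ∷ p) * coef r                           ∎

  const-neg1 : const (ℚ.- 1ℚ) ≈ - 1#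
  const-neg1 zero = ≡.refl
  const-neg1 (suc k) = ≡.refl

  xpow : ℕ → Series
  xpow zero = 1#
  xpow (suc k) = X * xpow k

  xpow-+ : ∀ i j → xpow (i ℕ.+ j) ≈ xpow i * xpow j
  xpow-+ zero j = sym (*-identityˡ (xpow j))
  xpow-+ (suc i) j = trans (*-congˡ {X} (xpow-+ i j)) (sym (*-assoc X (xpow i) (xpow j)))

  coef-zeros : ∀ k p → coef (replicate k 0ℚ ++ p) ≈ xpow k * coef p
  coef-zeros zero p = sym (*-identityˡ (coef p))
  coef-zeros (suc k) p = trans (coef-0∷ (replicate k 0ℚ ++ p)) (trans (*-congˡ {X} (coef-zeros k p)) (sym (*-assoc X (xpow k) (coef p))))

  -- The index is shifted: this is the substitution of q^{k+1} for q, so only positive exponents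
  -- occur.
  adams : ℕ → Poly → Series
  adams k p = coef (adamsP (suc k) p)

  adams-∷ : ∀ k a p → adams k (a ∷ p) ≈ const a + xpow (suc k) * adams k p
  adams-∷ k a p = trans (coef-∷ a (replicate k 0ℚ ++ adamsP (suc k) p)) (+-congˡ {const a}
    (trans (*-congˡ {X} (coef-zeros k (adamsP (suc k) p))) (sym (*-assoc X (xpow k) (adams k p)))))

  const-+ : ∀ a b → const (a ℚ.+ b) ≈ const a + const b
  const-+ a b zero = ≡.refl
  const-+ a b (suc k) = ≡.refl

  const-* : ∀ a b → const (a ℚ.* b) ≈ const a * const b
  const-* a b k = ≡.trans (go k) (≡.sym (const-⊛ a (const b) k))
    where
    go : ∀ k → const (a ℚ.* b) k ≡ a ℚ.* const b k
    go zero = ≡.refl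
    go (suc k) = ≡.sym (ℚ.*-zeroʳ a)

module Substitution (P : CommutativeRing 0ℓ 0ℓ) where
  open CommutativeRing P hiding (zero)

  -- The hypothesis `ad-∷` is Horner's rule for evaluation at `x`; compatibility with sums and
  -- products follows from it alone together with the rules for constants.
  module Evaluate
    (ad : Poly → Carrier) (k : ℚ → Carrier) (x : Carrier)
    (ad-[] : ad [] ≈ 0#) (ad-∷ : ∀ a p → ad (a ∷ p) ≈ k a + x * ad p)
    (k-+ : ∀ a b → k (a ℚ.+ b) ≈ k a + k b) (k-* : ∀ a b → k (a ℚ.* b) ≈ k a * k b) (k-0 : k 0ℚ ≈ 0#) where
    open IntegerSolver P

    substitution-+ : ∀ p r → ad (p +P r) ≈ ad p + ad r
    substitution-+ [] r = sym (trans (+-congʳ ad-[]) (+-identityˡ _))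
    substitution-+ (a ∷ p) [] = sym (trans (+-congˡ ad-[]) (+-identityʳ _))
    substitution-+ (a ∷ p) (b ∷ r) = trans (ad-∷ _ _) (trans (+-cong (k-+ a b) (*-congˡ (substitution-+ p r)))
      (trans (solve 5 (λ a b x p r → (a :+ b) :+ x :* (p :+ r) := (a :+ x :* p) :+ (b :+ x :* r)) refl _ _ _ _ _)
      (sym (+-cong (ad-∷ a p) (ad-∷ b r)))))

    substitution-scale : ∀ a p → ad (scaleP a p) ≈ k a * ad p
    substitution-scale a [] = trans ad-[] (sym (trans (*-congˡ ad-[]) (zeroʳ _)))
    substitution-scale a (b ∷ p) = trans (ad-∷ _ _) (trans (+-cong (k-* a b) (*-congˡ (substitution-scale a p)))
      (trans (solve 4 (λ a b x p → a :* b :+ x :* (a :* p) := a :* (b :+ x :* p)) refl _ _ _ _) (*-congˡ (sym (ad-∷ b p)))))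

    substitution-0∷ : ∀ p → ad (0ℚ ∷ p) ≈ x * ad p
    substitution-0∷ p = trans (ad-∷ 0ℚ p) (trans (+-congʳ k-0) (+-identityˡ _))

    substitution-* : ∀ p r → ad (p *P r) ≈ ad p * ad r
    substitution-* [] r = trans ad-[] (sym (trans (*-congʳ ad-[]) (zeroˡ _)))
    substitution-* (a ∷ p) r = trans (substitution-+ (scaleP a r) _) (trans (+-cong (substitution-scale a r)
        (trans (substitution-0∷ _) (*-congˡ (substitution-* p r))))
      (trans (solve 4 (λ a x p r → a :* r :+ x :* (p :* r) := (a :+ x :* p) :* r) refl _ _ _ _) (*-congʳ (sym (ad-∷ a p)))))

    power : ℕ → Carrier
    power zero = 1#
    power (suc i) = x * power i

    substitution-zeros : ∀ j p → ad (replicate j 0ℚ ++ p) ≈ power j * ad p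
    substitution-zeros zero p = sym (*-identityˡ _)
    substitution-zeros (suc j) p = trans (substitution-0∷ _) (trans (*-congˡ (substitution-zeros j p)) (sym (*-assoc _ _ _)))

-- Adams operations on polynomials and fractions

module Adams where
  open CommutativeRing ℚ-series hiding (zero)
  open PolynomialSeries
  open PowerSeries ℚ.+-*-commutativeRing using (X; X⊛; const; Series; _⊛_)
  open import Relation.Binary.Reasoning.Setoid setoid

  module A (k : ℕ) = Substitution.Evaluate ℚ-series (adams k) const (xpow (suc k)) coef-[] (adams-∷ k) const-+ const-* const-0

  adams-* : ∀ k p r → adams k (p *P r) ≈ adams k p * adams k r
  adams-* k = A.substitution-* k

  adams-+ : ∀ k p r → adams k (p +P r) ≈ adams k p + adams k r
  adams-+ k = A.substitution-+ k

  coef-neg : ∀ p → coef (scaleP (ℚ.- 1ℚ) p) ≈ - coef p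
  coef-neg p = trans (coef-scale (ℚ.- 1ℚ) p) (trans (*-congʳ {coef p} const-neg1) (-1*x≈-x (coef p)))
    where open import Algebra.Properties.Ring ring using (-1*x≈-x)

  adamsP-1 : ∀ p → adamsP 1 p ≡ p
  adamsP-1 [] = ≡.refl
  adamsP-1 (a ∷ p) = ≡.cong (a ∷_) (adamsP-1 p)

  adams-zero : ∀ k p → coef p ≈ 0# → adams k p ≈ 0#
  adams-zero k [] e = coef-[]
  adams-zero k (a ∷ p) e = trans (adams-∷ k a p) (trans (+-cong {const a} (const-cong (e 0)) (trans (*-congˡ {xpow (suc k)} (adams-zero k p (λ i → e (suc i)))) (zeroʳ (xpow (suc k))))) (+-identityʳ 0#))
    where
    const-cong : a ≡ 0ℚ → const a ≈ 0#
    const-cong ≡.refl = const-0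

  adams-cong : ∀ k p r → coef p ≈ coef r → adams k p ≈ adams k r
  adams-cong k [] r e = sym (adams-zero k r (sym e))
  adams-cong k (a ∷ p) [] e = adams-zero k (a ∷ p) e
  adams-cong k (a ∷ p) (b ∷ r) e = trans (adams-∷ k a p) (trans (+-cong {const a} (const-cong (e 0)) (*-congˡ {xpow (suc k)} (adams-cong k p r (λ i → e (suc i))))) (sym (adams-∷ k b r)))
    where
    const-cong : a ≡ b → const a ≈ const b
    const-cong ≡.refl _ = ≡.refl

  power-xpow : ∀ j i → A.power j i ≈ xpow (suc j ℕ.* i)
  power-xpow j zero = sym (reflexive (≡.cong xpow (ℕ.*-zeroʳ (suc j))))
  power-xpow j (suc i) = trans (*-congˡ {xpow (suc j)} (power-xpow j i)) (trans (sym (xpow-+ (suc j) (suc j ℕ.* i)))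
    (reflexive (≡.cong xpow (≡.sym (ℕ.*-suc (suc j) i)))))

  -- With the shifted indices, (j + 1)(k + 1) = 1 + (k + j(k + 1)).
  adams-adams : ∀ j k p → adams j (adamsP (suc k) p) ≈ adams (k ℕ.+ j ℕ.* suc k) p
  adams-adams j k [] = coef-[]
  adams-adams j k (a ∷ p) = begin
    adams j (a ∷ (replicate k 0ℚ ++ adamsP (suc k) p))
      ≈⟨ adams-∷ j a _ ⟩
    const a + xpow (suc j) * adams j (replicate k 0ℚ ++ adamsP (suc k) p)
      ≈⟨ +-congˡ {const a} (*-congˡ {xpow (suc j)} (A.substitution-zeros j k (adamsP (suc k) p))) ⟩
    const a + xpow (suc j) * (A.power j k * adams j (adamsP (suc k) p))
      ≈⟨ +-congˡ {const a} (trans (sym (*-assoc (xpow (suc j)) (A.power j k) _)) (*-cong {xpow (suc j) * A.power j k} (power-xpow j (suc k)) (adams-adams j k p))) ⟩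
    const a + xpow (suc j ℕ.* suc k) * adams (k ℕ.+ j ℕ.* suc k) p
      ≈⟨ adams-∷ (k ℕ.+ j ℕ.* suc k) a p ⟨
    adams (k ℕ.+ j ℕ.* suc k) (a ∷ p) ∎

  Cancellable : Series → Set
  Cancellable f = ∀ {x} → f * x ≈ 0# → x ≈ 0#

  Cancellable-resp : ∀ {f g} → f ≈ g → Cancellable f → Cancellable g
  Cancellable-resp {f} {g} e cf {x} p = cf {x} (trans (*-congʳ {x} e) p)

  Cancellable-* : ∀ {f g} → Cancellable f → Cancellable g → Cancellable (f * g)
  Cancellable-* {f} {g} cf cg {x} e = cg {x} (cf {g * x} (trans (sym (*-assoc f g x)) e))

  Cancellable-X : Cancellable X
  Cancellable-X {x} e k = ≡.trans (≡.sym (X⊛ x k)) (e (suc k))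

  Cancellable-xpow : ∀ k → Cancellable (xpow k)
  Cancellable-xpow zero {x} e = trans (sym (*-identityˡ x)) e
  Cancellable-xpow (suc k) = Cancellable-* {X} {xpow k} Cancellable-X (Cancellable-xpow k)

  ⊛-vanish : ∀ g x k → (∀ i → i ℕ.≤ k → x i ≡ 0ℚ) → (g ⊛ x) k ≡ 0ℚ
  ⊛-vanish g x zero e = ≡.trans (≡.cong (g 0 ℚ.*_) (e 0 ℕ.z≤n)) (ℚ.*-zeroʳ (g 0))
  ⊛-vanish g x (suc k) e = ≡.cong₂ ℚ._+_ (≡.trans (≡.cong (g 0 ℚ.*_) (e (suc k) ℕ.≤-refl)) (ℚ.*-zeroʳ (g 0)))
    (⊛-vanish (λ i → g (suc i)) x k (λ i le → e i (ℕ.m≤n⇒m≤1+n le)))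

  -- Comparing coefficients in increasing degree shows that those of the other factor vanish one
  -- after another.
  Cancellable-head : ∀ {f} .{{_ : ℚ.NonZero (f 0)}} → Cancellable f
  Cancellable-head {f} {x} e k = go k k ℕ.≤-refl
    where
    cancel : ∀ {y} → f 0 ℚ.* y ≡ 0ℚ → y ≡ 0ℚ
    cancel {y} p = ≡.trans (≡.sym (ℚ.*-identityˡ y)) (≡.trans (≡.cong (ℚ._* y) (≡.sym (ℚ.*-inverseˡ (f 0))))
      (≡.trans (ℚ.*-assoc (ℚ.1/ f 0) (f 0) y) (≡.trans (≡.cong (ℚ.1/ f 0 ℚ.*_) p) (ℚ.*-zeroʳ (ℚ.1/ f 0)))))
    go : ∀ k i → i ℕ.≤ k → x i ≡ 0ℚ
    go zero zero le = cancel (e 0)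
    go (suc k) i le with ℕ.m≤n⇒m<n∨m≡n le
    ... | inj₁ (ℕ.s≤s i≤k) = go k i i≤k
    ... | inj₂ ≡.refl = cancel (≡.trans (≡.sym (ℚ.+-identityʳ _)) (≡.trans (≡.cong (f 0 ℚ.* x (suc k) ℚ.+_)
            (≡.sym (⊛-vanish (λ i → f (suc i)) x k (go k)))) (e (suc k))))

  -- Denominators that stay cancellable under every substitution q ↦ q^k.
  record Good (p : Poly) : Set where
    constructor good-at
    field cancellable : ∀ k → Cancellable (adams k p)
  open Good public

  Good-* : ∀ {p r} → Good p → Good r → Good (p *P r)
  Good-* {p} {r} gp gr = good-at λ k → Cancellable-resp (sym (adams-* k p r)) (Cancellable-* {adams k p} {adams k r} (cancellable gp k) (cancellable gr k))

  Good-∷ : ∀ a p .{{_ : ℚ.NonZero a}} → Good (a ∷ p)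
  Good-∷ a p = good-at λ k → Cancellable-head

  -- Covers t = 1/q, whose denominator has constant term 0, so that `Good-∷` does not apply.
  Good-0∷ : ∀ {p} → Good p → Good (0ℚ ∷ p)
  Good-0∷ {p} gp = good-at λ k → Cancellable-resp (sym (A.substitution-0∷ k p)) (Cancellable-* {xpow (suc k)} {adams k p} (Cancellable-xpow (suc k)) (cancellable gp k))

  Good-1 : Good (1ℚ ∷ [])
  Good-1 = Good-∷ 1ℚ []

  Good-cancel : ∀ {p} → Good p → ∀ {x} → coef p * x ≈ 0# → x ≈ 0#
  Good-cancel {p} gp = Cancellable-resp (reflexive (≡.cong coef (adamsP-1 p))) (cancellable gp 0)

  Good-adams : ∀ k {p} → Good p → Good (adamsP (suc k) p)
  Good-adams k {p} gp = good-at λ j → Cancellable-resp (sym (adams-adams j k p)) (cancellable gp (k ℕ.+ j ℕ.* suc k))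

  coef-const0 : coef (0ℚ ∷ []) ≈ 0#
  coef-const0 zero = ≡.refl
  coef-const0 (suc k) = ≡.refl

  coef-const1 : coef (1ℚ ∷ []) ≈ 1#
  coef-const1 zero = ≡.refl
  coef-const1 (suc k) = ≡.refl

  open Fractions.Denominators ℚ-series coef coef-+ coef-* coef-neg coef-const0 coef-const1
    Good (λ {p} {r} → Good-* {p} {r}) Good-1 (λ {p} → Good-cancel {p}) public

  private
    num den : Fraction → Poly
    num x = Qq.num (frac x)
    den x = Qq.den (frac x)

  ≈F⇒≈Q : ∀ {x y} → x ≈F y → frac x ≈Q frac y
  ≈F⇒≈Q {x} {y} e = trans (coef-* (num x) (den y)) (trans (crossed e) (sym (coef-* (num y) (den x))))

  opaque
    adamsF : ℕ → Fraction → Fraction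
    adamsF k x = fraction (adamsQ (suc k) (frac x)) (Good-adams k (good x))

    frac-adams : ∀ k x → frac (adamsF k x) ≡ adamsQ (suc k) (frac x)
    frac-adams k x = ≡.refl

    n-adams : ∀ k x → n (adamsF k x) ≈ adams k (num x)
    n-adams k x = refl

    d-adams : ∀ k x → d (adamsF k x) ≈ adams k (den x)
    d-adams k x = refl

  adamsF-cong : ∀ k {x y} → x ≈F y → adamsF k x ≈F adamsF k y
  adamsF-cong k {x} {y} e = cross-via {adamsF k x} {adamsF k y} (n-adams k x) (d-adams k x) (n-adams k y) (d-adams k y)
    (trans (sym (adams-* k (num x) (den y))) (trans (adams-cong k (num x *P den y) (num y *P den x) (≈F⇒≈Q e)) (adams-* k (num y) (den x))))

  adams-coef : ∀ k x y (a b : Series) → adams k (num x) ≈ a → adams k (den x) ≈ b → n y ≈ a → d y ≈ b → adamsF k x ≈F y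
  adams-coef k x y a b e₁ e₂ e₃ e₄ = cross-via {adamsF k x} {y} (trans (n-adams k x) e₁) (trans (d-adams k x) e₂) e₃ e₄ refl

  adams-num-* : ∀ k x y → adams k (num (x *F y)) ≈ adams k (num x) * adams k (num y)
  adams-num-* k x y = trans (reflexive (≡.cong (λ f → adams k (Qq.num f)) (frac-* x y))) (adams-* k (num x) (num y))

  adams-den-* : ∀ k x y → adams k (den (x *F y)) ≈ adams k (den x) * adams k (den y)
  adams-den-* k x y = trans (reflexive (≡.cong (λ f → adams k (Qq.den f)) (frac-* x y))) (adams-* k (den x) (den y))

  adamsF-* : ∀ k x y → adamsF k (x *F y) ≈F adamsF k x *F adamsF k y
  adamsF-* k x y = adams-coef k (x *F y) (adamsF k x *F adamsF k y) (adams k (num x) * adams k (num y)) (adams k (den x) * adams k (den y))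
    (adams-num-* k x y) (adams-den-* k x y)
    (trans (n-* (adamsF k x) (adamsF k y)) (*-cong {n (adamsF k x)} (n-adams k x) (n-adams k y)))
    (trans (d-* (adamsF k x) (adamsF k y)) (*-cong {d (adamsF k x)} (d-adams k x) (d-adams k y)))

  adamsF-+ : ∀ k x y → adamsF k (x +F y) ≈F adamsF k x +F adamsF k y
  adamsF-+ k x y = adams-coef k (x +F y) (adamsF k x +F adamsF k y) (adams k (num x) * adams k (den y) + adams k (num y) * adams k (den x)) (adams k (den x) * adams k (den y))
    (trans (reflexive (≡.cong (λ f → adams k (Qq.num f)) (frac-+ x y))) (trans (adams-+ k (num x *P den y) (num y *P den x))
      (+-cong {adams k (num x *P den y)} (adams-* k (num x) (den y)) (adams-* k (num y) (den x)))))
    (trans (reflexive (≡.cong (λ f → adams k (Qq.den f)) (frac-+ x y))) (adams-* k (den x) (den y)))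
    (trans (n-+ (adamsF k x) (adamsF k y)) (+-cong {n (adamsF k x) * d (adamsF k y)} (*-cong {n (adamsF k x)} (n-adams k x) (d-adams k y)) (*-cong {n (adamsF k y)} (n-adams k y) (d-adams k x))))
    (trans (d-+ (adamsF k x) (adamsF k y)) (*-cong {d (adamsF k x)} (d-adams k x) (d-adams k y)))

  adams-const : ∀ k a → adams k (a ∷ []) ≈ coef (a ∷ [])
  adams-const k a = trans (adams-∷ k a []) (trans (+-congˡ {const a} (trans (*-congˡ {xpow (suc k)} coef-[]) (trans (zeroʳ (xpow (suc k))) (sym (zeroʳ X))))) (sym (coef-∷ a [])))

  adamsF-1 : ∀ k → adamsF k 1F ≈F 1F
  adamsF-1 k = adams-coef k 1F 1F 1# 1# (trans (reflexive (≡.cong (λ f → adams k (Qq.num f)) frac-1)) (trans (adams-const k 1ℚ) coef-const1))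
    (trans (reflexive (≡.cong (λ f → adams k (Qq.den f)) frac-1)) (trans (adams-const k 1ℚ) coef-const1)) n-1 d-1

-- Newton identities

module Powers (R : CommutativeRing 0ℓ 0ℓ) where
  open CommutativeRing R hiding (zero)
  open IntegerSolver R

  power : Carrier → ℕ → Carrier
  power c zero = 1#
  power c (suc n) = c * power c n

  power-* : ∀ c d n → power (c * d) n ≈ power c n * power d n
  power-* c d zero = sym (*-identityˡ 1#)
  power-* c d (suc n) = trans (*-congˡ (power-* c d n)) (solve 4 (λ x y z w → (x :* y) :* (z :* w) := (x :* z) :* (y :* w)) refl _ _ _ _)

  power-1 : ∀ n → power 1# n ≈ 1#
  power-1 zero = refl
  power-1 (suc n) = trans (*-identityˡ _) (power-1 n)

  power-cong : ∀ {c d} n → c ≈ d → power c n ≈ power d n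
  power-cong zero e = refl
  power-cong (suc n) e = *-cong e (power-cong n e)

  power-+ : ∀ c m n → power c (m ℕ.+ n) ≈ power c m * power c n
  power-+ c zero n = sym (*-identityˡ _)
  power-+ c (suc m) n = trans (*-congˡ (power-+ c m n)) (sym (*-assoc _ _ _))

  power-inverse : ∀ {c d} → c * d ≈ 1# → ∀ n → power c n * power d n ≈ 1#
  power-inverse {c} {d} cd n = trans (sym (power-* c d n)) (trans (power-cong n cd) (power-1 n))

  power-homo-* : ∀ c m n → power c (m ℕ.* n) ≈ power (power c m) n
  power-homo-* c m zero = reflexive (≡.cong (power c) (ℕ.*-zeroʳ m))
  power-homo-* c m (suc n) = trans (reflexive (≡.cong (power c) (ℕ.*-suc m n))) (trans (power-+ c m (m ℕ.* n)) (*-congˡ (power-homo-* c m n)))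

  module Inverses (q t : Carrier) (qt : q * t ≈ 1#) where
    integerPower : ℤ → Carrier
    integerPower (+ n) = power q n
    integerPower -[1+ n ] = power t (suc n)

    integerPower-suc : ∀ i → integerPower (sucℤ i) ≈ q * integerPower i
    integerPower-suc (+ n) = refl
    integerPower-suc -[1+ zero ] = sym (trans (*-congˡ (*-identityʳ t)) qt)
    integerPower-suc -[1+ suc n ] = sym (trans (sym (*-assoc _ _ _)) (trans (*-congʳ qt) (*-identityˡ _)))

    integerPower-⊖ : ∀ m n → integerPower (m ℤ.⊖ n) ≈ power q m * power t n
    integerPower-⊖ m zero = sym (*-identityʳ _)
    integerPower-⊖ zero (suc n) = sym (*-identityˡ _)
    integerPower-⊖ (suc m) (suc n) = trans (reflexive (≡.cong integerPower (ℤ.[1+m]⊖[1+n]≡m⊖n m n))) (trans (integerPower-⊖ m n)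
      (trans (sym (*-identityˡ _)) (trans (*-congʳ (sym qt)) (solve 4 (λ q t x y → (q :* t) :* (x :* y) := (q :* x) :* (t :* y)) refl _ _ _ _))))

    -- Rows are counted from 0, so the row number in the exponent appears as i + 1.
    integerPower-exponent : ∀ u x v i → integerPower ((+ (u ℕ.* x ℕ.+ v)) ℤ.- (+ (u ℕ.* (i ℕ.+ 1)))) ≈
      power q v * (power (power t u) (suc i) * power (power q u) x)
    integerPower-exponent u x v i = trans (reflexive (≡.cong integerPower (ℤ.m-n≡m⊖n (u ℕ.* x ℕ.+ v) (u ℕ.* (i ℕ.+ 1)))))
      (trans (integerPower-⊖ (u ℕ.* x ℕ.+ v) (u ℕ.* (i ℕ.+ 1)))
      (trans (*-cong (trans (power-+ q (u ℕ.* x) v) (*-congʳ (power-homo-* q u x)))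
        (trans (power-homo-* t u (i ℕ.+ 1)) (reflexive (≡.cong (power (power t u)) (ℕ.+-comm i 1)))))
      (solve 3 (λ x y z → (x :* y) :* z := y :* (z :* x)) refl _ _ _)))

module NewtonIdentities (R : CommutativeRing 0ℓ 0ℓ) where
  open CommutativeRing R hiding (zero)
  open SemiringMult semiring using () renaming (_×_ to _×′_)

  module Cancellative (cancel : ∀ n {x y} → suc n ×′ x ≈ suc n ×′ y → x ≈ y) where

    open IntegerSolver R
    open PowerSeries R
    open Powers R
    open SemiringMult semiring using (×-congʳ; ×-comm-*; ×-assoc-*)
    open import Algebra.Properties.CommutativeMonoid.Mult +-commutativeMonoid using (×-distrib-+)
    module S = CommutativeRing seriesRing
    open import Relation.Binary.Reasoning.Setoid setoid

    derivative : Series → Series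
    derivative f n = suc n ×′ f (suc n)

    private
      ×-zero : ∀ k → k ×′ 0# ≈ 0#
      ×-zero zero = refl
      ×-zero (suc k) = trans (+-identityˡ _) (×-zero k)

      ×-⊛ : ∀ k f g → (λ i → k ×′ f i) ⊛ g ≋ λ n → k ×′ (f ⊛ g) n
      ×-⊛ k f g zero = ×-assoc-* k _ _
      ×-⊛ k f g (suc n) = trans (+-cong (×-assoc-* k _ _) (×-⊛ k (tail f) g n)) (sym (×-distrib-+ _ _ k))

    derivative-⊛ : ∀ f g n → derivative (f ⊛ g) n ≈ (derivative f ⊛ g) n + (f ⊛ derivative g) n
    derivative-⊛ f g zero = solve 4 (λ a b c d → (a :* d :+ b :* c) :+ con (+ 0) := (b :+ con (+ 0)) :* c :+ a :* (d :+ con (+ 0))) refl _ _ _ _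
    derivative-⊛ f g (suc m) = begin
      suc (suc m) ×′ (f 0 * g (suc (suc m)) + (tail f ⊛ g) (suc m))
        ≈⟨ ×-distrib-+ _ _ (suc (suc m)) ⟩
      suc (suc m) ×′ (f 0 * g (suc (suc m))) + ((tail f ⊛ g) (suc m) + derivative (tail f ⊛ g) m)
        ≈⟨ +-cong (sym (×-comm-* (suc (suc m)) _ _)) (+-congˡ (derivative-⊛ (tail f) g m)) ⟩
      f 0 * derivative g (suc m) + ((f 1 * g (suc m) + (tail (tail f) ⊛ g) m) + ((derivative (tail f) ⊛ g) m + (tail f ⊛ derivative g) m))
        ≈⟨ solve 5 (λ x y z w v → x :+ ((y :+ z) :+ (w :+ v)) := (y :+ (z :+ w)) :+ (x :+ v)) refl _ _ _ _ _ ⟩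
      (f 1 * g (suc m) + ((tail (tail f) ⊛ g) m + (derivative (tail f) ⊛ g) m)) + (f ⊛ derivative g) (suc m)
        ≈⟨ +-congʳ (+-cong (*-congʳ (+-identityʳ _)) (⊛-distribʳ g (tail (tail f)) (derivative (tail f)) m)) ⟨
      (derivative f ⊛ g) (suc m) + (f ⊛ derivative g) (suc m) ∎

    -- f is determined by the power sums P n = p_{n+1} as Σ_n f_n x^n = exp (Σ_k p_k x^k / k).
    record Newton (P f : Series) : Set where
      constructor newton
      field
        initial : f 0 ≈ 1#
        recursion : ∀ n → derivative f n ≈ (P ⊛ f) n
    open Newton public

    ⊛-congʳ≤ : ∀ P {f g} n → (∀ i → i ℕ.≤ n → f i ≈ g i) → (P ⊛ f) n ≈ (P ⊛ g) n
    ⊛-congʳ≤ P zero e = *-congˡ (e 0 z≤n)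
    ⊛-congʳ≤ P (suc n) e = +-cong (*-congˡ (e (suc n) ℕ.≤-refl)) (⊛-congʳ≤ (tail P) n (λ i le → e i (ℕ.m≤n⇒m≤1+n le)))

    -- The recursion expresses (n + 1) f_{n+1} through earlier coefficients, and the factor n + 1
    -- can be cancelled.
    Newton-unique : ∀ {P Q f g} → P ≋ Q → Newton P f → Newton Q g → f ≋ g
    Newton-unique {P} {Q} {f} {g} e nf ng n = go n n ℕ.≤-refl
      where
      go : ∀ n i → i ℕ.≤ n → f i ≈ g i
      go n zero le = trans (initial nf) (sym (initial ng))
      go (suc n) (suc i) (s≤s le) = cancel i (begin
        derivative f i   ≈⟨ recursion nf i ⟩
        (P ⊛ f) i        ≈⟨ ⊛-congʳ≤ P i (λ j j≤i → go n j (ℕ.≤-trans j≤i le)) ⟩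
        (P ⊛ g) i        ≈⟨ ⊛-cong e (λ _ → refl) i ⟩
        (Q ⊛ g) i        ≈⟨ recursion ng i ⟨
        derivative g i   ∎)

    -- Logarithmic derivatives add, by the Leibniz rule.
    Newton-⊛ : ∀ {P Q f g} → Newton P f → Newton Q g → Newton (λ n → P n + Q n) (f ⊛ g)
    Newton-⊛ {P} {Q} {f} {g} nf ng = newton (trans (*-cong (initial nf) (initial ng)) (*-identityˡ 1#)) λ n → begin
      derivative (f ⊛ g) n
        ≈⟨ derivative-⊛ f g n ⟩
      (derivative f ⊛ g) n + (f ⊛ derivative g) n
        ≈⟨ +-cong (⊛-cong (recursion nf) (λ _ → refl) n) (⊛-cong {f} (λ _ → refl) (recursion ng) n) ⟩
      ((P ⊛ f) ⊛ g) n + (f ⊛ (Q ⊛ g)) n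
        ≈⟨ +-cong (⊛-assoc P f g n) (trans (sym (⊛-assoc f Q g n)) (trans (⊛-cong (⊛-comm f Q) (λ _ → refl) n) (⊛-assoc Q f g n))) ⟩
      (P ⊛ (f ⊛ g)) n + (Q ⊛ (f ⊛ g)) n
        ≈⟨ ⊛-distribʳ (f ⊛ g) P Q n ⟨
      ((λ n → P n + Q n) ⊛ (f ⊛ g)) n ∎

    dilate : Carrier → Series → Series
    dilate c f n = power c n * f n

    dilate-⊛ : ∀ c f g → dilate c f ⊛ dilate c g ≋ dilate c (f ⊛ g)
    dilate-⊛ c f g zero = solve 2 (λ x y → (con (+ 1) :* x) :* (con (+ 1) :* y) := con (+ 1) :* (x :* y)) refl _ _
    dilate-⊛ c f g (suc n) = begin
      (1# * f 0) * (c * power c n * g (suc n)) + ((λ i → c * power c i * f (suc i)) ⊛ dilate c g) n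
        ≈⟨ +-congˡ (trans (⊛-cong (λ i → *-assoc _ _ _) (λ _ → refl) n) (trans (⊛-scale c (dilate c (tail f)) (dilate c g) n) (*-congˡ (dilate-⊛ c (tail f) g n)))) ⟩
      (1# * f 0) * (c * power c n * g (suc n)) + c * (power c n * (tail f ⊛ g) n)
        ≈⟨ solve 5 (λ c p x y z → (con (+ 1) :* x) :* (c :* p :* y) :+ c :* (p :* z) := c :* p :* (x :* y :+ z)) refl _ _ _ _ _ ⟩
      c * power c n * (f 0 * g (suc n) + (tail f ⊛ g) n) ∎

    Newton-dilate : ∀ c {P f} → Newton P f → Newton (λ n → power c (suc n) * P n) (dilate c f)
    Newton-dilate c {P} {f} nf = newton (trans (*-identityˡ _) (initial nf)) λ n → begin
      suc n ×′ (c * power c n * f (suc n))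
        ≈⟨ ×-comm-* (suc n) _ _ ⟨
      c * power c n * derivative f n
        ≈⟨ *-congˡ (recursion nf n) ⟩
      c * power c n * (P ⊛ f) n
        ≈⟨ trans (*-assoc _ _ _) (*-congˡ (sym (dilate-⊛ c P f n))) ⟩
      c * (dilate c P ⊛ dilate c f) n
        ≈⟨ ⊛-scale c (dilate c P) (dilate c f) n ⟨
      ((λ n → c * (power c n * P n)) ⊛ dilate c f) n
        ≈⟨ ⊛-cong (λ i → sym (*-assoc _ _ _)) (λ _ → refl) n ⟩
      ((λ n → power c (suc n) * P n) ⊛ dilate c f) n ∎

    1-_·X : Carrier → Series
    (1- α ·X) zero = 1#
    (1- α ·X) (suc n) = const (- α) n

    1-X⊛ : ∀ α f n → ((1- α ·X) ⊛ f) (suc n) ≈ f (suc n) - α * f n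
    1-X⊛ α f n = +-cong (*-identityˡ _) (trans (const-⊛ (- α) f n) (solve 2 (λ x y → (:- x) :* y := :- (x :* y)) refl _ _))

    -- This is log(1 - αx) = -Σ α^k x^k / k.
    Newton-1-X : ∀ α → Newton (λ n → - power α (suc n)) (1- α ·X)
    Newton-1-X α = newton refl steps
      where
      P : Series
      P n = - power α (suc n)
      steps : ∀ n → derivative (1- α ·X) n ≈ (P ⊛ (1- α ·X)) n
      steps zero = solve 1 (λ x → (:- x) :+ con (+ 0) := (:- (x :* con (+ 1))) :* con (+ 1)) refl _
      steps (suc n) = trans (×-zero (suc (suc n))) (sym (trans (⊛-comm P (1- α ·X) (suc n)) (trans (1-X⊛ α P n)
        (solve 2 (λ x y → (:- (x :* y)) :- x :* (:- y) := con (+ 0)) refl _ _))))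

    geom-⊛ : ∀ a (H G : ℤ → Carrier) n v → AlternatingSums.geom R a (λ i j → H i * G j) (+ n) (+ v) ≈
      ((λ j → power a j * G (+ (v ℕ.+ j))) ⊛ (λ i → H (+ i))) n
    geom-⊛ a H G zero v = trans (*-comm _ _) (*-congʳ (trans (reflexive (≡.cong (λ k → G (+ k)) (≡.sym (ℕ.+-identityʳ v)))) (sym (*-identityˡ _))))
    geom-⊛ a H G (suc n) v = +-cong
      (trans (*-comm _ _) (*-congʳ (trans (reflexive (≡.cong (λ k → G (+ k)) (≡.sym (ℕ.+-identityʳ v)))) (sym (*-identityˡ _)))))
      (trans (*-congˡ (geom-⊛ a H G n (suc v))) (sym (trans (⊛-cong (λ j → trans (*-assoc _ _ _) (*-congˡ (*-congˡ
        (reflexive (≡.cong (λ k → G (+ k)) (ℕ.+-suc v j)))))) (λ _ → refl) n) (⊛-scale a _ _ n))))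

    -- `inv m` plays the part of 1/m!. As ℓ has no constant term, its m-th power starts in degree m,
    -- so the coefficient of degree n is settled by the powers up to n; hence the diagonal
    -- definition of `exponential`.
    module Exponential (ℓ : Series) (ℓ0 : ℓ 0 ≈ 0#) (inv : ℕ → Carrier) (inv-suc : ∀ m → suc m ×′ inv (suc m) ≈ inv m) (inv-0 : inv 0 ≈ 1#) where

      pow : ℕ → Series
      pow zero = const 1#
      pow (suc m) = ℓ ⊛ pow m

      pow-vanish : ∀ m n → n ℕ.< m → pow m n ≈ 0#
      pow-vanish (suc m) n (s≤s n≤m) = go n n≤m
        where
        go : ∀ n → n ℕ.≤ m → (ℓ ⊛ pow m) n ≈ 0#
        go zero le = trans (*-congʳ ℓ0) (zeroˡ _)
        go (suc n) le = trans (+-congʳ (trans (*-congʳ ℓ0) (zeroˡ _))) (trans (+-identityˡ _)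
          (trans (⊛-congʳ≤ (tail ℓ) n (λ i i≤n → pow-vanish m i (ℕ.≤-trans (s≤s i≤n) le))) (trans (⊛-comm (tail ℓ) (λ _ → 0#) n) (⊛-zero (tail ℓ) (λ _ → refl) n))))

      derivative-pow : ∀ m n → derivative (pow (suc m)) n ≈ suc m ×′ (derivative ℓ ⊛ pow m) n
      derivative-pow zero n = trans (derivative-⊛ ℓ (const 1#) n) (+-congˡ (trans (⊛-comm ℓ (derivative (const 1#)) n) (⊛-zero ℓ (λ i → ×-zero (suc i)) n)))
      derivative-pow (suc m) n = begin
        derivative (ℓ ⊛ pow (suc m)) n
          ≈⟨ derivative-⊛ ℓ (pow (suc m)) n ⟩
        (derivative ℓ ⊛ pow (suc m)) n + (ℓ ⊛ derivative (pow (suc m))) n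
          ≈⟨ +-congˡ (begin
            (ℓ ⊛ derivative (pow (suc m))) n                          ≈⟨ ⊛-cong {ℓ} (λ _ → refl) (derivative-pow m) n ⟩
            (ℓ ⊛ (λ n → suc m ×′ (derivative ℓ ⊛ pow m) n)) n         ≈⟨ ⊛-comm ℓ _ n ⟩
            ((λ n → suc m ×′ (derivative ℓ ⊛ pow m) n) ⊛ ℓ) n         ≈⟨ ×-⊛ (suc m) (derivative ℓ ⊛ pow m) ℓ n ⟩
            suc m ×′ ((derivative ℓ ⊛ pow m) ⊛ ℓ) n                   ≈⟨ ×-congʳ (suc m) (trans (⊛-assoc (derivative ℓ) (pow m) ℓ n) (⊛-cong {derivative ℓ} (λ _ → refl) (⊛-comm (pow m) ℓ) n)) ⟩
            suc m ×′ (derivative ℓ ⊛ pow (suc m)) n                   ∎) ⟩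
        suc (suc m) ×′ (derivative ℓ ⊛ pow (suc m)) n ∎

      partial : ℕ → Series
      partial zero n = inv 0 * pow 0 n
      partial (suc m) n = partial m n + inv (suc m) * pow (suc m) n

      derivative-partial : ∀ m n → derivative (partial (suc m)) n ≈ (derivative ℓ ⊛ partial m) n
      derivative-partial m n = go m n
        where
        term : ∀ m n → suc n ×′ (inv (suc m) * pow (suc m) (suc n)) ≈ (derivative ℓ ⊛ (λ i → inv m * pow m i)) n
        term m n = begin
          suc n ×′ (inv (suc m) * pow (suc m) (suc n))              ≈⟨ ×-comm-* (suc n) _ _ ⟨
          inv (suc m) * derivative (pow (suc m)) n                  ≈⟨ *-congˡ (derivative-pow m n) ⟩
          inv (suc m) * (suc m ×′ (derivative ℓ ⊛ pow m) n)         ≈⟨ ×-comm-* (suc m) _ _ ⟩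
          suc m ×′ (inv (suc m) * (derivative ℓ ⊛ pow m) n)         ≈⟨ ×-assoc-* (suc m) _ _ ⟨
          (suc m ×′ inv (suc m)) * (derivative ℓ ⊛ pow m) n         ≈⟨ *-cong (inv-suc m) (⊛-comm (derivative ℓ) (pow m) n) ⟩
          inv m * (pow m ⊛ derivative ℓ) n                          ≈⟨ ⊛-scale (inv m) (pow m) (derivative ℓ) n ⟨
          ((λ i → inv m * pow m i) ⊛ derivative ℓ) n                ≈⟨ ⊛-comm _ (derivative ℓ) n ⟩
          (derivative ℓ ⊛ (λ i → inv m * pow m i)) n                ∎
        go : ∀ m n → derivative (partial (suc m)) n ≈ (derivative ℓ ⊛ partial m) n
        go zero n = trans (×-distrib-+ _ _ (suc n)) (trans (+-cong (trans (×-congʳ (suc n) (zeroʳ _)) (×-zero (suc n))) (term 0 n)) (+-identityˡ _))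
        go (suc m) n = trans (×-distrib-+ _ _ (suc n)) (trans (+-cong (go m n) (term (suc m) n))
          (sym (S.distribˡ (derivative ℓ) (partial m) (λ i → inv (suc m) * pow (suc m) i) n)))

      partial-stable : ∀ n k → partial (n ℕ.+ k) n ≈ partial n n
      partial-stable n zero = reflexive (≡.cong (λ m → partial m n) (ℕ.+-identityʳ n))
      partial-stable n (suc k) = trans (reflexive (≡.cong (λ m → partial m n) (ℕ.+-suc n k)))
        (trans (+-cong (partial-stable n k) (trans (*-congˡ (pow-vanish (suc (n ℕ.+ k)) n (s≤s (ℕ.m≤m+n n k)))) (zeroʳ _))) (+-identityʳ _))

      exponential : Series
      exponential n = partial n n

      partial-≤ : ∀ {n m} → n ℕ.≤ m → partial m n ≈ exponential n
      partial-≤ {n} {m} le = trans (reflexive (≡.cong (λ m → partial m n) (≡.sym (ℕ.m+[n∸m]≡n le)))) (partial-stable n (m ℕ.∸ n))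

      Newton-exponential : Newton (derivative ℓ) exponential
      Newton-exponential = newton (trans (*-identityʳ _) inv-0) λ n → trans (derivative-partial n n)
        (⊛-congʳ≤ (derivative ℓ) n (λ i i≤n → partial-≤ i≤n))

-- Ring homomorphisms and their effect on Schur functions

schurBy-cong : ∀ (R : CommutativeRing 0ℓ 0ℓ) {h h′} → (∀ k → CommutativeRing._≈_ R (h k) (h′ k)) → ∀ {s p n} (β : Vec ℤ n) →
  CommutativeRing._≈_ R (AlternatingSums.Schur.schurBy R h s p β) (AlternatingSums.Schur.schurBy R h′ s p β)
schurBy-cong R e [] = CommutativeRing.refl R
schurBy-cong R e (m ∷ β) = AlternatingSums.alt-cong R β (λ k γ → CommutativeRing.*-cong R (e k) (schurBy-cong R e γ))

record Hom (A B : CommutativeRing 0ℓ 0ℓ) : Set where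
  private
    module A = CommutativeRing A
    module B = CommutativeRing B
  field
    fun : A.Carrier → B.Carrier
    cong : ∀ {x y} → x A.≈ y → fun x B.≈ fun y
    +-homo : ∀ x y → fun (x A.+ y) B.≈ fun x B.+ fun y
    *-homo : ∀ x y → fun (x A.* y) B.≈ fun x B.* fun y
    1-homo : fun A.1# B.≈ B.1#
  open import Algebra.Properties.Ring B.ring using (x+x≈x⇒x≈0)
  open import Algebra.Properties.Group B.+-group using (inverseˡ-unique)

  0-homo : fun A.0# B.≈ B.0#
  0-homo = x+x≈x⇒x≈0 (fun A.0#) (B.trans (B.sym (+-homo A.0# A.0#)) (cong (A.+-identityˡ A.0#)))

  neg-homo : ∀ x → fun (A.- x) B.≈ B.- fun x
  neg-homo x = inverseˡ-unique (fun (A.- x)) (fun x) (B.trans (B.sym (+-homo (A.- x) x)) (B.trans (cong (A.-‿inverseˡ x)) 0-homo))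

_∘H_ : ∀ {A B C} → Hom B C → Hom A B → Hom A C
_∘H_ {C = C} g f = record
  { fun = λ x → g.fun (f.fun x)
  ; cong = λ e → g.cong (f.cong e)
  ; +-homo = λ x y → trans (g.cong (f.+-homo x y)) (g.+-homo _ _)
  ; *-homo = λ x y → trans (g.cong (f.*-homo x y)) (g.*-homo _ _)
  ; 1-homo = trans (g.cong f.1-homo) g.1-homo }
  where
  open CommutativeRing C using (trans)
  module g = Hom g
  module f = Hom f

module Naturality {A B : CommutativeRing 0ℓ 0ℓ} (f : Hom A B) where
  private
    module A = CommutativeRing A
    module SA = AlternatingSums A
    module SB = AlternatingSums B
  open CommutativeRing B
  open Hom f hiding (cong)

  alt-natural : ∀ {s p n} (β : Vec ℤ n) {m} F → fun (SA.alt s p β m F) ≈ SB.alt s p β m (λ k γ → fun (F k γ))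
  alt-natural [] F = refl
  alt-natural (b ∷ β) F = trans (+-homo _ _) (+-cong (alt-natural β _) (trans (neg-homo _) (-‿cong (alt-natural β _))))

  schur-natural : ∀ {s p} (h : ℤ → A.Carrier) {n} (β : Vec ℤ n) → fun (SA.Schur.schurBy h s p β) ≈ SB.Schur.schurBy (λ k → fun (h k)) s p β
  schur-natural h [] = 1-homo
  schur-natural h (m ∷ β) = trans (alt-natural β _) (SB.alt-cong β (λ k γ → trans (*-homo _ _) (*-congˡ (schur-natural h γ))))

-- Symmetric functions as a monoid algebra, and plethysm as evaluation

multisets : CommutativeMonoid 0ℓ 0ℓ
multisets = ↭.++-commutativeMonoid {A = ℕ}

monomials : CommutativeMonoid 0ℓ 0ℓ
monomials = DirectProduct.commutativeMonoid ℤ.+-0-commutativeMonoid multisets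

module Constants (K : CommutativeRing 0ℓ 0ℓ) (M : CommutativeMonoid 0ℓ 0ℓ) where
  open MonoidAlgebra K M
  private
    module K = CommutativeRing K
    module M = CommutativeMonoid M
  open CommutativeRing algebra

  constant : K.Carrier → Sum
  constant c = (c , M.ε) ∷ []

  pair-constant : ∀ c F (φ : Functional) → pair (constant c · F) (on φ) K.≈ c K.* pair F (on φ)
  pair-constant c F φ = K.trans (pair-· (constant c) F (on φ)) (K.trans (K.+-identityʳ _) (K.*-congˡ (pair-cong F (λ m → on-cong φ (M.identityˡ m)))))

  scale-constant : ∀ c F → scale c F ≈ constant c * F
  scale-constant c F = agree λ φ → K.trans (pair-scale c F (on φ)) (K.sym (pair-constant c F φ))

  constant-cong : ∀ {c d} → c K.≈ d → constant c ≈ constant d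
  constant-cong e = agree λ φ → K.+-congʳ (K.*-congʳ e)

  constant-* : ∀ c d → constant (c K.* d) ≈ constant c * constant d
  constant-* c d = agree λ φ → K.trans (K.+-identityʳ _) (K.trans (K.*-assoc _ _ _) (K.sym (K.trans (pair-constant c (constant d) φ) (K.*-congˡ (K.+-identityʳ _)))))

  constant-+ : ∀ c d → constant (c K.+ d) ≈ constant c + constant d
  constant-+ c d = agree λ φ → K.trans (K.+-congʳ (K.distribʳ _ c d)) (K.+-assoc _ _ _)

  constant-neg : ∀ c → constant (K.- c) ≈ - constant c
  constant-neg c = agree λ φ → K.refl

  constant-hom : Hom K algebra
  constant-hom = record { fun = constant ; cong = constant-cong ; +-homo = constant-+ ; *-homo = constant-* ; 1-homo = refl }

module Monomials (C : CommutativeRing 0ℓ 0ℓ) (ρ : ℕ → CommutativeRing.Carrier C) where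
  open CommutativeRing C
  open IntegerSolver C

  monomial : List ℕ → Carrier
  monomial = foldr (λ j → ρ j *_) 1#

  monomial-++ : ∀ ms ns → monomial (ms ++ ns) ≈ monomial ms * monomial ns
  monomial-++ [] ns = sym (*-identityˡ _)
  monomial-++ (m ∷ ms) ns = trans (*-congˡ (monomial-++ ms ns)) (sym (*-assoc _ _ _))

  monomial-↭ : ∀ {ms ns} → ms ↭ ns → monomial ms ≈ monomial ns
  monomial-↭ ↭.refl = refl
  monomial-↭ (↭.prep x e) = *-congˡ (monomial-↭ e)
  monomial-↭ (↭.swap x y e) = trans (*-congˡ (*-congˡ (monomial-↭ e))) (solve 3 (λ x y z → x :* (y :* z) := y :* (x :* z)) refl _ _ _)
  monomial-↭ (↭.trans e d) = trans (monomial-↭ e) (monomial-↭ d)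

  regroup : ∀ {A A′ B B′ P P′ q s E T} → A ≈ A′ → B ≈ B′ → P ≈ P′ → q * (B′ * P′) ≈ E → T ≈ E * s →
    q * (A * (B * P) * s) ≈ A′ * T
  regroup {A} {A′} {B} {B′} {P} {P′} {q} {s} eA eB eP eE eT = trans (*-congˡ (*-congʳ (*-cong eA (*-cong eB eP))))
    (trans (solve 5 (λ q A B P s → q :* (A :* (B :* P) :* s) := A :* ((q :* (B :* P)) :* s)) refl q A′ B′ P′ s)
    (*-congˡ (trans (*-congʳ eE) (sym eT))))

  interchange : ∀ x y z w → (x * y) * (z * w) ≈ (x * z) * (y * w)
  interchange x y z w = solve 4 (λ x y z w → (x :* y) :* (z :* w) := (x :* z) :* (y :* w)) refl x y z w

module Evaluation (K : CommutativeRing 0ℓ 0ℓ) (M : CommutativeMonoid 0ℓ 0ℓ)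
  (ρ : ℕ → MonoidAlgebra.Sum K M) where
  private
    module K = CommutativeRing K
    module Λ = MonoidAlgebra K multisets
    module C = Constants K M
  open MonoidAlgebra K M
  open CommutativeRing algebra hiding (zero)

  open Monomials algebra ρ public

  -- The algebra of multisets is free on the power sums, so prescribing images ρ k determines a
  -- homomorphism. A plethysm is the case where ρ k is p_k of the substituted expression.
  evaluate : Λ.Sum → Sum
  evaluate = foldr (λ (c , ms) acc → scale c (monomial ms) ++ acc) []

  pair-evaluate : ∀ F φ → pair (evaluate F) φ K.≈ Λ.pair F (λ ms → pair (monomial ms) φ)
  pair-evaluate [] φ = K.refl
  pair-evaluate ((c , ms) ∷ F) φ = K.trans (pair-++ (scale c (monomial ms)) (evaluate F) φ) (K.+-cong (pair-scale c (monomial ms) φ) (pair-evaluate F φ))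

  evaluate-++ : ∀ F G → evaluate (F ++ G) ≈ evaluate F + evaluate G
  evaluate-++ [] G = refl
  evaluate-++ ((c , ms) ∷ F) G = trans (+-congˡ {scale c (monomial ms)} (evaluate-++ F G)) (sym (+-assoc (scale c (monomial ms)) (evaluate F) (evaluate G)))

  evaluate-term : ∀ c ms G → evaluate (Λ.timesTerm (c , ms) G) ≈ scale c (monomial ms) * evaluate G
  evaluate-term c ms [] = sym (zeroʳ (scale c (monomial ms)))
  evaluate-term c ms ((d , ns) ∷ G) = trans (+-cong {scale (c K.* d) (monomial (ms ++ ns))} {scale c (monomial ms) * scale d (monomial ns)} (begin
      scale (c K.* d) (monomial (ms ++ ns))                       ≈⟨ C.scale-constant (c K.* d) (monomial (ms ++ ns)) ⟩
      C.constant (c K.* d) * monomial (ms ++ ns)                       ≈⟨ *-cong {C.constant (c K.* d)} {C.constant c * C.constant d} {monomial (ms ++ ns)} {monomial ms * monomial ns} (C.constant-* c d) (monomial-++ ms ns) ⟩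
      (C.constant c * C.constant d) * (monomial ms * monomial ns)           ≈⟨ interchange (C.constant c) (C.constant d) (monomial ms) (monomial ns) ⟩
      (C.constant c * monomial ms) * (C.constant d * monomial ns)           ≈⟨ *-cong {scale c (monomial ms)} {C.constant c * monomial ms} {scale d (monomial ns)} (C.scale-constant c (monomial ms)) (C.scale-constant d (monomial ns)) ⟨
      scale c (monomial ms) * scale d (monomial ns)               ∎)
    (evaluate-term c ms G)) (sym (distribˡ (scale c (monomial ms)) (scale d (monomial ns)) (evaluate G)))
    where open import Relation.Binary.Reasoning.Setoid setoid

  evaluate-· : ∀ F G → evaluate (F Λ.· G) ≈ evaluate F * evaluate G
  evaluate-· [] G = sym (zeroˡ (evaluate G))
  evaluate-· ((c , ms) ∷ F) G = trans (evaluate-++ (Λ.timesTerm (c , ms) G) (F Λ.· G)) (trans (+-cong {evaluate (Λ.timesTerm (c , ms) G)} {scale c (monomial ms) * evaluate G} {evaluate (F Λ.· G)} {evaluate F * evaluate G} (evaluate-term c ms G) (evaluate-· F G))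
    (sym (distribʳ (evaluate G) (scale c (monomial ms)) (evaluate F))))

  evaluate-hom : Hom Λ.algebra algebra
  evaluate-hom = record
    { fun = evaluate
    ; cong = λ {F} {G} e → agree λ φ → K.trans (pair-evaluate F (on φ)) (K.trans
        (Λ.under e (record { on = λ ms → pair (monomial ms) (on φ) ; on-cong = λ p → under (monomial-↭ p) φ })) (K.sym (pair-evaluate G (on φ))))
    ; +-homo = evaluate-++
    ; *-homo = evaluate-·
    ; 1-homo = agree λ φ → K.+-congʳ (K.*-congʳ (K.*-identityʳ _)) }

  evaluate-p : ∀ c k → evaluate ((c , k ∷ []) ∷ []) ≈ C.constant c * ρ k
  evaluate-p c k = trans (+-identityʳ (scale c (monomial (k ∷ [])))) (trans (C.scale-constant c (monomial (k ∷ []))) (*-congˡ {C.constant c} (*-identityʳ (ρ k))))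

-- Laurent polynomials in z over symmetric functions

module Laurent (K : CommutativeRing 0ℓ 0ℓ) where
  private module K = CommutativeRing K
  module Λ = MonoidAlgebra K multisets
  module R = MonoidAlgebra K monomials
  module Λr = CommutativeRing Λ.algebra
  module Rr = CommutativeRing R.algebra

  coefficient : ℤ → R.Sum → Λ.Sum
  coefficient v [] = []
  coefficient v ((c , e , ms) ∷ r) = if does (e ℤ.≟ v) then (c , ms) ∷ coefficient v r else coefficient v r

  pair-coefficient : ∀ v r φ → Λ.pair (coefficient v r) φ K.≈ R.pair r (λ (e , ms) → if does (e ℤ.≟ v) then φ ms else K.0#)
  pair-coefficient v [] φ = K.refl
  pair-coefficient v ((c , e , ms) ∷ r) φ with does (e ℤ.≟ v)
  ... | true = K.+-congˡ (pair-coefficient v r φ)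
  ... | false = K.trans (pair-coefficient v r φ) (K.sym (K.trans (K.+-congʳ (K.zeroʳ c)) (K.+-identityˡ _)))

  coefficient-cong : ∀ v {r w} → r R.≈ₛ w → coefficient v r Λ.≈ₛ coefficient v w
  coefficient-cong v {r} {w} e = Λ.agree λ φ → K.trans (pair-coefficient v r _) (K.trans
    (R.under e (record { on = λ (e , ms) → if does (e ℤ.≟ v) then Λ.on φ ms else K.0# ; on-cong = λ { (≡.refl , p) → if-cong p φ } }))
    (K.sym (pair-coefficient v w _)))
    where
    if-cong : ∀ {b ms ns} → ms ↭ ns → ∀ φ → (if b then Λ.on φ ms else K.0#) K.≈ (if b then Λ.on φ ns else K.0#)
    if-cong {true} p φ = Λ.on-cong φ p
    if-cong {false} p φ = K.refl

  coefficient-++ : ∀ v r w → coefficient v (r ++ w) Λr.≈ coefficient v r Λr.+ coefficient v w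
  coefficient-++ v r w = Λ.agree λ φ → K.trans (pair-coefficient v (r ++ w) _) (K.trans (R.pair-++ r w _)
    (K.sym (K.trans (Λ.pair-++ (coefficient v r) _ _) (K.+-cong (pair-coefficient v r _) (pair-coefficient v w _)))))

  coefficient-scale : ∀ v k r → coefficient v (R.scale k r) Λr.≈ Λ.scale k (coefficient v r)
  coefficient-scale v k r = Λ.agree λ φ → K.trans (pair-coefficient v (R.scale k r) _) (K.trans (R.pair-scale k r _)
    (K.sym (K.trans (Λ.pair-scale k (coefficient v r) _) (K.*-congˡ (pair-coefficient v r _)))))

  -- The coefficient of z^v in r · Σ_e g(e) z^e.
  extract : (ℤ → Λ.Sum) → ℤ → R.Sum → Λ.Sum
  extract g v [] = []
  extract g v ((c , e , ms) ∷ r) = Λ.timesTerm (c , ms) (g (v ℤ.- e)) ++ extract g v r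

  pair-extract : ∀ g v r φ → Λ.pair (extract g v r) φ K.≈ R.pair r (λ (e , ms) → Λ.pair (g (v ℤ.- e)) (λ ns → φ (ms ++ ns)))
  pair-extract g v [] φ = K.refl
  pair-extract g v ((c , e , ms) ∷ r) φ = K.trans (Λ.pair-++ (Λ.timesTerm (c , ms) (g (v ℤ.- e))) _ φ)
    (K.+-cong (Λ.pair-timesTerm c ms (g (v ℤ.- e)) φ) (pair-extract g v r φ))

  extract-functional : (ℤ → Λ.Sum) → ℤ → Λ.Functional → R.Functional
  extract-functional g v φ = record
    { on = λ (e , ms) → Λ.pair (g (v ℤ.- e)) (λ ns → Λ.on φ (ms ++ ns))
    ; on-cong = λ { {e , ms} (≡.refl , p) → Λ.pair-cong (g (v ℤ.- e)) (λ ns → Λ.on-cong φ (↭.++⁺ʳ ns p)) } }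

  extract-cong : ∀ g v {r w} → r R.≈ₛ w → extract g v r Λ.≈ₛ extract g v w
  extract-cong g v {r} {w} e = Λ.agree λ φ → K.trans (pair-extract g v r _) (K.trans (R.under e (extract-functional g v φ)) (K.sym (pair-extract g v w _)))

  extract-++ : ∀ g v r w → extract g v (r ++ w) Λr.≈ extract g v r Λr.+ extract g v w
  extract-++ g v r w = Λ.agree λ φ → K.trans (pair-extract g v (r ++ w) _) (K.trans (R.pair-++ r w _)
    (K.sym (K.trans (Λ.pair-++ (extract g v r) _ _) (K.+-cong (pair-extract g v r _) (pair-extract g v w _)))))

  extract-negate : ∀ g v r → extract g v (R.negate r) Λr.≈ Λr.- extract g v r
  extract-negate g v r = Λ.agree λ φ → K.trans (pair-extract g v (R.negate r) _) (K.trans (R.pair-negate r _)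
    (K.sym (K.trans (Λ.pair-negate (extract g v r) _) (K.-‿cong (pair-extract g v r _)))))

  extract-1 : ∀ g v → extract g v Rr.1# Λr.≈ g v
  extract-1 g v = Λ.agree λ φ → K.trans (pair-extract g v Rr.1# _) (K.trans (K.+-identityʳ _) (K.trans (K.*-identityˡ _)
    (K.reflexive (≡.cong (λ i → Λ.pair (g i) (Λ.on φ)) (ℤ.+-identityʳ v)))))

  coefficient-· : ∀ v r w → coefficient v (r R.· w) Λr.≈ extract (λ e → coefficient e w) v r
  coefficient-· v r w = Λ.agree λ φ → K.trans (pair-coefficient v (r R.· w) _) (K.trans (R.pair-· r w _)
    (K.trans (R.pair-cong r (λ (e , ms) → K.trans (R.pair-cong w (λ (f , ns) → K.reflexive (≡.cong (if_then Λ.on φ (ms ++ ns) else K.0#) (moved e f))))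
      (K.sym (pair-coefficient (v ℤ.- e) w _)))) (K.sym (pair-extract _ v r _))))
    where
    moved : ∀ e f → does (e ℤ.+ f ℤ.≟ v) ≡ does (f ℤ.≟ v ℤ.- e)
    moved e f with e ℤ.+ f ℤ.≟ v | f ℤ.≟ v ℤ.- e
    ... | yes _ | yes _ = ≡.refl
    ... | no _ | no _ = ≡.refl
    ... | yes p | no q = contradiction (≡.trans (≡.sym (≡.trans (≡.cong (λ i → i ℤ.+ f) (ℤ.+-inverseˡ e)) (ℤ.+-identityˡ f)))
            (≡.trans (ℤ.+-assoc (ℤ.- e) e f) (≡.trans (≡.cong (λ i → ℤ.- e ℤ.+ i) p) (ℤ.+-comm (ℤ.- e) v)))) q
    ... | no p | yes q = contradiction (≡.trans (≡.cong (λ i → e ℤ.+ i) (≡.trans q (ℤ.+-comm v (ℤ.- e))))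
            (≡.trans (≡.sym (ℤ.+-assoc e (ℤ.- e) v)) (≡.trans (≡.cong (λ i → i ℤ.+ v) (ℤ.+-inverseʳ e)) (ℤ.+-identityˡ v)))) p

  embed : Λ.Sum → R.Sum
  embed = map (λ (c , ms) → c , + 0 , ms)

  pair-embed : ∀ F φ → R.pair (embed F) φ K.≈ Λ.pair F (λ ms → φ (+ 0 , ms))
  pair-embed [] φ = K.refl
  pair-embed (_ ∷ F) φ = K.+-congˡ (pair-embed F φ)

  embed-hom : Hom Λ.algebra R.algebra
  embed-hom = record
    { fun = embed
    ; cong = λ {F} {G} e → R.agree λ φ → K.trans (pair-embed F _) (K.trans
        (Λ.under e (record { on = λ ms → R.on φ (+ 0 , ms) ; on-cong = λ p → R.on-cong φ (≡.refl , p) })) (K.sym (pair-embed G _)))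
    ; +-homo = λ F G → Rr.reflexive (List.map-++ _ F G)
    ; *-homo = λ F G → R.agree λ φ → K.trans (pair-embed (F Λ.· G) _) (K.trans (Λ.pair-· F G _) (K.sym (K.trans (R.pair-· (embed F) (embed G) _)
        (K.trans (pair-embed F _) (Λ.pair-cong F (λ m → pair-embed G _))))))
    ; 1-homo = Rr.refl }

  coefficient-embed : ∀ F → coefficient (+ 0) (embed F) ≡ F
  coefficient-embed [] = ≡.refl
  coefficient-embed (_ ∷ F) = ≡.cong (_ ∷_) (coefficient-embed F)

  extract-embed : ∀ g v F r → extract g v (embed F R.· r) Λr.≈ F Λ.· extract g v r
  extract-embed g v F r = Λ.agree λ φ → K.trans (pair-extract g v (embed F R.· r) _) (K.trans (R.pair-· (embed F) r _) (K.trans (pair-embed F _)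
    (K.sym (K.trans (Λ.pair-· F (extract g v r) _) (Λ.pair-cong F (λ m → K.trans (pair-extract g v r _)
      (R.pair-cong r (λ (f , ns) → K.trans (Λ.pair-cong (g (v ℤ.- f)) (λ l → K.reflexive (≡.cong (Λ.on φ) (≡.sym (List.++-assoc m ns l)))))
        (K.reflexive (≡.cong (λ i → Λ.pair (g (v ℤ.- i)) (λ l → Λ.on φ ((m ++ ns) ++ l))) (≡.sym (ℤ.+-identityˡ f))))))))))))

  z⁻¹ : K.Carrier → R.Sum
  z⁻¹ c = (c , -[1+ 0 ] , []) ∷ []

  extract-z⁻¹ : ∀ g v c r → extract g v (z⁻¹ c R.· r) Λr.≈ Λ.scale c (extract g (sucℤ v) r)
  extract-z⁻¹ g v c r = Λ.agree λ φ → K.trans (pair-extract g v (z⁻¹ c R.· r) _) (K.trans (R.pair-· (z⁻¹ c) r _) (K.trans (K.+-identityʳ _)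
    (K.sym (K.trans (Λ.pair-scale c (extract g (sucℤ v) r) _) (K.*-congˡ (K.trans (pair-extract g (sucℤ v) r _)
      (R.pair-cong r (λ (f , ns) → K.reflexive (≡.cong (λ i → Λ.pair (g i) (λ l → Λ.on φ (ns ++ l))) (index f)))))))))) 
    where
    index : ∀ f → sucℤ v ℤ.- f ≡ v ℤ.- (-[1+ 0 ] ℤ.+ f)
    index f = ≡.trans (≡.cong (λ i → i ℤ.- f) (sucℤ≡ v)) (≡.trans (≡.cong (λ i → i ℤ.+ ℤ.- f) (ℤ.+-comm (+ 1) v)) (≡.trans (ℤ.+-assoc v (+ 1) (ℤ.- f))
      (≡.cong (λ i → v ℤ.+ i) (≡.sym (ℤ.neg-distrib-+ -[1+ 0 ] f)))))

-- Integer multiples and Newton recursions under homomorphisms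

module Multiples {A B : CommutativeRing 0ℓ 0ℓ} (f : Hom A B) where
  private
    module A = CommutativeRing A
    module MA = SemiringMult A.semiring
  open CommutativeRing B
  open SemiringMult semiring using () renaming (_×_ to _×′_)
  open SemiringMult semiring using (×-congʳ; ×-comm-*; ×-assoc-*)
  open Hom f renaming (cong to f-cong)
  open Powers B using (power)

  fun-× : ∀ n x → fun (n MA.× x) ≈ n ×′ fun x
  fun-× zero x = 0-homo
  fun-× (suc n) x = trans (+-homo x _) (+-congˡ (fun-× n x))

  fun-power : ∀ c n → power (fun c) n ≈ fun (Powers.power A c n)
  fun-power c zero = sym 1-homo
  fun-power c (suc n) = trans (*-congˡ (fun-power c n)) (sym (*-homo c _))

  module _ (recip : ℕ → A.Carrier) (recip-inverse : ∀ n → (suc n MA.× A.1#) A.* recip n A.≈ A.1#) where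

    recip-× : ∀ n x → suc n ×′ (fun (recip n) * x) ≈ x
    recip-× n x = trans (sym (×-assoc-* (suc n) (fun (recip n)) x)) (trans (*-congʳ (trans (sym (fun-× (suc n) (recip n)))
      (trans (f-cong (A.trans (A.sym (A.trans (MA.×-assoc-* (suc n) A.1# (recip n)) (MA.×-congʳ (suc n) (A.*-identityˡ _)))) (recip-inverse n))) 1-homo))) (*-identityˡ x))

    cancel : ∀ n {x y} → suc n ×′ x ≈ suc n ×′ y → x ≈ y
    cancel n {x} {y} e = trans (sym (recip-× n x)) (trans (×-comm-* (suc n) _ _ ⁻) (trans (*-congˡ e) (trans (×-comm-* (suc n) _ _) (recip-× n y))))
      where
      _⁻ : ∀ {x y} → x ≈ y → y ≈ x
      _⁻ = sym

onℤ : {A : Set} → A → (ℕ → A) → ℤ → A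
onℤ z f (+ n) = f n
onℤ z f -[1+ n ] = z

Newton-push : ∀ {A B : CommutativeRing 0ℓ 0ℓ} (f : Hom A B) →
  let
    module A = CommutativeRing A
    module B = CommutativeRing B
  in
  (cancelA : ∀ n {x y} → SemiringMult._×_ A.semiring (suc n) x A.≈ SemiringMult._×_ A.semiring (suc n) y → x A.≈ y)
  (cancelB : ∀ n {x y} → SemiringMult._×_ B.semiring (suc n) x B.≈ SemiringMult._×_ B.semiring (suc n) y → x B.≈ y) →
  ∀ {P h} → NewtonIdentities.Cancellative.Newton A cancelA P h → NewtonIdentities.Cancellative.Newton B cancelB (λ n → Hom.fun f (P n)) (λ n → Hom.fun f (h n))
Newton-push {A} {B} f cancelA cancelB {P} {h} nh = NB.newton (B.trans (F.cong (NA.initial nh)) F.1-homo) λ n →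
  B.trans (B.sym (Multiples.fun-× f (suc n) (h (suc n)))) (B.trans (F.cong (NA.recursion nh n)) (fun-⊛ P h n))
  where
  module A = CommutativeRing A
  module B = CommutativeRing B
  module F = Hom f
  module NA = NewtonIdentities.Cancellative A cancelA
  module NB = NewtonIdentities.Cancellative B cancelB
  fun-⊛ : ∀ f g n → F.fun (PowerSeries._⊛_ A f g n) B.≈ PowerSeries._⊛_ B (λ i → F.fun (f i)) (λ i → F.fun (g i)) n
  fun-⊛ f g zero = F.*-homo _ _
  fun-⊛ f g (suc n) = B.trans (F.+-homo _ _) (B.+-cong (F.*-homo _ _) (fun-⊛ _ g n))

-- From the coefficient functional to the recursion on rows

module Transfer (A C : CommutativeRing 0ℓ 0ℓ) (embed : Hom A C) where
  private
    module A = CommutativeRing A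
    module C = CommutativeRing C
    module Em = Hom embed
    module PA = Powers A
    module PC = Powers C

  module Cancellative
    (cancelA : ∀ n {x y} → SemiringMult._×_ A.semiring (suc n) x A.≈ SemiringMult._×_ A.semiring (suc n) y → x A.≈ y)
    (cancelC : ∀ n {x y} → SemiringMult._×_ C.semiring (suc n) x C.≈ SemiringMult._×_ C.semiring (suc n) y → x C.≈ y) where
    private
      module NA = NewtonIdentities.Cancellative A cancelA
      module NC = NewtonIdentities.Cancellative C cancelC

    -- A models Λ, C models Λ[z, 1/z], and `T v` takes a coefficient after multiplication by Ω. It
    -- is A-linear, and multiplication by `y` raises its index. The Newton hypotheses give the power
    -- sums: Y_k for h, Y_k + (ay)^k - y^k for h̃, and (1 - b^k)Y_k for ĝ, with b = 1/a.
    module Intertwiner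
      (a b : A.Carrier) (ab : a A.* b A.≈ A.1#) (y : C.Carrier) (Y h ĝ : ℕ → A.Carrier) (h̃ : ℕ → C.Carrier)
      (h-newton : NA.Newton Y h)
      (h̃-newton : NC.Newton (λ n → Em.fun (Y n) C.+ (PC.power (Em.fun a C.* y) (suc n) C.- PC.power y (suc n))) h̃)
      (ĝ-newton : NA.Newton (λ n → Y n A.- PA.power b (suc n) A.* Y n) ĝ)
      (T : ℤ → C.Carrier → A.Carrier)
      (T-cong : ∀ v {x x′} → x C.≈ x′ → T v x A.≈ T v x′)
      (T-+ : ∀ v x x′ → T v (x C.+ x′) A.≈ T v x A.+ T v x′)
      (T-neg : ∀ v x → T v (C.- x) A.≈ A.- T v x)
      (T-embed : ∀ v α x → T v (Em.fun α C.* x) A.≈ α A.* T v x)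
      (T-y : ∀ v x → T v (y C.* x) A.≈ T (sucℤ v) x)
      (T-1 : ∀ v → T v C.1# A.≈ onℤ A.0# ĝ v)
      where

      private
        module SA = AlternatingSums A
        module SC = AlternatingSums C
        module ISA = IntegerSolver A
        module ISC = IntegerSolver C

      hℤA gℤA : ℤ → A.Carrier
      hℤA = onℤ A.0# h
      gℤA = onℤ A.0# ĝ

      h̃ℤ : ℤ → C.Carrier
      h̃ℤ = onℤ C.0# h̃

      -- Both sides have power sums Y_k - y^k.
      h̃-recursion : ∀ n → h̃ (suc n) C.- (Em.fun a C.* y) C.* h̃ n C.≈ Em.fun (h (suc n)) C.- y C.* Em.fun (h n)
      h̃-recursion n = C.trans (C.sym (NC.1-X⊛ α h̃ n)) (C.trans (NC.Newton-unique weights left right (suc n)) (NC.1-X⊛ y (λ i → Em.fun (h i)) n))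
        where
        open ISC
        α : C.Carrier
        α = Em.fun a C.* y
        embedded : NC.Newton (λ n → Em.fun (Y n)) (λ n → Em.fun (h n))
        embedded = Newton-push embed cancelA cancelC h-newton
        left = NC.Newton-⊛ (NC.Newton-1-X α) h̃-newton
        right = NC.Newton-⊛ (NC.Newton-1-X y) embedded
        weights : ∀ n → C.- PC.power α (suc n) C.+ (Em.fun (Y n) C.+ (PC.power α (suc n) C.- PC.power y (suc n))) C.≈ C.- PC.power y (suc n) C.+ Em.fun (Y n)
        weights n = solve 3 (λ p x r → :- p :+ (x :+ (p :- r)) := :- r :+ x) C.refl (PC.power α (suc n)) (Em.fun (Y n)) (PC.power y (suc n))

      h̃ℤ-recursion : ∀ n → h̃ℤ n C.- (Em.fun a C.* y) C.* h̃ℤ (predℤ n) C.≈ Em.fun (hℤA n) C.- y C.* Em.fun (hℤA (predℤ n))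
      h̃ℤ-recursion (+ suc n) = h̃-recursion n
      h̃ℤ-recursion (+ zero) = C.trans (C.+-cong (NC.initial h̃-newton) (C.-‿cong (C.zeroʳ _)))
        (C.sym (C.+-cong (C.trans (Em.cong (NA.initial h-newton)) Em.1-homo) (C.-‿cong (C.trans (C.*-congˡ Em.0-homo) (C.zeroʳ y)))))
      h̃ℤ-recursion -[1+ n ] = C.+-cong (C.sym Em.0-homo) (C.-‿cong (C.trans (C.zeroʳ _) (C.sym (C.trans (C.*-congˡ Em.0-homo) (C.zeroʳ y)))))

      open PA.Inverses a b ab using () renaming (integerPower to pw; integerPower-suc to pw-suc)

      -- Dilation by `a` turns the power sums of ĝ into (a^k - 1)Y_k. Adding those of h leaves a^k
      -- Y_k, the power sums of h dilated by `a`.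
      h-ĝ : ∀ n → SA.geom a (λ i j → hℤA i A.* gℤA j) (+ n) (+ 0) A.≈ pw (+ n) A.* hℤA (+ n)
      h-ĝ n = A.trans (NA.geom-⊛ a hℤA gℤA n 0)
        (NA.Newton-unique weights (NA.Newton-⊛ (NA.Newton-dilate a ĝ-newton) h-newton) (NA.Newton-dilate a h-newton) n)
        where
        open ISA
        weights : ∀ n → PA.power a (suc n) A.* (Y n A.- PA.power b (suc n) A.* Y n) A.+ Y n A.≈ PA.power a (suc n) A.* Y n
        weights n = A.trans (solve 3 (λ p r x → p :* (x :- r :* x) :+ x := p :* x :+ (x :- (p :* r) :* x)) A.refl (PA.power a (suc n)) (PA.power b (suc n)) (Y n))
          (A.trans (A.+-congˡ (A.trans (A.+-congˡ (A.-‿cong (A.trans (A.*-congʳ (PA.power-inverse ab (suc n))) (A.*-identityˡ _)))) (A.-‿inverseʳ _))) (A.+-identityʳ _))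

      torsion-free : ∀ {x} → x A.≈ A.- x → x A.≈ A.0#
      torsion-free {x} e = cancelA 1 (A.trans (A.+-congˡ (A.+-identityʳ x)) (A.trans (A.+-congˡ e) (A.trans (A.-‿inverseʳ x)
        (A.sym (A.trans (A.+-identityˡ _) (A.+-identityˡ A.0#))))))

      open VertexOperator.Rows A torsion-free a b ab hℤA gℤA (λ n → A.refl) (λ n → A.refl) (NA.initial h-newton) (NA.initial ĝ-newton)
        pw A.refl pw-suc h-ĝ public using (rows; τ-zeros)

      private
        module SchurA = SA.Schur hℤA
        module SchurC = SC.Schur h̃ℤ

      T-alt : ∀ v {s p n} (β : Vec ℤ n) {m} F → T v (SC.alt s p β m F) A.≈ SA.alt s p β m (λ k γ → T v (F k γ))
      T-alt v [] F = A.refl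
      T-alt v (c ∷ β) F = A.trans (T-+ v _ _) (A.+-cong (T-alt v β _) (A.trans (T-neg v _) (A.-‿cong (T-alt v β _))))

      -- Applied to `h̃ℤ-recursion` times `x`, the linear functional turns each factor `y` into an
      -- index shift, which is the recursion characterising `quot`.
      T-h̃ : ∀ x n v → T v (h̃ℤ n C.* x) A.≈ SA.quot a (λ i j → hℤA i A.* T j x) n v
      T-h̃ x = SA.quot-unique (λ n v → A.zeroˡ _) (λ n v → T v (h̃ℤ n C.* x)) negative recursion
        where
        T-- : ∀ v x x′ → T v (x C.- x′) A.≈ T v x A.- T v x′
        T-- v x x′ = A.trans (T-+ v _ _) (A.+-congˡ (T-neg v _))
        T-0 : ∀ v → T v C.0# A.≈ A.0#
        T-0 v = A.trans (T-cong v (C.sym (C.trans (C.*-congʳ Em.0-homo) (C.zeroˡ C.0#)))) (A.trans (T-embed v A.0# C.0#) (A.zeroˡ _))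
        negative : SA.NegZero (λ n v → T v (h̃ℤ n C.* x))
        negative n v = A.trans (T-cong v (C.zeroˡ x)) (T-0 v)
        recursion : ∀ n v → T v (h̃ℤ n C.* x) A.- a A.* T (sucℤ v) (h̃ℤ (predℤ n) C.* x) A.≈ hℤA n A.* T v x A.- hℤA (predℤ n) A.* T (sucℤ v) x
        recursion n v = begin
          T v (h̃ℤ n C.* x) A.- a A.* T (sucℤ v) (h̃ℤ (predℤ n) C.* x)
            ≈⟨ A.+-congˡ (A.-‿cong (A.trans (T-embed v a _) (A.*-congˡ (T-y v _)))) ⟨
          T v (h̃ℤ n C.* x) A.- T v (Em.fun a C.* (y C.* (h̃ℤ (predℤ n) C.* x)))
            ≈⟨ T-- v _ _ ⟨
          T v (h̃ℤ n C.* x C.- Em.fun a C.* (y C.* (h̃ℤ (predℤ n) C.* x)))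
            ≈⟨ T-cong v (C.trans (solve 5 (λ p x a y q → p :* x :- a :* (y :* (q :* x)) := (p :- (a :* y) :* q) :* x) C.refl (h̃ℤ n) x (Em.fun a) y (h̃ℤ (predℤ n)))
                 (C.trans (C.*-congʳ (h̃ℤ-recursion n)) (solve 4 (λ p x y q → (p :- y :* q) :* x := p :* x :- y :* (q :* x)) C.refl (Em.fun (hℤA n)) x y (Em.fun (hℤA (predℤ n)))))) ⟩
          T v (Em.fun (hℤA n) C.* x C.- y C.* (Em.fun (hℤA (predℤ n)) C.* x))
            ≈⟨ A.trans (T-- v _ _) (A.+-cong (T-embed v _ _) (A.-‿cong (A.trans (T-y v _) (T-embed (sucℤ v) _ _)))) ⟩
          hℤA n A.* T v x A.- hℤA (predℤ n) A.* T (sucℤ v) x ∎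
          where
          open import Relation.Binary.Reasoning.Setoid A.setoid
          open ISC

      τ : ∀ {n} → ℤ → Vec ℤ n → A.Carrier
      τ v β = T v (SchurC.schur↑ β)

      τ-∷ : ∀ {n} v m (β : Vec ℤ n) → τ v (m ∷ β) A.≈ SA.alt sucℤ predℤ β m (λ k γ → SA.quot a (λ i j → hℤA i A.* τ j γ) k v)
      τ-∷ v m β = A.trans (T-alt v β _) (SA.alt-cong β (λ k γ → T-h̃ (SchurC.schur↑ γ) k v))

      schur↑-zeros : ∀ M {n} (β : Vec ℤ n) → SchurC.schur↑ (zeros M β) C.≈ SchurC.schur↑ β
      schur↑-zeros zero β = C.refl
      schur↑-zeros (suc M) β = C.trans (SC.alt-pred-+0 (zeros M β) (λ n γ → C.zeroˡ _))
        (C.trans (C.*-congʳ (NC.initial h̃-newton)) (C.trans (C.*-identityˡ _) (schur↑-zeros M β)))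

      -- The sum `rows` for rows listed from the top: each row passed contributes a factor 1/a, and
      -- the first row starts with one such factor.
      forward : ∀ {n} → ℤ → Vec ℤ n → (Vec ℤ n → A.Carrier) → A.Carrier
      forward v [] F = A.0#
      forward v (c ∷ β) F = (a A.- A.1#) A.* (b A.* pw c) A.* F (c ℤ.+ v ∷ β) A.+ b A.* forward v β (λ γ → F (c ∷ γ))

      forward-cong : ∀ {n} v (β : Vec ℤ n) {F G} → (∀ γ → F γ A.≈ G γ) → forward v β F A.≈ forward v β G
      forward-cong v [] e = A.refl
      forward-cong v (c ∷ β) e = A.+-cong (A.*-congˡ (e _)) (A.*-congˡ (forward-cong v β (λ γ → e _)))

      rows-∷ʳ : ∀ {n} v (β : Vec ℤ n) c f → rows v (β ∷ʳ c) f A.≈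
        (a A.- A.1#) A.* (b A.* pw c) A.* f (β ∷ʳ (c ℤ.+ v)) A.+ b A.* rows v β (λ γ → f (γ ∷ʳ c))
      rows-∷ʳ v [] c f = A.+-cong (A.*-congʳ (A.*-congˡ (A.*-congˡ (A.*-identityʳ _)))) (A.sym (A.zeroʳ b))
      rows-∷ʳ v (d ∷ β) c f = A.trans (A.+-congˡ (rows-∷ʳ v β c _))
        (solve 7 (λ u b p n x y z → u :* (b :* (p :* (b :* n))) :* x :+ (y :+ b :* z) := y :+ b :* (u :* (b :* (p :* n)) :* x :+ z)) A.refl _ _ _ _ _ _ _)
        where open ISA

      rows-reverse : ∀ {n} v (β : Vec ℤ n) f → rows v (Vec.reverse β) f A.≈ forward v β (λ γ → f (Vec.reverse γ))
      rows-reverse v [] f = A.refl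
      rows-reverse v (c ∷ β) f = A.trans (A.reflexive (≡.cong (λ γ → rows v γ f) (Vec.reverse-∷ c β))) (A.trans (rows-∷ʳ v (Vec.reverse β) c f)
        (A.+-cong (A.*-congˡ (A.reflexive (≡.cong f (≡.sym (Vec.reverse-∷ (c ℤ.+ v) β)))))
          (A.*-congˡ (A.trans (rows-reverse v β _) (forward-cong v β (λ γ → A.reflexive (≡.cong f (≡.sym (Vec.reverse-∷ c γ)))))))))

      -- Appending zero rows leaves the Schur function on the left unchanged, so it may be expanded
      -- with `M` of them. There must be enough to kill the remainder, and on the right they
      -- reappear as rows that can be raised.
      transfer : ∀ v M (μ : List ℕ) → suc v ℕ.≤ M →
        T (+ suc v) (SchurC.schur↓ (toVec μ)) A.≈ forward (+ suc v) (toVec (μ List.++ replicate M 0)) SchurA.schur↓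
      transfer v M μ v<M = begin
        T (+ suc v) (SchurC.schur↓ (toVec μ))
          ≈⟨ T-cong _ (C.sym (C.trans (schur↑-zeros M β) (C.trans (SchurC.schur↑-reverse β) (C.reflexive (≡.cong SchurC.schur↓ (Vec.reverse-involutive (toVec μ))))))) ⟩
        τ (+ suc v) (zeros M β)
          ≈⟨ τ-zeros τ T-1 τ-∷ M β v v<M ⟩
        rows (+ suc v) (zeros M β) SchurA.schur↑
          ≡⟨ ≡.cong (λ γ → rows (+ suc v) γ SchurA.schur↑) (≡.sym (Vec.reverse-involutive (zeros M β))) ⟩
        rows (+ suc v) (Vec.reverse (Vec.reverse (zeros M β))) SchurA.schur↑
          ≈⟨ rows-reverse (+ suc v) (Vec.reverse (zeros M β)) SchurA.schur↑ ⟩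
        forward (+ suc v) (Vec.reverse (zeros M β)) (λ γ → SchurA.schur↑ (Vec.reverse γ))
          ≈⟨ forward-cong (+ suc v) (Vec.reverse (zeros M β)) (λ γ → A.trans (SchurA.schur↑-reverse (Vec.reverse γ)) (A.reflexive (≡.cong SchurA.schur↓ (Vec.reverse-involutive γ)))) ⟩
        forward (+ suc v) (Vec.reverse (zeros M β)) SchurA.schur↓
          ≡⟨ ≡.cong (λ (n , γ) → forward (+ suc v) γ SchurA.schur↓) (reverse-zeros M μ) ⟩
        forward (+ suc v) (toVec (μ List.++ replicate M 0)) SchurA.schur↓ ∎
        where
        open import Relation.Binary.Reasoning.Setoid A.setoid
        β : Vec ℤ (List.length μ)
        β = Vec.reverse (toVec μ)

      total : List A.Carrier → A.Carrier
      total = List.foldr A._+_ A.0#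

      total-cong : ∀ n {f g} → (∀ i → f i A.≈ g i) → total (applyUpTo f n) A.≈ total (applyUpTo g n)
      total-cong zero e = A.refl
      total-cong (suc n) e = A.+-cong (e 0) (total-cong n (λ i → e (suc i)))

      total-* : ∀ n c f → total (applyUpTo (λ i → c A.* f i) n) A.≈ c A.* total (applyUpTo f n)
      total-* zero c f = A.sym (A.zeroʳ c)
      total-* (suc n) c f = A.trans (A.+-congˡ (total-* n c (λ i → f (suc i)))) (A.sym (A.distribˡ c _ _))

      forward-total : ∀ v L (f : Vecℤ → A.Carrier) → forward (+ v) (toVec L) (λ γ → f (_ , γ)) A.≈
        total (applyUpTo (λ i → (a A.- A.1#) A.* (PA.power b (suc i) A.* PA.power a (at i L)) A.* f (_ , toVec (addAt i v L))) (List.length L))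
      forward-total v List.[] f = A.refl
      forward-total v (x List.∷ L) f = A.+-cong
        (A.*-congʳ (A.*-congˡ (A.*-congʳ (A.sym (A.*-identityʳ b)))))
        (A.trans (A.*-congˡ (forward-total v L (λ γ → f (+ x ∷′ γ)))) (A.trans (A.sym (total-* (List.length L) b _))
          (total-cong (List.length L) (λ i → solve 5 (λ b u p r s → b :* (u :* (p :* r) :* s) := u :* ((b :* p) :* r) :* s) A.refl b (a A.- A.1#) (PA.power b (suc i)) (PA.power a (at i L)) (f (+ x ∷′ (_ , toVec (addAt i v L))))))))
        where open ISA

-- Jacobi-Trudi determinants and complete functions in recursive form

module Recursions (R : CommutativeRing 0ℓ 0ℓ) where
  open CommutativeRing R hiding (zero)

  -- Sign changes are realised as multiplication by -1, which agrees with the negation of the ring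
  -- only up to its equality; hence the separate parameter.
  module Signed (opposite : Carrier → Carrier) (opposite≈ : ∀ x → opposite x ≈ - x) where
    open IntegerSolver R
    open Determinants R
    open PowerSeries R using (_⊛_)

    total : List Carrier → Carrier
    total = foldr _+_ 0#

    signed : ℕ → Carrier → Carrier
    signed j x = if does (j ℕ.% 2 ℕ.≟ 0) then x else opposite x

    signed≈ : ∀ j x → signed j x ≈ sign j * x
    signed≈ zero x = sym (*-identityˡ x)
    signed≈ (suc zero) x = trans (opposite≈ x) (solve 1 (λ x → :- x := (:- con (+ 1)) :* x) refl x)
    signed≈ (suc (suc j)) x = trans (signed≈ j x) (*-congʳ (solve 1 (λ x → x := :- (:- x)) refl (sign j)))

    cofactors : ℕ → (ℕ → ℕ → Carrier) → Carrier
    cofactors zero M = 1#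
    cofactors (suc n) M = total (applyUpTo (λ j → signed j (M 0 j * cofactors n (λ i k → M (suc i) (skip j k)))) (suc n))

    total-sum : ∀ n f → total (applyUpTo f n) ≈ sum< n f
    total-sum zero f = sym (sum<-zero f)
    total-sum (suc n) f = trans (+-congˡ (total-sum n (λ j → f (suc j)))) (sym (sum<-suc n f))

    rowVec : ∀ n → (ℕ → ℕ → Carrier) → Vec Row n
    rowVec zero M = []
    rowVec (suc n) M = M 0 ∷ rowVec n (λ i → M (suc i))

    dropColumn-rowVec : ∀ j n M → dropColumn j (rowVec n M) ≡ rowVec n (λ i k → M i (skip j k))
    dropColumn-rowVec j zero M = ≡.refl
    dropColumn-rowVec j (suc n) M = ≡.cong (_ ∷_) (dropColumn-rowVec j n (λ i → M (suc i)))

    cofactors≈ : ∀ n M → cofactors n M ≈ determinant (rowVec n M)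
    cofactors≈ zero M = refl
    cofactors≈ (suc n) M = trans (total-sum (suc n) _) (sum<-cong (suc n) (λ j _ → trans (signed≈ j _)
      (*-congˡ (*-congˡ (trans (cofactors≈ n _) (reflexive (≡.cong determinant (≡.sym (dropColumn-rowVec j n (λ i → M (suc i)))))))))))

    module _ (h : ℤ → Carrier) where
      open AlternatingSums.Schur R h using (schur↓)

      jacobiTrudiMatrix : List ℕ → ℕ → ℕ → Carrier
      jacobiTrudiMatrix lam i j = h ((+ at i lam) ℤ.- (+ i) ℤ.+ (+ j))

      schurDet : List ℕ → Carrier
      schurDet lam = cofactors (length lam) (jacobiTrudiMatrix lam)

      hRow-+ : ∀ c j → hRow h c j ≡ h (c ℤ.+ + j)
      hRow-+ c zero = ≡.cong h (≡.sym (ℤ.+-identityʳ c))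
      hRow-+ c (suc j) = ≡.trans (hRow-+ (sucℤ c) j) (≡.cong h (≡.trans (sucℤ-+ c (+ j)) (≡.sym (+-sucℤ c (+ j)))))

      -- Here `s` is the number of rows already passed. `hRows` accounts for it by composing one
      -- more `predℤ` per row, the matrix by subtracting the row number.
      matrix-rows : ∀ lam s (f : ℤ → ℤ) → (∀ x → f x ≡ x ℤ.- + s) →
        Rows≈ (rowVec (length lam) (λ i j → h ((+ at i lam) ℤ.- (+ (s ℕ.+ i)) ℤ.+ (+ j)))) (hRows h f (toVec lam))
      matrix-rows [] s f e = []
      matrix-rows (x ∷ lam) s f e =
        (λ j → reflexive (≡.trans (≡.cong (λ k → h ((+ x) ℤ.- (+ k) ℤ.+ (+ j))) (ℕ.+-identityʳ s)) (≡.trans (≡.cong (λ c → h (c ℤ.+ + j)) (≡.sym (e (+ x)))) (≡.sym (hRow-+ (f (+ x)) j)))))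
        ∷ ≡.subst (λ g → Rows≈ (rowVec (length lam) g) (hRows h (λ z → predℤ (f z)) (toVec lam))) ≡.refl
            (Pointwise.trans (λ p q k → trans (p k) (q k)) (shift (length lam) lam) (matrix-rows lam (suc s) (λ z → predℤ (f z)) pred-f))
        where
        pred≡ : ∀ i → predℤ i ≡ i ℤ.- + 1
        pred≡ (+ zero) = ≡.refl
        pred≡ (+ suc n) = ≡.refl
        pred≡ -[1+ n ] = ≡.cong (λ k → -[1+ suc k ]) (≡.sym (ℕ.+-identityʳ n))
        pred-f : ∀ z → predℤ (f z) ≡ z ℤ.- + suc s
        pred-f z = ≡.trans (≡.cong predℤ (e z)) (≡.trans (pred≡ (z ℤ.- + s)) (≡.trans (ℤ.+-assoc z (ℤ.- + s) (ℤ.- + 1))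
          (≡.cong (λ i → z ℤ.+ i) (≡.trans (≡.sym (ℤ.neg-distrib-+ (+ s) (+ 1))) (≡.cong (λ k → ℤ.- + k) (ℕ.+-comm s 1))))))
        shift : ∀ n lam′ → Rows≈ (rowVec n (λ i j → h ((+ at i lam′) ℤ.- (+ (s ℕ.+ suc i)) ℤ.+ (+ j)))) (rowVec n (λ i j → h ((+ at i lam′) ℤ.- (+ (suc s ℕ.+ i)) ℤ.+ (+ j))))
        shift n lam′ = rowVec-cong n (λ i j → reflexive (≡.cong (λ k → h ((+ at i lam′) ℤ.- (+ k) ℤ.+ (+ j))) (ℕ.+-suc s i)))
          where
          rowVec-cong : ∀ n {M N} → (∀ i j → M i j ≈ N i j) → Rows≈ (rowVec n M) (rowVec n N)
          rowVec-cong zero e = []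
          rowVec-cong (suc n) e = (λ j → e 0 j) ∷ rowVec-cong n (λ i → e (suc i))

      schurDet≈ : ∀ lam → schurDet lam ≈ schur↓ (toVec lam)
      schurDet≈ lam = trans (cofactors≈ (length lam) (jacobiTrudiMatrix lam)) (trans
        (determinant-cong (matrix-rows lam 0 (λ i → i) (λ x → ≡.sym (ℤ.+-identityʳ x)))) (jacobiTrudi h (toVec lam)))

    module Complete (p : ℕ → Carrier) (divide : ℕ → Carrier → Carrier) where

      completes : ℕ → List Carrier
      completes zero = 1# ∷ []
      completes (suc n) = divide n (total (zipWith (λ k h → p (suc k) * h) (applyUpTo (λ k → k) (suc n)) (completes n))) ∷ completes n

      complete : ℕ → Carrier
      complete zero = 1#
      complete (suc n) = divide n (total (zipWith (λ k h → p (suc k) * h) (applyUpTo (λ k → k) (suc n)) (completes n)))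

      completes-⊛ : ∀ n (w : ℕ → ℕ) → total (zipWith (λ k h → p (suc k) * h) (applyUpTo w (suc n)) (completes n)) ≈ ((λ i → p (suc (w i))) ⊛ complete) n
      completes-⊛ zero w = +-identityʳ _
      completes-⊛ (suc n) w = +-congˡ (completes-⊛ n (λ i → w (suc i)))

-- r k, κ k, σ k and o k stand for 1/(1-q), M[u]_q, -[u]_t and 1 with q replaced by q^k.
module Operators (K : CommutativeRing 0ℓ 0ℓ) (r κ σ o recip invfact : ℕ → CommutativeRing.Carrier K) where
  private module K = CommutativeRing K
  open Laurent K using (module Λ; module R; module Λr; coefficient)

  p : ℕ → Λ.Sum
  p k = (K.1# , k ∷ []) ∷ []

  X/[1-q] E₁ E₂ : ℕ → R.Sum
  X/[1-q] k = (r k , (+ k) ℤ.* + 0 , map (k ℕ.*_) (1 ∷ [])) ∷ []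
  E₁ k = (o k , (+ k) ℤ.* + 0 , map (k ℕ.*_) (1 ∷ [])) ∷ (κ k , (+ k) ℤ.* -[1+ 0 ] , []) ∷ []
  E₂ k = (σ k , (+ k) ℤ.* + 1 , map (k ℕ.*_) (1 ∷ [])) ∷ []

  plethX : Λ.Sum → Λ.Sum
  plethX F = coefficient (+ 0) (Evaluation.evaluate K monomials X/[1-q] F)

  oneR : R.Sum
  oneR = (K.1# , + 0 , []) ∷ []

  powR : R.Sum → ℕ → R.Sum
  powR L zero = oneR
  powR L (suc n) = L R.· powR L n

  logarithm : ℕ → R.Sum
  logarithm N = foldr _++_ [] (applyUpTo (λ k → R.scale (recip k) (E₂ (suc k))) N)

  Ω : ℕ → R.Sum
  Ω N = foldr _++_ [] (applyUpTo (λ n → R.scale (invfact n) (powR (logarithm N) n)) (suc N))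

  degree : Λ.Sum → ℕ
  degree F = sum (map (λ (_ , ms) → sum ms) F)

  D : ℕ → Λ.Sum → Λ.Sum
  D v F = coefficient (+ v) (Evaluation.evaluate K monomials E₁ F R.· Ω (v ℕ.+ degree F))

  opposite : Λ.Sum → Λ.Sum
  opposite = Λ.scale (K.- K.1#)

  opposite≈ : ∀ G → opposite G Λr.≈ Λr.- G
  opposite≈ G = Λr.trans (Constants.scale-constant K multisets (K.- K.1#) G) (-1*x≈-x G)
    where open import Algebra.Properties.Ring Λr.ring using (-1*x≈-x)

  module Rec = Recursions.Signed Λ.algebra opposite opposite≈
  module Com = Rec.Complete p (λ n → Λ.scale (recip n))

  H : ℕ → Λ.Sum
  H = Com.complete

  schur : List ℕ → Λ.Sum
  schur = Rec.schurDet (onℤ [] H)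

  sComp : List ℕ → Λ.Sum
  sComp α = if repeats β then [] else Rec.signed (inversions β) (schur (dropZerosEnd (zipWith _∸_ (sortDesc β) (delta (length α)))))
    where
    β : List ℕ
    β = zipWith ℕ._+_ α (delta (length α))

-- The action of the operator on Schur functions of X/(1-q)

module PlethysticAction (K : CommutativeRing 0ℓ 0ℓ) where
  private
    module K = CommutativeRing K
    module MK = SemiringMult K.semiring
  open Powers K using (power)

  -- `r-κ` and `σ-r` are the identities M[u]_q/(1-q) = (a - 1)t and -[u]_t = q(1 - 1/a)/(1-q) with q
  -- replaced by its powers; through them the quantum integers enter the computation.
  module Parameters
    (q t : K.Carrier) (qt : q K.* t K.≈ K.1#) (u : ℕ)
    (r κ σ o : ℕ → K.Carrier)
    (o-1 : ∀ k → o (suc k) K.≈ K.1#)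
    (r-κ : ∀ k → r (suc k) K.* κ (suc k) K.≈ (power (power q u) (suc k) K.- K.1#) K.* power t (suc k))
    (σ-r : ∀ k → σ (suc k) K.≈ power q (suc k) K.* (K.1# K.- power (power t u) (suc k)) K.* r (suc k))
    (recip invfact : ℕ → K.Carrier)
    (recip-inverse : ∀ n → (suc n MK.× K.1#) K.* recip n K.≈ K.1#)
    (invfact-0 : invfact 0 K.≈ K.1#) (invfact-suc : ∀ m → suc m MK.× invfact (suc m) K.≈ invfact m)
    where
    private
      a b : K.Carrier
      a = power q u
      b = power t u


    open Laurent K
    open Operators K r κ σ o recip invfact
    module CΛ = Constants K multisets
    module CR = Constants K monomials
    module MΛ = Multiples CΛ.constant-hom
    module MR = Multiples CR.constant-hom
    module PΛ = Powers Λ.algebra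
    module PR = Powers R.algebra

    cancelΛ = MΛ.cancel recip recip-inverse
    cancelR = MR.cancel recip recip-inverse

    module NΛ = NewtonIdentities.Cancellative Λ.algebra cancelΛ
    module NR = NewtonIdentities.Cancellative R.algebra cancelR

    -- p_k[X/(1-q)]
    Y : ℕ → Λ.Sum
    Y k = (r k , k ∷ []) ∷ []

    module EvX = Evaluation K monomials X/[1-q]
    module EvY = Evaluation K multisets Y
    module Ev₁ = Evaluation K monomials E₁

    module Em = Hom embed-hom

    X/[1-q]≡ : ∀ k → X/[1-q] k ≡ embed (Y k)
    X/[1-q]≡ k = ≡.cong₂ (λ e m → (r k , e , m ∷ []) ∷ []) (ℤ.*-zeroʳ (+ k)) (ℕ.*-identityʳ k)

    embed-scale : ∀ c F → embed (Λ.scale c F) ≡ R.scale c (embed F)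
    embed-scale c [] = ≡.refl
    embed-scale c (_ ∷ F) = ≡.cong (_ ∷_) (embed-scale c F)

    EvX-monomial : ∀ ms → EvX.monomial ms Rr.≈ embed (EvY.monomial ms)
    EvX-monomial [] = Rr.refl
    EvX-monomial (m ∷ ms) = Rr.trans (Rr.*-cong {X/[1-q] m} {embed (Y m)} {EvX.monomial ms} {embed (EvY.monomial ms)} (Rr.reflexive (X/[1-q]≡ m)) (EvX-monomial ms))
      (Rr.sym (Em.*-homo (Y m) (EvY.monomial ms)))

    scale-cong : ∀ c {r w} → r Rr.≈ w → R.scale c r Rr.≈ R.scale c w
    scale-cong c {r} {w} e = R.agree λ φ → K.trans (R.pair-scale c r _) (K.trans (K.*-congˡ (R.under e φ)) (K.sym (R.pair-scale c w _)))

    EvX-evaluate : ∀ F → EvX.evaluate F Rr.≈ embed (EvY.evaluate F)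
    EvX-evaluate [] = Rr.refl
    EvX-evaluate ((c , ms) ∷ F) = Rr.trans (Rr.+-cong {R.scale c (EvX.monomial ms)} {embed (Λ.scale c (EvY.monomial ms))} {EvX.evaluate F} {embed (EvY.evaluate F)}
        (Rr.trans (scale-cong c (EvX-monomial ms)) (Rr.reflexive (≡.sym (embed-scale c (EvY.monomial ms))))) (EvX-evaluate F))
      (Rr.sym (Em.+-homo (Λ.scale c (EvY.monomial ms)) (EvY.evaluate F)))

    plethX≈ : ∀ F → plethX F Λr.≈ EvY.evaluate F
    plethX≈ F = Λr.trans (coefficient-cong (+ 0) (EvX-evaluate F)) (Λr.reflexive (coefficient-embed (EvY.evaluate F)))

    y : R.Sum
    y = z⁻¹ t

    pair-power-y : ∀ k (φ : R.Functional) → R.pair (PR.power y (suc k)) (R.on φ) K.≈ power t (suc k) K.* R.on φ (-[1+ k ] , [])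
    pair-power-y k φ = K.trans (R.pair-· y (PR.power y k) _) (K.trans (K.+-identityʳ _) (K.trans (K.*-congˡ (rest k)) (K.sym (K.*-assoc _ _ _))))
      where
      rest : ∀ k → R.pair (PR.power y k) (λ (e , ms) → R.on φ (-[1+ 0 ] ℤ.+ e , ms)) K.≈ power t k K.* R.on φ (-[1+ k ] , [])
      rest zero = K.+-identityʳ _
      rest (suc k) = pair-power-y k (R.shiftBy (-[1+ 0 ] , []) φ)

    α : R.Sum
    α = embed (CΛ.constant a)

    pair-power-αy : ∀ k (φ : R.Functional) → R.pair (PR.power (α R.· y) (suc k)) (R.on φ) K.≈ power a (suc k) K.* (power t (suc k) K.* R.on φ (-[1+ k ] , []))
    pair-power-αy k φ = K.trans (R.under (Rr.trans (PR.power-* α y (suc k)) (Rr.*-congʳ {PR.power y (suc k)} (MR.fun-power a (suc k)))) φ)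
      (K.trans (CR.pair-constant (power a (suc k)) (PR.power y (suc k)) φ) (K.*-congˡ (pair-power-y k φ)))

    Θ : Hom Λ.algebra R.algebra
    Θ = Ev₁.evaluate-hom ∘H EvY.evaluate-hom
    module Θ = Hom Θ

    Θ-p : ∀ n → Θ.fun (p (suc n)) Rr.≈ embed (Y (suc n)) Rr.+ (PR.power (α R.· y) (suc n) Rr.- PR.power y (suc n))
    Θ-p n = Rr.trans (Hom.cong Ev₁.evaluate-hom (Λr.trans (EvY.evaluate-p K.1# (suc n)) (Λr.*-identityˡ (Y (suc n)))))
      (Rr.trans (Ev₁.evaluate-p (r (suc n)) (suc n)) (R.agree λ φ → begin
        R.pair (CR.constant (r (suc n)) R.· E₁ (suc n)) (R.on φ)
          ≈⟨ CR.pair-constant (r (suc n)) (E₁ (suc n)) φ ⟩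
        r (suc n) K.* (o (suc n) K.* R.on φ ((+ suc n) ℤ.* + 0 , (suc n ℕ.* 1) ∷ []) K.+ (κ (suc n) K.* R.on φ ((+ suc n) ℤ.* -[1+ 0 ] , []) K.+ K.0#))
          ≈⟨ K.*-congˡ (K.+-cong (K.*-cong (o-1 n) (K.reflexive (≡.cong₂ (λ e m → R.on φ (e , m ∷ [])) (ℤ.*-zeroʳ (+ suc n)) (ℕ.*-identityʳ (suc n)))))
               (K.+-congʳ (K.*-congˡ (K.reflexive (≡.cong (λ e → R.on φ (e , [])) (exponent n)))))) ⟩
        r (suc n) K.* (K.1# K.* x φ K.+ (κ (suc n) K.* w φ K.+ K.0#))
          ≈⟨ solve 4 (λ r x k w → r :* (con (+ 1) :* x :+ (k :* w :+ con (+ 0))) := r :* x :+ (r :* k) :* w) K.refl _ _ _ _ ⟩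
        r (suc n) K.* x φ K.+ (r (suc n) K.* κ (suc n)) K.* w φ
          ≈⟨ K.+-congˡ (K.*-congʳ (r-κ n)) ⟩
        r (suc n) K.* x φ K.+ ((power a (suc n) K.- K.1#) K.* power t (suc n)) K.* w φ
          ≈⟨ K.+-congˡ (solve 3 (λ a t w → ((a :- con (+ 1)) :* t) :* w := a :* (t :* w) :+ :- (t :* w)) K.refl _ _ _) ⟩
        r (suc n) K.* x φ K.+ (power a (suc n) K.* (power t (suc n) K.* w φ) K.+ K.- (power t (suc n) K.* w φ))
          ≈⟨ K.+-congˡ (K.trans (R.pair-++ (PR.power (α R.· y) (suc n)) (R.negate (PR.power y (suc n))) (R.on φ))
               (K.+-cong (pair-power-αy n φ) (K.trans (R.pair-negate (PR.power y (suc n)) (R.on φ)) (K.-‿cong (pair-power-y n φ))))) ⟨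
        R.pair (embed (Y (suc n)) Rr.+ (PR.power (α R.· y) (suc n) Rr.- PR.power y (suc n))) (R.on φ) ∎))
      where
      open import Relation.Binary.Reasoning.Setoid K.setoid
      open IntegerSolver K
      x w : R.Functional → K.Carrier
      x φ = R.on φ (+ 0 , suc n ∷ [])
      w φ = R.on φ (-[1+ n ] , [])
      exponent : ∀ n → (+ suc n) ℤ.* -[1+ 0 ] ≡ -[1+ n ]
      exponent n = ≡.trans (ℤ.*-comm (+ suc n) -[1+ 0 ]) (ℤ.-1*i≡-i (+ suc n))

    Pσ : ℕ → Λ.Sum
    Pσ n = (σ (suc n) , suc n ∷ []) ∷ []

    -- The logarithm of Ω[-z[u]_t X], with the power of z as series index.
    ℓ : ℕ → Λ.Sum
    ℓ zero = []
    ℓ (suc k) = Λ.scale (recip k) (Pσ k)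

    invfactΛ : ℕ → Λ.Sum
    invfactΛ m = CΛ.constant (invfact m)

    module Exp = NΛ.Exponential ℓ Λr.refl invfactΛ
      (λ m → Λr.trans (Λr.sym (MΛ.fun-× (suc m) (invfact (suc m)))) (CΛ.constant-cong (invfact-suc m))) (CΛ.constant-cong invfact-0)

    g : ℕ → Λ.Sum
    g = Exp.exponential

    Newton-cong : ∀ {P Q f} → (∀ n → P n Λr.≈ Q n) → NΛ.Newton P f → NΛ.Newton Q f
    Newton-cong {P} {Q} {f} e nf = NΛ.newton (NΛ.initial nf) λ n → Λr.trans (NΛ.recursion nf n) (PowerSeries.⊛-cong Λ.algebra {P} {Q} {f} {f} e (λ _ → Λr.refl) n)

    g-newton : NΛ.Newton Pσ g
    g-newton = Newton-cong (λ n → Λr.trans (SemiringMult.×-congʳ Λr.semiring (suc n) (CΛ.scale-constant (recip n) (Pσ n))) (MΛ.recip-× recip recip-inverse n (Pσ n))) Exp.Newton-exponential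

    -- Since z = t/y, these are the coefficients of Ω with respect to powers of 1/y.
    ĝ : ℕ → Λ.Sum
    ĝ = NΛ.dilate (CΛ.constant t) g

    pair-constantPower : ∀ c k F (φ : Λ.Functional) → Λ.pair (PΛ.power (CΛ.constant c) k Λ.· F) (Λ.on φ) K.≈ power c k K.* Λ.pair F (Λ.on φ)
    pair-constantPower c k F φ = K.trans (Λ.under (Λr.*-congʳ {F} (MΛ.fun-power c k)) φ) (CΛ.pair-constant (power c k) F φ)

    power-inverse : ∀ n → power t n K.* power q n K.≈ K.1#
    power-inverse = Powers.power-inverse K (K.trans (K.*-comm t q) qt)

    ĝ-newton : NΛ.Newton (λ n → Y (suc n) Λr.- PΛ.power (CΛ.constant b) (suc n) Λ.· Y (suc n)) ĝ
    ĝ-newton = Newton-cong (λ n → Λ.agree λ φ → begin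
        Λ.pair (PΛ.power (CΛ.constant t) (suc n) Λ.· Pσ n) (Λ.on φ)
          ≈⟨ pair-constantPower t (suc n) (Pσ n) φ ⟩
        power t (suc n) K.* (σ (suc n) K.* Λ.on φ (suc n ∷ []) K.+ K.0#)
          ≈⟨ K.*-congˡ (K.+-congʳ (K.*-congʳ (σ-r n))) ⟩
        power t (suc n) K.* (power q (suc n) K.* (K.1# K.- power b (suc n)) K.* r (suc n) K.* Λ.on φ (suc n ∷ []) K.+ K.0#)
          ≈⟨ solve 5 (λ t q b r x → t :* (q :* (con (+ 1) :- b) :* r :* x :+ con (+ 0)) := (t :* q) :* (r :* x :- b :* (r :* x))) K.refl _ _ _ _ _ ⟩
        (power t (suc n) K.* power q (suc n)) K.* (r (suc n) K.* Λ.on φ (suc n ∷ []) K.- power b (suc n) K.* (r (suc n) K.* Λ.on φ (suc n ∷ [])))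
          ≈⟨ K.trans (K.*-congʳ (power-inverse (suc n))) (K.*-identityˡ _) ⟩
        r (suc n) K.* Λ.on φ (suc n ∷ []) K.- power b (suc n) K.* (r (suc n) K.* Λ.on φ (suc n ∷ []))
          ≈⟨ K.+-congˡ (K.trans (Λ.pair-negate (PΛ.power (CΛ.constant b) (suc n) Λ.· Y (suc n)) (Λ.on φ)) (K.-‿cong (K.trans (pair-constantPower b (suc n) (Y (suc n)) φ) (K.*-congˡ (K.+-identityʳ _))))) ⟨
        Λ.pair (Y (suc n) Λr.- PΛ.power (CΛ.constant b) (suc n) Λ.· Y (suc n)) (Λ.on φ) ∎)
      (NΛ.Newton-dilate (CΛ.constant t) g-newton)
      where
      open import Relation.Binary.Reasoning.Setoid K.setoid
      open IntegerSolver K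

    open Powers.Inverses K t q (K.trans (K.*-comm t q) qt) using () renaming (integerPower to tpow; integerPower-suc to tpow-suc)

    T : ℤ → R.Sum → Λ.Sum
    T v x = CΛ.constant (tpow v) Λ.· extract (onℤ [] g) v x

    T-y : ∀ v x → T v (y R.· x) Λr.≈ T (sucℤ v) x
    T-y v x = begin
      CΛ.constant (tpow v) Λ.· extract (onℤ [] g) v (y R.· x)
        ≈⟨ Λr.*-congˡ {CΛ.constant (tpow v)} (Λr.trans (extract-z⁻¹ (onℤ [] g) v t x) (CΛ.scale-constant t (extract (onℤ [] g) (sucℤ v) x))) ⟩
      CΛ.constant (tpow v) Λ.· (CΛ.constant t Λ.· extract (onℤ [] g) (sucℤ v) x)
        ≈⟨ Λr.*-assoc (CΛ.constant (tpow v)) (CΛ.constant t) (extract (onℤ [] g) (sucℤ v) x) ⟨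
      (CΛ.constant (tpow v) Λ.· CΛ.constant t) Λ.· extract (onℤ [] g) (sucℤ v) x
        ≈⟨ Λr.*-congʳ {extract (onℤ [] g) (sucℤ v) x} (Λr.trans (Λr.sym (CΛ.constant-* (tpow v) t)) (CΛ.constant-cong (K.trans (K.*-comm (tpow v) t) (K.sym (tpow-suc v))))) ⟩
      T (sucℤ v) x ∎
      where open import Relation.Binary.Reasoning.Setoid Λr.setoid

    T-embed : ∀ v F x → T v (embed F R.· x) Λr.≈ F Λ.· T v x
    T-embed v F x = Λr.trans (Λr.*-congˡ {CΛ.constant (tpow v)} (extract-embed (onℤ [] g) v F x)) (swap (CΛ.constant (tpow v)) F (extract (onℤ [] g) v x))
      where
      swap : ∀ x y z → x Λ.· (y Λ.· z) Λr.≈ y Λ.· (x Λ.· z)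
      swap x y z = Λr.trans (Λr.sym (Λr.*-assoc x y z)) (Λr.trans (Λr.*-congʳ {z} (Λr.*-comm x y)) (Λr.*-assoc y x z))

    T-neg : ∀ v x → T v (R.negate x) Λr.≈ Λ.negate (T v x)
    T-neg v x = Λr.trans (Λr.*-congˡ {CΛ.constant (tpow v)} (extract-negate (onℤ [] g) v x)) (Λr.sym (-‿distribʳ-* (CΛ.constant (tpow v)) (extract (onℤ [] g) v x)))
      where open import Algebra.Properties.Ring Λr.ring using (-‿distribʳ-*)

    T-1 : ∀ v → T v Rr.1# Λr.≈ onℤ [] ĝ v
    T-1 v = Λr.trans (Λr.*-congˡ {CΛ.constant (tpow v)} (extract-1 (onℤ [] g) v)) (go v)
      where
      go : ∀ v → CΛ.constant (tpow v) Λ.· onℤ [] g v Λr.≈ onℤ [] ĝ v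
      go (+ n) = Λr.*-congʳ {g n} (Λr.sym (MΛ.fun-power t n))
      go -[1+ n ] = Λr.zeroʳ (CΛ.constant (power q (suc n)))

    schur-evaluated : ∀ (f : Hom Λ.algebra R.algebra) (H : ℕ → Λ.Sum) {n} (β : Vec ℤ n) →
      Hom.fun f (AlternatingSums.Schur.schur↓ Λ.algebra (onℤ [] H) β) Rr.≈ AlternatingSums.Schur.schur↓ R.algebra (onℤ [] (λ n → Hom.fun f (H n))) β
    schur-evaluated f H β = Rr.trans (Naturality.schur-natural f (onℤ [] H) β) (schurBy-cong R.algebra pointwise β)
      where
      pointwise : ∀ k → Hom.fun f (onℤ [] H k) Rr.≈ onℤ [] (λ n → Hom.fun f (H n)) k
      pointwise (+ n) = Rr.refl
      pointwise -[1+ n ] = Hom.0-homo f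

    -- If no power of z below -N occurs in a factor, then the coefficient of z^v in its product with
    -- Ω involves only the coefficients of Ω up to degree v + N.
    Bounded : ℕ → R.Sum → Set
    Bounded N = All (λ (c , e , ms) → ℤ.- (+ N) ℤ.≤ e)

    Bounded-≤ : ∀ {M N r} → M ℕ.≤ N → Bounded M r → Bounded N r
    Bounded-≤ le = All.map (ℤ.≤-trans (ℤ.neg-mono-≤ (ℤ.+≤+ le)))

    Bounded-scale : ∀ {N} c {r} → Bounded N r → Bounded N (R.scale c r)
    Bounded-scale c b = All.map⁺ b

    Bounded-· : ∀ {M N r w} → Bounded M r → Bounded N w → Bounded (M ℕ.+ N) (r R.· w)
    Bounded-· [] bw = []
    Bounded-· {M} {N} {(c , e , ms) ∷ r} {w} (be ∷ br) bw = All.++⁺ (All.map⁺ (All.map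
      (λ bf → ℤ.≤-trans (ℤ.≤-reflexive (≡.trans (≡.cong ℤ.-_ (ℤ.pos-+ M N)) (ℤ.neg-distrib-+ (+ M) (+ N)))) (ℤ.+-mono-≤ be bf)) bw)) (Bounded-· br bw)

    Bounded-E₁ : ∀ k → Bounded k (E₁ k)
    Bounded-E₁ k = ℤ.≤-trans (ℤ.neg-mono-≤ (ℤ.+≤+ z≤n)) (ℤ.≤-reflexive (≡.sym (ℤ.*-zeroʳ (+ k))))
      ∷ ℤ.≤-reflexive (≡.sym (≡.trans (ℤ.*-comm (+ k) -[1+ 0 ]) (ℤ.-1*i≡-i (+ k)))) ∷ []

    Bounded-monomial : ∀ ms → Bounded (sum ms) (Ev₁.monomial ms)
    Bounded-monomial [] = ℤ.≤-refl ∷ []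
    Bounded-monomial (m ∷ ms) = Bounded-· (Bounded-E₁ m) (Bounded-monomial ms)

    Bounded-evaluate : ∀ F → Bounded (degree F) (Ev₁.evaluate F)
    Bounded-evaluate [] = []
    Bounded-evaluate ((c , ms) ∷ F) = All.++⁺ (Bounded-≤ (ℕ.m≤m+n (sum ms) (degree F)) (Bounded-scale c (Bounded-monomial ms)))
      (Bounded-≤ (ℕ.m≤n+m (degree F) (sum ms)) (Bounded-evaluate F))

    timesTerm-cong : ∀ c ms {F G} → F Λr.≈ G → Λ.timesTerm (c , ms) F Λr.≈ Λ.timesTerm (c , ms) G
    timesTerm-cong c ms {F} {G} e = Λ.agree λ φ → K.trans (Λ.pair-timesTerm c ms F (Λ.on φ)) (K.trans (K.*-congˡ (Λ.under e (Λ.shiftBy ms φ))) (K.sym (Λ.pair-timesTerm c ms G (Λ.on φ))))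

    extract-Bounded : ∀ G G′ v N r → Bounded N r → (∀ i → i ℕ.≤ v ℕ.+ N → G (+ i) Λr.≈ G′ (+ i)) → (∀ i → G -[1+ i ] Λr.≈ G′ -[1+ i ]) →
      extract G (+ v) r Λr.≈ extract G′ (+ v) r
    extract-Bounded G G′ v N [] [] e e⁻ = Λr.refl
    extract-Bounded G G′ v N ((c , f , ms) ∷ r) (bf ∷ br) e e⁻ =
      Λr.+-cong {Λ.timesTerm (c , ms) (G (+ v ℤ.- f))} {Λ.timesTerm (c , ms) (G′ (+ v ℤ.- f))} {extract G (+ v) r} {extract G′ (+ v) r}
        (timesTerm-cong c ms (agree (+ v ℤ.- f) (ℤ.≤-trans (ℤ.+-monoʳ-≤ (+ v) (ℤ.neg-mono-≤ bf)) (ℤ.≤-reflexive (≡.cong (λ i → + v ℤ.+ i) (ℤ.neg-involutive (+ N)))))))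
        (extract-Bounded G G′ v N r br e e⁻)
      where
      agree : ∀ i → i ℤ.≤ + v ℤ.+ + N → G i Λr.≈ G′ i
      agree (+ i) le = e i (ℤ.drop‿+≤+ le)
      agree -[1+ i ] le = e⁻ i

    concatTerms : (ℕ → Λ.Sum) → ℕ → Λ.Sum
    concatTerms F N = foldr _++_ [] (applyUpTo F N)

    concatTerms-cong : ∀ N {F G} → (∀ k → F k Λr.≈ G k) → concatTerms F N Λr.≈ concatTerms G N
    concatTerms-cong zero e = Λr.refl
    concatTerms-cong (suc N) {F} {G} e = Λr.+-cong {F 0} {G 0} {concatTerms (λ k → F (suc k)) N} {concatTerms (λ k → G (suc k)) N} (e 0) (concatTerms-cong N (λ k → e (suc k)))

    concatTerms-0 : ∀ N {F} → (∀ k → F k Λr.≈ []) → concatTerms F N Λr.≈ []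
    concatTerms-0 zero e = Λr.refl
    concatTerms-0 (suc N) {F} e = Λr.+-cong {F 0} {[]} {concatTerms (λ k → F (suc k)) N} {[]} (e 0) (concatTerms-0 N (λ k → e (suc k)))

    concatTerms-∷ʳ : ∀ N F → concatTerms F (suc N) Λr.≈ concatTerms F N Λr.+ F N
    concatTerms-∷ʳ zero F = Λr.+-identityʳ (F 0)
    concatTerms-∷ʳ (suc N) F = Λr.trans (Λr.+-congˡ {F 0} (concatTerms-∷ʳ N (λ k → F (suc k)))) (Λr.sym (Λr.+-assoc (F 0) (concatTerms (λ k → F (suc k)) N) (F (suc N))))

    extract-concat : ∀ G v (w : ℕ → R.Sum) N → extract G v (foldr _++_ [] (applyUpTo w N)) Λr.≈ concatTerms (λ k → extract G v (w k)) N
    extract-concat G v w zero = Λr.refl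
    extract-concat G v w (suc N) = Λr.trans (extract-++ G v (w 0) _) (Λr.+-congˡ {extract G v (w 0)} (extract-concat G v (λ k → w (suc k)) N))

    coefficient-concat : ∀ v (w : ℕ → R.Sum) N → coefficient v (foldr _++_ [] (applyUpTo w N)) Λr.≈ concatTerms (λ k → coefficient v (w k)) N
    coefficient-concat v w zero = Λr.refl
    coefficient-concat v w (suc N) = Λr.trans (coefficient-++ v (w 0) _) (Λr.+-congˡ {coefficient v (w 0)} (coefficient-concat v (λ k → w (suc k)) N))

    open PowerSeries Λ.algebra using (_⊛_)

    -- Terms with k > n have a negative argument and vanish, so every upper limit `N` beyond n gives
    -- the same Cauchy product.
    convolution : ∀ N (u f : ℕ → Λ.Sum) (G : ℤ → Λ.Sum) n → n ℕ.< N → (∀ i → G -[1+ i ] Λr.≈ []) → (∀ i → i ℕ.≤ n → G (+ i) Λr.≈ f i) →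
      concatTerms (λ k → u k Λ.· G (suc n ℤ.⊖ suc k)) N Λr.≈ (u ⊛ f) n
    convolution (suc N) u f G n (s≤s n≤N) G⁻ Gf = Λr.trans
      (Λr.+-cong {u 0 Λ.· G (suc n ℤ.⊖ 1)} {u 0 Λ.· f n} {concatTerms (λ k → u (suc k) Λ.· G (suc n ℤ.⊖ suc (suc k))) N} {concatTerms (λ k → u (suc k) Λ.· G (n ℤ.⊖ suc k)) N}
        (Λr.*-congˡ {u 0} (Λr.trans (Λr.reflexive (≡.cong G (ℤ.[1+m]⊖[1+n]≡m⊖n n 0))) (Gf n ℕ.≤-refl)))
        (concatTerms-cong N (λ k → Λr.*-congˡ {u (suc k)} (Λr.reflexive (≡.cong G (ℤ.[1+m]⊖[1+n]≡m⊖n n (suc k)))))))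
      (last n n≤N Gf)
      where
      last : ∀ n → n ℕ.≤ N → (∀ i → i ℕ.≤ n → G (+ i) Λr.≈ f i) →
        u 0 Λ.· f n Λr.+ concatTerms (λ k → u (suc k) Λ.· G (n ℤ.⊖ suc k)) N Λr.≈ (u ⊛ f) n
      last zero le Gf = Λr.trans (Λr.+-congˡ {u 0 Λ.· f 0} (concatTerms-0 N (λ k → Λr.trans (Λr.*-congˡ {u (suc k)} (G⁻ k)) (Λr.zeroʳ (u (suc k)))))) (Λr.+-identityʳ (u 0 Λ.· f 0))
      last (suc n) le Gf = Λr.+-congˡ {u 0 Λ.· f (suc n)} (convolution N (λ k → u (suc k)) f G n le G⁻ (λ i i≤n → Gf i (ℕ.m≤n⇒m≤1+n i≤n)))

    extract-log-term : ∀ G v k → extract G v (R.scale (recip k) (E₂ (suc k))) ≡ ℓ (suc k) Λ.· G (v ℤ.- + suc k)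
    extract-log-term G v k = ≡.cong₂ (λ e m → Λ.timesTerm (recip k K.* σ (suc k) , m ∷ []) (G (v ℤ.- e)) ++ []) (ℤ.*-identityʳ (+ suc k)) (ℕ.*-identityʳ (suc k))

    scaleΛ-cong : ∀ c {F G} → F Λr.≈ G → Λ.scale c F Λr.≈ Λ.scale c G
    scaleΛ-cong c {F} {G} e = Λr.trans (CΛ.scale-constant c F) (Λr.trans (Λr.*-congˡ {CΛ.constant c} e) (Λr.sym (CΛ.scale-constant c G)))

    module _ (N : ℕ) where

      -- The truncated logarithm agrees with ℓ up to degree `N`. Because neither factor has negative
      -- powers, agreement up to degree `N` passes to the product.
      coefficient-log : ∀ (w : R.Sum) (f : ℕ → Λ.Sum) → (∀ i → coefficient -[1+ i ] w Λr.≈ []) → (∀ i → i ℕ.≤ N → coefficient (+ i) w Λr.≈ f i) →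
        (∀ i → coefficient -[1+ i ] (logarithm N R.· w) Λr.≈ []) × (∀ i → i ℕ.≤ N → coefficient (+ i) (logarithm N R.· w) Λr.≈ (ℓ ⊛ f) i)
      coefficient-log w f w⁻ wf = negative , nonnegative
        where
        G : ℤ → Λ.Sum
        G e = coefficient e w
        expand : ∀ v → coefficient v (logarithm N R.· w) Λr.≈ concatTerms (λ k → ℓ (suc k) Λ.· G (v ℤ.- + suc k)) N
        expand v = Λr.trans (coefficient-· v (logarithm N) w) (Λr.trans (extract-concat G v (λ k → R.scale (recip k) (E₂ (suc k))) N)
          (concatTerms-cong N (λ k → Λr.reflexive (extract-log-term G v k))))
        vanish : ∀ v → (∀ k → G (v ℤ.- + suc k) Λr.≈ []) → coefficient v (logarithm N R.· w) Λr.≈ []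
        vanish v e = Λr.trans (expand v) (concatTerms-0 N (λ k → Λr.trans (Λr.*-congˡ {ℓ (suc k)} (e k)) (Λr.zeroʳ (ℓ (suc k)))))
        negative : ∀ i → coefficient -[1+ i ] (logarithm N R.· w) Λr.≈ []
        negative i = vanish -[1+ i ] (λ k → w⁻ (suc (i ℕ.+ k)))
        nonnegative : ∀ i → i ℕ.≤ N → coefficient (+ i) (logarithm N R.· w) Λr.≈ (ℓ ⊛ f) i
        nonnegative zero le = vanish (+ 0) (λ k → w⁻ k)
        nonnegative (suc i) le = Λr.trans (expand (+ suc i)) (convolution N (λ k → ℓ (suc k)) f G i le w⁻ (λ j j≤i → wf j (ℕ.≤-trans (ℕ.m≤n⇒m≤1+n j≤i) le)))

      coefficient-powR : ∀ m → (∀ i → coefficient -[1+ i ] (powR (logarithm N) m) Λr.≈ []) × (∀ i → i ℕ.≤ N → coefficient (+ i) (powR (logarithm N) m) Λr.≈ Exp.pow m i)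
      coefficient-powR zero = (λ i → Λr.refl) , λ { zero _ → Λr.refl ; (suc i) _ → Λr.refl }
      coefficient-powR (suc m) = coefficient-log (powR (logarithm N) m) (Exp.pow m) (proj₁ (coefficient-powR m)) (proj₂ (coefficient-powR m))

      partial-concat : ∀ n M → concatTerms (λ m → Λ.scale (invfact m) (Exp.pow m n)) (suc M) Λr.≈ Exp.partial M n
      partial-concat n zero = Λr.trans (concatTerms-∷ʳ 0 (λ m → Λ.scale (invfact m) (Exp.pow m n))) (CΛ.scale-constant (invfact 0) (Exp.pow 0 n))
      partial-concat n (suc M) = Λr.trans (concatTerms-∷ʳ (suc M) (λ m → Λ.scale (invfact m) (Exp.pow m n)))
        (Λr.+-cong {concatTerms (λ m → Λ.scale (invfact m) (Exp.pow m n)) (suc M)} {Exp.partial M n} {Λ.scale (invfact (suc M)) (Exp.pow (suc M) n)} {invfactΛ (suc M) Λ.· Exp.pow (suc M) n}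
          (partial-concat n M) (CΛ.scale-constant (invfact (suc M)) (Exp.pow (suc M) n)))

      coefficient-Ω⁻ : ∀ i → coefficient -[1+ i ] (Ω N) Λr.≈ []
      coefficient-Ω⁻ i = Λr.trans (coefficient-concat -[1+ i ] (λ n → R.scale (invfact n) (powR (logarithm N) n)) (suc N))
        (concatTerms-0 (suc N) (λ k → Λr.trans (coefficient-scale -[1+ i ] (invfact k) (powR (logarithm N) k)) (scaleΛ-cong (invfact k) (proj₁ (coefficient-powR k) i))))

      coefficient-Ω : ∀ i → i ℕ.≤ N → coefficient (+ i) (Ω N) Λr.≈ g i
      coefficient-Ω i le = Λr.trans (coefficient-concat (+ i) (λ n → R.scale (invfact n) (powR (logarithm N) n)) (suc N))
        (Λr.trans (concatTerms-cong (suc N) (λ k → Λr.trans (coefficient-scale (+ i) (invfact k) (powR (logarithm N) k)) (scaleΛ-cong (invfact k) (proj₂ (coefficient-powR k) i le))))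
          (Λr.trans (partial-concat i N) (Exp.partial-≤ le)))

    -- A power sum p_k produces powers of z no lower than -k, so `degree F` bounds the negative
    -- exponents, and truncating Ω at v plus this bound does not affect z^v.
    D-extract : ∀ v F → D v F Λr.≈ extract (onℤ [] g) (+ v) (Ev₁.evaluate F)
    D-extract v F = Λr.trans (coefficient-· (+ v) (Ev₁.evaluate F) (Ω (v ℕ.+ degree F)))
      (extract-Bounded (λ e → coefficient e (Ω (v ℕ.+ degree F))) (onℤ [] g) v (degree F) (Ev₁.evaluate F) (Bounded-evaluate F)
        (λ i le → coefficient-Ω (v ℕ.+ degree F) i le) (coefficient-Ω⁻ (v ℕ.+ degree F)))

    extract-T : ∀ v x → extract (onℤ [] g) (+ v) x Λr.≈ CΛ.constant (power q v) Λ.· T (+ v) x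
    extract-T v x = Λr.sym (Λr.trans (Λr.sym (Λr.*-assoc (CΛ.constant (power q v)) (CΛ.constant (power t v)) (extract (onℤ [] g) (+ v) x)))
      (Λr.trans (Λr.*-congʳ {extract (onℤ [] g) (+ v) x} (Λr.trans (Λr.sym (CΛ.constant-* (power q v) (power t v))) (CΛ.constant-cong (K.trans (K.*-comm _ _) (power-inverse v)))))
        (Λr.*-identityˡ (extract (onℤ [] g) (+ v) x))))

    private
      ab : a K.* b K.≈ K.1#
      ab = K.trans (K.*-comm a b) (power-inverse u)

    H-newton : NΛ.Newton (λ n → p (suc n)) H
    H-newton = NΛ.newton Λr.refl λ n → Λr.trans
      (SemiringMult.×-congʳ Λr.semiring (suc n) (CΛ.scale-constant (recip n) (sums n)))
      (Λr.trans (MΛ.recip-× recip recip-inverse n (sums n)) (Com.completes-⊛ n (λ k → k)))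
      where
      sums : ℕ → Λ.Sum
      sums n = Rec.total (zipWith (λ k h → p (suc k) Λ.· h) (applyUpTo (λ k → k) (suc n)) (Com.completes n))

    h : ℕ → Λ.Sum
    h n = EvY.evaluate (H n)

    h̃ : ℕ → R.Sum
    h̃ n = Θ.fun (H n)

    EvY-p : ∀ n → EvY.evaluate (p (suc n)) Λr.≈ Y (suc n)
    EvY-p n = Λr.trans (EvY.evaluate-p K.1# (suc n)) (Λr.*-identityˡ (Y (suc n)))

    h-newton : NΛ.Newton (λ n → Y (suc n)) h
    h-newton = Newton-cong EvY-p (Newton-push EvY.evaluate-hom cancelΛ cancelΛ H-newton)

    NewtonR-cong : ∀ {P Q f} → (∀ n → P n Rr.≈ Q n) → NR.Newton P f → NR.Newton Q f
    NewtonR-cong {P} {Q} {f} e nf = NR.newton (NR.initial nf) λ n → Rr.trans (NR.recursion nf n) (PowerSeries.⊛-cong R.algebra {P} {Q} {f} {f} e (λ _ → Rr.refl) n)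

    h̃-newton : NR.Newton (λ n → embed (Y (suc n)) Rr.+ (PR.power (α R.· y) (suc n) Rr.- PR.power y (suc n))) h̃
    h̃-newton = NewtonR-cong Θ-p (Newton-push Θ cancelΛ cancelR H-newton)

    module Tr = Transfer.Cancellative.Intertwiner Λ.algebra R.algebra embed-hom cancelΛ cancelR (CΛ.constant a) (CΛ.constant b)
      (Λr.trans (Λr.sym (CΛ.constant-* a b)) (CΛ.constant-cong ab)) y (λ n → Y (suc n)) h ĝ h̃ h-newton h̃-newton ĝ-newton T
      (λ v {x} {x′} e → Λr.*-congˡ {CΛ.constant (tpow v)} (extract-cong (onℤ [] g) v e))
      (λ v x x′ → Λr.trans (Λr.*-congˡ {CΛ.constant (tpow v)} (extract-++ (onℤ [] g) v x x′)) (Λr.distribˡ (CΛ.constant (tpow v)) (extract (onℤ [] g) v x) (extract (onℤ [] g) v x′)))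
      T-neg T-embed T-y T-1

    open AlternatingSums.Schur Λ.algebra (onℤ [] H) using () renaming (schur↓ to schurH)
    open AlternatingSums.Schur Λ.algebra (onℤ [] h) using () renaming (schur↓ to schurh)

    schurh≈ : ∀ {n} (β : Vec ℤ n) → EvY.evaluate (schurH β) Λr.≈ schurh β
    schurh≈ β = Λr.trans (Naturality.schur-natural EvY.evaluate-hom (onℤ [] H) β) (schurBy-cong Λ.algebra pointwise β)
      where
      pointwise : ∀ k → EvY.evaluate (onℤ [] H k) Λr.≈ onℤ [] h k
      pointwise (+ n) = Λr.refl
      pointwise -[1+ n ] = Λr.refl

    D-schur : ∀ v M (μ : List ℕ) S → S Λr.≈ schurH (toVec μ) → suc v ℕ.≤ M →
      D (suc v) (plethX S) Λr.≈ CΛ.constant (power q (suc v)) Λ.· Tr.forward (+ suc v) (toVec (μ ++ replicate M 0)) schurh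
    D-schur v M μ S e v<M = begin
      D (suc v) (plethX S)
        ≈⟨ Λr.trans (D-extract (suc v) (plethX S)) (extract-T (suc v) (Ev₁.evaluate (plethX S))) ⟩
      CΛ.constant (power q (suc v)) Λ.· T (+ suc v) (Ev₁.evaluate (plethX S))
        ≈⟨ Λr.*-congˡ {CΛ.constant (power q (suc v))} (Λr.*-congˡ {CΛ.constant (tpow (+ suc v))} (extract-cong (onℤ [] g) (+ suc v) (Rr.trans
             (Hom.cong Ev₁.evaluate-hom (plethX≈ S)) (Rr.trans (Θ.cong e) (schur-evaluated Θ H (toVec μ)))))) ⟩
      CΛ.constant (power q (suc v)) Λ.· T (+ suc v) (AlternatingSums.Schur.schur↓ R.algebra (onℤ [] h̃) (toVec μ))
        ≈⟨ Λr.*-congˡ {CΛ.constant (power q (suc v))} (Tr.transfer v M μ v<M) ⟩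
      CΛ.constant (power q (suc v)) Λ.· Tr.forward (+ suc v) (toVec (μ ++ replicate M 0)) schurh ∎
      where open import Relation.Binary.Reasoning.Setoid Λr.setoid

    -- Repetition and sorting are accounted for by antisymmetry of the determinant, so s_α is the
    -- Jacobi-Trudi determinant of the unsorted rows.
    sComp≈ : ∀ α → sComp α Λr.≈ schurH (toVec α)
    sComp≈ α = cases (repeats β) ≡.refl
      where
      open Straightening.TorsionFree Λ.algebra Tr.torsion-free
      β lam : List ℕ
      β = zipWith ℕ._+_ α (delta (length α))
      lam = dropZerosEnd (zipWith _∸_ (sortDesc β) (delta (length α)))
      cases : ∀ b → repeats β ≡ b → (if b then [] else Rec.signed (inversions β) (schur lam)) Λr.≈ schurH (toVec α)
      cases true e = Λr.sym (schur↓-repeats (onℤ [] H) (λ n → Λr.refl) Λr.refl α e)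
      cases false e = Λr.trans (Rec.signed≈ (inversions β) (schur lam)) (Λr.trans
        (Λr.*-congˡ {Determinants.sign Λ.algebra (inversions β)} (Rec.schurDet≈ (onℤ [] H) lam))
        (Λr.sym (schur↓-straighten (onℤ [] H) (λ n → Λr.refl) Λr.refl α e)))

    plethX-sComp : ∀ α → plethX (sComp α) Λr.≈ schurh (toVec α)
    plethX-sComp α = Λr.trans (plethX≈ (sComp α)) (Λr.trans (Hom.cong EvY.evaluate-hom (sComp≈ α)) (schurh≈ (toVec α)))

    term : ℕ → List ℕ → ℕ → Λ.Sum
    term v L i = Λ.scale (Powers.Inverses.integerPower K q t qt ((+ (u ℕ.* at i L ℕ.+ v)) ℤ.- (+ (u ℕ.* (i ℕ.+ 1))))) (plethX (sComp (addAt i v L)))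

    rhs : ℕ → List ℕ → ℕ → Λ.Sum
    rhs v L N = Λ.scale (a K.- K.1#) (foldr _++_ [] (applyUpTo (term v L) N))

    D≈rhs : ∀ v M μ → suc v ℕ.≤ M → D (suc v) (plethX (schur μ)) Λr.≈ rhs (suc v) (μ ++ replicate M 0) (length (μ ++ replicate M 0))
    D≈rhs v M μ v<M = begin
      D (suc v) (plethX (schur μ))
        ≈⟨ D-schur v M μ (schur μ) (Rec.schurDet≈ (onℤ [] H) μ) v<M ⟩
      Q Λ.· Tr.forward (+ suc v) (toVec L) schurh
        ≈⟨ Λr.*-congˡ {Q} (Tr.forward-total (suc v) L (λ (n , γ) → schurh γ)) ⟩
      Q Λ.· Tr.total (applyUpTo summand (length L))
        ≈⟨ Tr.total-* (length L) Q summand ⟨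
      Tr.total (applyUpTo (λ i → Q Λ.· summand i) (length L))
        ≈⟨ Tr.total-cong (length L) {λ i → Q Λ.· summand i} {λ i → CΛ.constant (a K.- K.1#) Λ.· term (suc v) L i} compare ⟩
      Tr.total (applyUpTo (λ i → CΛ.constant (a K.- K.1#) Λ.· term (suc v) L i) (length L))
        ≈⟨ Λr.trans (Tr.total-* (length L) (CΛ.constant (a K.- K.1#)) (term (suc v) L)) (Λr.sym (CΛ.scale-constant (a K.- K.1#) (Tr.total (applyUpTo (term (suc v) L) (length L))))) ⟩
      rhs (suc v) L (length L) ∎
      where
      open import Relation.Binary.Reasoning.Setoid Λr.setoid
      L : List ℕ
      L = μ ++ replicate M 0
      Q : Λ.Sum
      Q = CΛ.constant (power q (suc v))
      S : ℕ → Λ.Sum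
      S i = schurh (toVec (addAt i (suc v) L))
      summand : ℕ → Λ.Sum
      summand i = (CΛ.constant a Λr.- Λr.1#) Λ.· (PΛ.power (CΛ.constant b) (suc i) Λ.· PΛ.power (CΛ.constant a) (at i L)) Λ.· S i
      compare : ∀ i → Q Λ.· summand i Λr.≈ CΛ.constant (a K.- K.1#) Λ.· term (suc v) L i
      -- The power q^v from rescaling `T`, the factor b^{i+1} from the row number and a^{μ_i} from
      -- the row length combine into the single power of q in `term`.
      compare i = Monomials.regroup Λ.algebra p {CΛ.constant a Λr.- Λr.1#} {CΛ.constant (a K.- K.1#)} {PΛ.power (CΛ.constant b) (suc i)} {CΛ.constant (power b (suc i))}
        {PΛ.power (CΛ.constant a) (at i L)} {CΛ.constant (power a (at i L))} {Q} {S i} {CΛ.constant e} {term (suc v) L i}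
        (Λr.sym (Λr.trans (CΛ.constant-+ a (K.- K.1#)) (Λr.+-congˡ {CΛ.constant a} (CΛ.constant-neg K.1#))))
        (MΛ.fun-power b (suc i)) (MΛ.fun-power a (at i L))
        (Λr.sym (Λr.trans (CΛ.constant-cong (Powers.Inverses.integerPower-exponent K q t qt u (at i L) (suc v) i))
          (Λr.trans (CΛ.constant-* (power q (suc v)) (power b (suc i) K.* power a (at i L))) (Λr.*-congˡ {Q} (CΛ.constant-* (power b (suc i)) (power a (at i L)))))))
        (Λr.trans (CΛ.scale-constant e (plethX (sComp (addAt i (suc v) L)))) (Λr.*-congˡ {CΛ.constant e} (plethX-sComp (addAt i (suc v) L))))
        where
        e : K.Carrier
        e = Powers.Inverses.integerPower K q t qt ((+ (u ℕ.* at i L ℕ.+ suc v)) ℤ.- (+ (u ℕ.* (i ℕ.+ 1))))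

open import Defs

-- Quantum integers and their images under q ↦ q^k

module QuantumIntegers (K : CommutativeRing 0ℓ 0ℓ) where
  open CommutativeRing K
  open IntegerSolver K
  open import Relation.Binary.Reasoning.Setoid setoid

  private
    1-t : ∀ {q t} → q * t ≈ 1# → 1# - t ≈ - (t * (1# - q))
    1-t {q} {t} qt = trans (+-congʳ (sym qt)) (solve 2 (λ q t → q :* t :- t := :- (t :* (con (+ 1) :- q))) refl q t)

  -- Of the two factors 1/(1-q), one from [u]_q and one from X/(1-q), one cancels 1 - q in M and the
  -- other cancels 1 - t = -t(1 - q) up to -t.
  M-qint : ∀ {q t a r} → q * t ≈ 1# → (1# - q) * r ≈ 1# → r * (((1# - t) * (1# - q)) * ((1# - a) * r)) ≈ (a - 1#) * t
  M-qint {q} {t} {a} {r} qt qr = begin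
    r * (((1# - t) * (1# - q)) * ((1# - a) * r))
      ≈⟨ *-congˡ (*-congʳ (*-congʳ (1-t qt))) ⟩
    r * ((- (t * (1# - q)) * (1# - q)) * ((1# - a) * r))
      ≈⟨ solve 4 (λ r t s a → r :* ((:- (t :* s) :* s) :* ((con (+ 1) :- a) :* r)) := ((s :* r) :* (s :* r)) :* ((a :- con (+ 1)) :* t)) refl r t (1# - q) a ⟩
    (((1# - q) * r) * ((1# - q) * r)) * ((a - 1#) * t)
      ≈⟨ trans (*-congʳ (trans (*-cong qr qr) (*-identityˡ 1#))) (*-identityˡ _) ⟩
    (a - 1#) * t ∎

  -tint : ∀ {q t b r s} → q * t ≈ 1# → (1# - q) * r ≈ 1# → (1# - t) * s ≈ 1# → - ((1# - b) * s) ≈ q * (1# - b) * r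
  -tint {q} {t} {b} {r} {s} qt qr ts = begin
    - ((1# - b) * s)
      ≈⟨ trans (sym (*-identityˡ _)) (*-congʳ (trans (sym (*-identityˡ 1#)) (*-cong (sym qt) (sym qr)))) ⟩
    ((q * t) * ((1# - q) * r)) * - ((1# - b) * s)
      ≈⟨ solve 6 (λ q t u r b s → ((q :* t) :* (u :* r)) :* :- (b :* s) := (q :* b :* r) :* ((:- (t :* u)) :* s)) refl q t (1# - q) r (1# - b) s ⟩
    (q * (1# - b) * r) * (- (t * (1# - q)) * s)
      ≈⟨ *-congˡ (trans (*-congʳ (sym (1-t qt))) ts) ⟩
    (q * (1# - b) * r) * 1#
      ≈⟨ *-identityʳ _ ⟩
    q * (1# - b) * r ∎

  inverse-unique : ∀ {x y z} → x * y ≈ 1# → x * z ≈ 1# → y ≈ z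
  inverse-unique {x} {y} {z} xy xz = trans (sym (*-identityʳ y)) (trans (*-congˡ (sym xz)) (trans (solve 3 (λ x y z → y :* (x :* z) := (x :* y) :* z) refl x y z)
    (trans (*-congʳ xy) (*-identityˡ z))))

module AdamsQuantum (K : CommutativeRing 0ℓ 0ℓ) where
  open CommutativeRing K
  open Powers K

  module Endomorphism (A : Hom K K) (q t iq it : Carrier) (qt : q * t ≈ 1#)
    (q-inverse : (1# - q) * iq ≈ 1#) (t-inverse : (1# - t) * it ≈ 1#) (k : ℕ) (A-q : Hom.fun A q ≈ power q k) where
    private module A = Hom A
    open QuantumIntegers K

    power-power : ∀ c m n → power (power c m) n ≈ power (power c n) m
    power-power c zero n = power-1 n
    power-power c (suc m) n = trans (power-* c (power c m) n) (*-congˡ (power-power c m n))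

    A-t : A.fun t ≈ power t k
    A-t = inverse-unique {power q k} (trans (*-congʳ (sym A-q)) (trans (sym (A.*-homo q t)) (trans (A.cong qt) A.1-homo))) (power-inverse qt k)

    A-1- : ∀ {x y} → A.fun x ≈ y → A.fun (1# - x) ≈ 1# - y
    A-1- {x} e = trans (A.+-homo 1# (- x)) (+-cong A.1-homo (trans (A.neg-homo x) (-‿cong e)))

    A-power : ∀ {x} → A.fun x ≈ power x k → ∀ u → A.fun (power x u) ≈ power (power x u) k
    A-power {x} e u = trans (sym (Multiples.fun-power A x u)) (trans (power-cong u e) (power-power x k u))

    A-inverse : ∀ {x ix} → (1# - x) * ix ≈ 1# → A.fun x ≈ power x k → (1# - power x k) * A.fun ix ≈ 1#
    A-inverse {x} {ix} e ex = trans (*-congʳ (sym (A-1- ex))) (trans (sym (A.*-homo (1# - x) ix)) (trans (A.cong e) A.1-homo))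

    -- A homomorphism sending q to q^k sends t to t^k and preserves inverses, so the identity
    -- `M-qint` can be applied at q^k.
    A-M-qint : ∀ u → A.fun iq * A.fun (((1# - t) * (1# - q)) * ((1# - power q u) * iq)) ≈ (power (power q u) k - 1#) * power t k
    A-M-qint u = trans (*-congˡ (trans (A.*-homo _ _) (*-cong (trans (A.*-homo _ _) (*-cong (A-1- A-t) (A-1- A-q)))
        (trans (A.*-homo _ _) (*-congʳ (A-1- (A-power A-q u)))))))
      (M-qint (power-inverse qt k) (A-inverse q-inverse A-q))

    A--tint : ∀ u → A.fun (- ((1# - power t u) * it)) ≈ power q k * (1# - power (power t u) k) * A.fun iq
    A--tint u = trans (A.neg-homo _) (trans (-‿cong (trans (A.*-homo _ _) (*-congʳ (A-1- (A-power A-t u)))))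
      (-tint (power-inverse qt k) (A-inverse q-inverse A-q) (A-inverse t-inverse A-t)))

open Adams
open Adams using () renaming (n to nF; d to dF)
module F = CommutativeRing fractionRing
open Powers fractionRing
open QuantumIntegers fractionRing

-- The concrete coefficients as fractions with certified denominators

qF tF : Fraction
qF = fraction qQ Good-1
tF = fraction tQ (Good-0∷ Good-1)

module _ where
  open CommutativeRing ℚ-series hiding (zero)
  open PolynomialSeries
  open PowerSeries ℚ.+-*-commutativeRing using (X)

  n-q : n qF ≈ X
  n-q = trans (coef-0∷ (1ℚ ∷ [])) (trans (*-congˡ {X} coef-const1) (*-identityʳ X))

  n-power-q : ∀ k → n (power qF k) ≈ xpow k
  n-power-q zero = n-1
  n-power-q (suc k) = trans (n-* qF (power qF k)) (*-cong {n qF} n-q (n-power-q k))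

  d-power-q : ∀ k → d (power qF k) ≈ 1#
  d-power-q zero = d-1
  d-power-q (suc k) = trans (d-* qF (power qF k)) (trans (*-cong {d qF} coef-const1 (d-power-q k)) (*-identityˡ 1#))

  adamsF-q : ∀ k → adamsF k qF F.≈ power qF (suc k)
  adamsF-q k = adams-coef k qF (power qF (suc k)) (xpow (suc k)) 1#
    (trans (A.substitution-0∷ k (1ℚ ∷ [])) (trans (*-congˡ {xpow (suc k)} (trans (adams-const k 1ℚ) coef-const1)) (*-identityʳ (xpow (suc k)))))
    (trans (adams-const k 1ℚ) coef-const1) (n-power-q (suc k)) (d-power-q (suc k))

  q*t : qF F.* tF F.≈ F.1#
  q*t = cross-via {qF F.* tF} {F.1#} (trans (n-* qF tF) (trans (*-cong {n qF} n-q coef-const1) (*-identityʳ X)))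
    (trans (d-* qF tF) (trans (*-cong {d qF} coef-const1 n-q) (*-identityˡ X))) n-1 d-1 (*-comm X 1#)

frac-1- : ∀ x → frac (F.1# F.- x) ≡ 1Q -Q frac x
frac-1- x = ≡.trans (frac-+ F.1# (F.- x)) (≡.cong₂ _+Q_ frac-1 (frac-neg x))

Good-1-q : Good (Qq.num (frac (F.1# F.- qF)))
Good-1-q = ≡.subst (λ f → Good (Qq.num f)) (≡.sym (frac-1- qF)) (Good-∷ _ _)

Good-1-t : Good (Qq.num (frac (F.1# F.- tF)))
Good-1-t = ≡.subst (λ f → Good (Qq.num f)) (≡.sym (frac-1- tF)) (Good-∷ _ _)

adams-hom : ℕ → Hom fractionRing fractionRing
adams-hom k = record { fun = adamsF k ; cong = adamsF-cong k ; +-homo = adamsF-+ k ; *-homo = adamsF-* k ; 1-homo = adamsF-1 k }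

inv1-q inv1-t : Fraction
inv1-q = invF (F.1# F.- qF) Good-1-q
inv1-t = invF (F.1# F.- tF) Good-1-t

M qintF -tintF : ℕ → Fraction
M u = ((F.1# F.- tF) F.* (F.1# F.- qF)) F.* qintF u
qintF u = (F.1# F.- power qF u) F.* inv1-q
-tintF u = F.- ((F.1# F.- power tF u) F.* inv1-t)

frac-power : ∀ x n → frac (power x n) ≡ frac x ^Q n
frac-power x zero = frac-1
frac-power x (suc n) = ≡.trans (frac-* x (power x n)) (≡.cong (frac x *Q_) (frac-power x n))

frac-quotient : ∀ x z y g → frac ((F.1# F.- power x z) F.* invF (F.1# F.- y) g) ≡ (1Q -Q (frac x ^Q z)) ÷Q (1Q -Q frac y)
frac-quotient x z y g = ≡.trans (frac-* _ _) (≡.cong₂ _*Q_ (≡.trans (frac-1- _) (≡.cong (λ w → 1Q -Q w) (frac-power x z)))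
  (≡.trans (frac-inv _ g) (≡.cong invQ (frac-1- y))))

frac-M : ∀ u → frac (M u) ≡ MQ *Q qint u
frac-M u = ≡.trans (frac-* _ _) (≡.cong₂ _*Q_ (≡.trans (frac-* _ _) (≡.cong₂ _*Q_ (frac-1- tF) (frac-1- qF))) (frac-quotient qF u qF Good-1-q))

frac--tint : ∀ u → frac (-tintF u) ≡ -Q (tint u)
frac--tint u = ≡.trans (frac-neg _) (≡.cong (λ w → -Q w) (frac-quotient tF u tF Good-1-t))

adamsP-0 : ∀ p → adamsP 0 p ≡ p
adamsP-0 [] = ≡.refl
adamsP-0 (a ∷ p) = ≡.cong (a ∷_) (adamsP-0 p)

-- The formal index 0 acts as the identity, because adamsP 0 inserts 0 ∸ 1 = 0 zeros.
adams₀ : ℕ → Fraction → Fraction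
adams₀ zero x = fraction (adamsQ 0 (frac x)) (≡.subst Good (≡.sym (adamsP-0 _)) (good x))
adams₀ (suc k) x = adamsF k x

frac-adams₀ : ∀ k x → frac (adams₀ k x) ≡ adamsQ k (frac x)
frac-adams₀ zero x = ≡.refl
frac-adams₀ (suc k) x = frac-adams k x

module AQ (k : ℕ) = AdamsQuantum.Endomorphism fractionRing (adams-hom k) qF tF inv1-q inv1-t q*t
  (invF-inverse (F.1# F.- qF) Good-1-q) (invF-inverse (F.1# F.- tF) Good-1-t) (suc k) (adamsF-q k)

module _ (u : ℕ) where

  r κ σ o : ℕ → Fraction
  r k = adams₀ k inv1-q
  κ k = adams₀ k (M u)
  σ k = adams₀ k (-tintF u)
  o k = adams₀ k F.1#

  r-κ : ∀ k → r (suc k) F.* κ (suc k) F.≈ (power (power qF u) (suc k) F.- F.1#) F.* power tF (suc k)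
  r-κ k = AQ.A-M-qint k u

  σ-r : ∀ k → σ (suc k) F.≈ power qF (suc k) F.* (F.1# F.- power (power tF u) (suc k)) F.* r (suc k)
  σ-r k = AQ.A--tint k u

-- Integers, reciprocals and inverse factorials among the fractions

fromℕF : ℕ → Fraction
fromℕF n = fraction (fromℕQ n) Good-1

module MF = SemiringMult F.semiring

/1-suc : ∀ n → (+ suc n) ℚ./ 1 ≡ 1ℚ ℚ.+ (+ n) ℚ./ 1
/1-suc n = ℚ.toℚᵘ-injective (ℚᵘ.≃-trans (ℚ.toℚᵘ-fromℚᵘ (ℚᵘ.mkℚᵘ (+ suc n) 0)) (ℚᵘ.≃-sym (ℚᵘ.≃-trans (ℚ.toℚᵘ-homo-+ 1ℚ ((+ n) ℚ./ 1))
  (ℚᵘ.≃-trans (ℚᵘ.+-congʳ (ℚ.toℚᵘ 1ℚ) (ℚ.toℚᵘ-fromℚᵘ (ℚᵘ.mkℚᵘ (+ n) 0))) (ℚᵘ.*≡* (≡.cong (λ i → (+ 1 ℤ.+ i) ℤ.* + 1) (ℤ.*-identityʳ (+ n))))))))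

fromℕF-suc : ∀ n → fromℕF (suc n) F.≈ F.1# F.+ fromℕF n
fromℕF-suc n = cross-via {fromℕF (suc n)} {F.1# F.+ fromℕF n} additive coef-const1
    (trans (n-+ F.1# (fromℕF n)) (trans (+-cong {nF F.1# * dF (fromℕF n)} (trans (*-cong {nF F.1#} n-1 coef-const1) (*-identityˡ 1#))
      (trans (*-congˡ {coef (((+ n) ℚ./ 1) ∷ [])} d-1) (*-identityʳ (coef (((+ n) ℚ./ 1) ∷ []))))) refl))
    (trans (d-+ F.1# (fromℕF n)) (trans (*-cong {dF F.1#} d-1 coef-const1) (*-identityˡ 1#))) refl
  where
  open CommutativeRing ℚ-series
  open PolynomialSeries
  additive : coef (((+ suc n) ℚ./ 1) ∷ []) ≈ 1# + coef (((+ n) ℚ./ 1) ∷ [])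
  additive zero = /1-suc n
  additive (suc k) = ≡.refl

fromℕF-× : ∀ n → fromℕF n F.≈ n MF.× F.1#
fromℕF-× zero = cross-via {fromℕF 0} {F.0#} coef-const0 coef-const1 n-0 d-0 (CommutativeRing.refl ℚ-series)
fromℕF-× (suc n) = F.trans (fromℕF-suc n) (F.+-congˡ (fromℕF-× n))

/1-nonZero : ∀ n .{{_ : ℕ.NonZero n}} → ℚ.NonZero ((+ n) ℚ./ 1)
/1-nonZero n = ℚ.pos⇒nonZero ((+ n) ℚ./ 1) {{ℚ.normalize-pos n 1}}

Good-fromℕ : ∀ n .{{_ : ℕ.NonZero n}} → Good (Qq.num (fromℕQ n))
Good-fromℕ n = Good-∷ ((+ n) ℚ./ 1) [] {{/1-nonZero n}}

inverseℕ : ∀ n .{{_ : ℕ.NonZero n}} → Fraction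
inverseℕ n = invF (fromℕF n) (Good-fromℕ n)

inverseℕ-inverse : ∀ n .{{_ : ℕ.NonZero n}} → (n MF.× F.1#) F.* inverseℕ n F.≈ F.1#
inverseℕ-inverse n = F.trans (F.*-congʳ (F.sym (fromℕF-× n))) (invF-inverse (fromℕF n) (Good-fromℕ n))

recip invfact : ℕ → Fraction
recip k = inverseℕ (suc k)
invfact n = inverseℕ (n !) {{n ℕ.!≢0}}

invfact-0 : invfact 0 F.≈ F.1#
invfact-0 = F.trans (F.sym (F.trans (F.*-congʳ (F.+-identityʳ F.1#)) (F.*-identityˡ (invfact 0)))) (inverseℕ-inverse 1)

-- Both sides are inverse to m!, and inverses are unique.
invfact-suc : ∀ m → suc m MF.× invfact (suc m) F.≈ invfact m
invfact-suc m = inverse-unique {(m !) MF.× F.1#} product (inverseℕ-inverse (m !) {{m ℕ.!≢0}})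
  where
  open import Relation.Binary.Reasoning.Setoid F.setoid
  product : ((m !) MF.× F.1#) F.* (suc m MF.× invfact (suc m)) F.≈ F.1#
  product = begin
    ((m !) MF.× F.1#) F.* (suc m MF.× invfact (suc m))
      ≈⟨ F.trans (MF.×-comm-* (suc m) _ _) (F.sym (MF.×-assoc-* (suc m) _ _)) ⟩
    (suc m MF.× ((m !) MF.× F.1#)) F.* invfact (suc m)
      ≈⟨ F.*-congʳ (MF.×-assocˡ F.1# (suc m) (m !)) ⟩
    ((suc m !) MF.× F.1#) F.* invfact (suc m)
      ≈⟨ inverseℕ-inverse (suc m !) {{suc m ℕ.!≢0}} ⟩
    F.1# ∎

-- Sorting as a normal form for multisets

insertDesc-ordered : ∀ x y l → x ℕ.< y → insertDesc x (insertDesc y l) ≡ insertDesc y (insertDesc x l)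
insertDesc-ordered x y [] x<y rewrite <ᵇ-true x<y | <ᵇ-false {y} {x} (ℕ.<⇒≤ x<y) = ≡.refl
insertDesc-ordered x y (z ∷ l) x<y with z ℕ.<ᵇ x in p | z ℕ.<ᵇ y in r
... | true | true rewrite <ᵇ-true x<y | <ᵇ-false {y} {x} (ℕ.<⇒≤ x<y) | p = ≡.refl
... | true | false = contradiction (≡.trans (≡.sym (<ᵇ-true (ℕ.<-trans (<ᵇ-true⇒< p) x<y))) r) λ ()
... | false | true rewrite <ᵇ-false {y} {x} (ℕ.<⇒≤ x<y) | p | r = ≡.refl
... | false | false rewrite p | r = ≡.cong (z ∷_) (insertDesc-ordered x y l x<y)

insertDesc-swap : ∀ x y l → insertDesc x (insertDesc y l) ≡ insertDesc y (insertDesc x l)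
insertDesc-swap x y l with ℕ.<-cmp x y
... | tri< x<y _ _ = insertDesc-ordered x y l x<y
... | tri≈ _ ≡.refl _ = ≡.refl
... | tri> _ _ y<x = ≡.sym (insertDesc-ordered y x l y<x)

-- Makes "the sorted list equals `lam`" a property of the multiset, so that taking a coefficient is
-- a functional on monomials.
sortDesc-↭ : ∀ {ms ns} → ms ↭ ns → sortDesc ms ≡ sortDesc ns
sortDesc-↭ ↭.refl = ≡.refl
sortDesc-↭ (↭.prep x e) = ≡.cong (insertDesc x) (sortDesc-↭ e)
sortDesc-↭ (↭.swap {xs} x y e) = ≡.trans (insertDesc-swap x y (sortDesc xs)) (≡.cong (λ l → insertDesc y (insertDesc x l)) (sortDesc-↭ e))
sortDesc-↭ (↭.trans e d) = ≡.trans (sortDesc-↭ e) (sortDesc-↭ d)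

if-map : ∀ {A B : Set} (f : A → B) b {x y x′ y′} → f x ≡ x′ → f y ≡ y′ → f (if b then x else y) ≡ (if b then x′ else y′)
if-map f true e d = e
if-map f false e d = d

-- Forgetting the certificates on denominators

module Erasure where
  module Λs = MonoidAlgebra fractionRing multisets
  module Rs = MonoidAlgebra fractionRing monomials
  open Laurent fractionRing using (coefficient)

  -- Compatibility with the operations is proved as equality of lists, not up to `_≈Λ_`: on raw
  -- fractions cross-multiplication is not transitive, so chains of equivalences must stay on the
  -- certified side.
  eΛ : Λs.Sum → Λ
  eΛ = map (λ (c , ms) → frac c , ms)

  eR : Rs.Sum → R
  eR = map (λ (c , e , ms) → frac c , e , ms)

  eΛ-++ : ∀ F G → eΛ (F ++ G) ≡ eΛ F ++ eΛ G
  eΛ-++ = List.map-++ _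

  eR-++ : ∀ F G → eR (F ++ G) ≡ eR F ++ eR G
  eR-++ = List.map-++ _

  eΛ-term : ∀ c ms G → eΛ (Λs.timesTerm (c , ms) G) ≡ map (λ (d , ns) → frac c *Q d , ms ++ ns) (eΛ G)
  eΛ-term c ms [] = ≡.refl
  eΛ-term c ms ((d , ns) ∷ G) = ≡.cong₂ (λ x F → (x , ms ++ ns) ∷ F) (frac-* c d) (eΛ-term c ms G)

  eΛ-· : ∀ F G → eΛ (F Λs.· G) ≡ eΛ F *Λ eΛ G
  eΛ-· [] G = ≡.refl
  eΛ-· ((c , ms) ∷ F) G = ≡.trans (eΛ-++ (Λs.timesTerm (c , ms) G) (F Λs.· G)) (≡.cong₂ _++_ (eΛ-term c ms G) (eΛ-· F G))

  eR-term : ∀ c e ms G → eR (Rs.timesTerm (c , e , ms) G) ≡ map (λ (d , f , ns) → frac c *Q d , e ℤ.+ f , ms ++ ns) (eR G)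
  eR-term c e ms [] = ≡.refl
  eR-term c e ms ((d , f , ns) ∷ G) = ≡.cong₂ (λ x F → (x , e ℤ.+ f , ms ++ ns) ∷ F) (frac-* c d) (eR-term c e ms G)

  eR-· : ∀ F G → eR (F Rs.· G) ≡ eR F *R eR G
  eR-· [] G = ≡.refl
  eR-· ((c , e , ms) ∷ F) G = ≡.trans (eR-++ (Rs.timesTerm (c , e , ms) G) (F Rs.· G)) (≡.cong₂ _++_ (eR-term c e ms G) (eR-· F G))

  eΛ-scale : ∀ k F → eΛ (Λs.scale k F) ≡ scaleΛ (frac k) (eΛ F)
  eΛ-scale k [] = ≡.refl
  eΛ-scale k ((c , ms) ∷ F) = ≡.cong₂ (λ x F → (x , ms) ∷ F) (frac-* k c) (eΛ-scale k F)

  eR-scale : ∀ k F → eR (Rs.scale k F) ≡ scaleR (frac k) (eR F)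
  eR-scale k [] = ≡.refl
  eR-scale k ((c , e , ms) ∷ F) = ≡.cong₂ (λ x F → (x , e , ms) ∷ F) (frac-* k c) (eR-scale k F)

  e-coefficient : ∀ v G → eΛ (coefficient v G) ≡ coeffZ v (eR G)
  e-coefficient v [] = ≡.refl
  e-coefficient v ((c , e , ms) ∷ G) = if-map eΛ (does (e ℤ.≟ v)) (≡.cong ((frac c , ms) ∷_) (e-coefficient v G)) (e-coefficient v G)

  eΛ-concat : ∀ (F : ℕ → Λs.Sum) f N → (∀ k → eΛ (F k) ≡ f k) → eΛ (foldr _++_ [] (applyUpTo F N)) ≡ foldr _++_ [] (applyUpTo f N)
  eΛ-concat F f zero e = ≡.refl
  eΛ-concat F f (suc N) e = ≡.trans (eΛ-++ (F 0) _) (≡.cong₂ _++_ (e 0) (eΛ-concat (λ k → F (suc k)) (λ k → f (suc k)) N (λ k → e (suc k))))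

  eR-concat : ∀ (F : ℕ → Rs.Sum) f N → (∀ k → eR (F k) ≡ f k) → eR (foldr _++_ [] (applyUpTo F N)) ≡ foldr _++_ [] (applyUpTo f N)
  eR-concat F f zero e = ≡.refl
  eR-concat F f (suc N) e = ≡.trans (eR-++ (F 0) _) (≡.cong₂ _++_ (e 0) (eR-concat (λ k → F (suc k)) (λ k → f (suc k)) N (λ k → e (suc k))))

  module _ (ρ : ℕ → Rs.Sum) (E : R) (match : ∀ j → eR (ρ j) ≡ adamsR j E) where
    open Evaluation fractionRing monomials ρ

    e-monomial : ∀ ms → eR (monomial ms) ≡ prodR (map (λ j → adamsR j E) ms)
    e-monomial [] = ≡.cong (λ c → (c , + 0 , []) ∷ []) frac-1
    e-monomial (m ∷ ms) = ≡.trans (eR-· (ρ m) (monomial ms)) (≡.cong₂ _*R_ (match m) (e-monomial ms))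

    e-pleth : ∀ F → eR (evaluate F) ≡ pleth (eΛ F) E
    e-pleth [] = ≡.refl
    e-pleth ((c , ms) ∷ F) = ≡.trans (eR-++ (Rs.scale c (monomial ms)) (evaluate F))
      (≡.cong₂ _++_ (≡.trans (eR-scale c (monomial ms)) (≡.cong (scaleR (frac c)) (e-monomial ms))) (e-pleth F))

  coefficientF : List ℕ → Λs.Sum → Fraction
  coefficientF lam [] = F.0#
  coefficientF lam ((c , ms) ∷ G) = if does (List.≡-dec ℕ._≟_ (sortDesc ms) lam) then c F.+ coefficientF lam G else coefficientF lam G

  frac-coefficient : ∀ lam G → frac (coefficientF lam G) ≡ coeffΛ lam (eΛ G)
  frac-coefficient lam [] = frac-0
  frac-coefficient lam ((c , ms) ∷ G) = if-map frac (does (List.≡-dec ℕ._≟_ (sortDesc ms) lam))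
    (≡.trans (frac-+ c (coefficientF lam G)) (≡.cong (frac c +Q_) (frac-coefficient lam G))) (frac-coefficient lam G)

  indicator : List ℕ → Λs.Functional
  indicator lam = record
    { on = λ ms → if does (List.≡-dec ℕ._≟_ (sortDesc ms) lam) then F.1# else F.0#
    ; on-cong = λ e → F.reflexive (≡.cong (λ l → if does (List.≡-dec ℕ._≟_ l lam) then F.1# else F.0#) (sortDesc-↭ e)) }

  pair-indicator : ∀ lam G → Λs.pair G (Λs.on (indicator lam)) F.≈ coefficientF lam G
  pair-indicator lam [] = F.refl
  pair-indicator lam ((c , ms) ∷ G) = step (does (List.≡-dec ℕ._≟_ (sortDesc ms) lam)) (pair-indicator lam G)
    where
    step : ∀ b {s s′} → s F.≈ s′ → c F.* (if b then F.1# else F.0#) F.+ s F.≈ (if b then c F.+ s′ else s′)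
    step true e = F.+-cong (F.*-identityʳ c) e
    step false e = F.trans (F.+-cong (F.zeroʳ c) e) (F.+-identityˡ _)

  -- Agreement under all functionals includes the functionals `indicator lam`, whose values are the
  -- coefficients compared by `_≈Λ_`.
  eΛ-≈ : ∀ {F G} → F Λs.≈ₛ G → eΛ F ≈Λ eΛ G
  eΛ-≈ {F} {G} e lam = ≡.subst₂ _≈Q_ (frac-coefficient lam F) (frac-coefficient lam G)
    (≈F⇒≈Q (F.trans (F.sym (pair-indicator lam F)) (F.trans (Λs.under e (indicator lam)) (pair-indicator lam G))))

-- Identification of the certified operators with those of the statement

open Erasure
open Laurent fractionRing using (module Λ; module Λr)
open import Data.Nat using (_<_; _+_; _*_)
open import Data.Integer using (_-_)
open Powers.Inverses fractionRing qF tF q*t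

recip-inverse : ∀ n → (suc n MF.× F.1#) F.* recip n F.≈ F.1#
recip-inverse n = inverseℕ-inverse (suc n)

frac-integerPower : ∀ i → frac (integerPower i) ≡ qPowℤ i
frac-integerPower (+ n) = frac-power qF n
frac-integerPower -[1+ n ] = frac-power tF (suc n)

module _ (u : ℕ) where
  private module O = Operators fractionRing (r u) (κ u) (σ u) (o u) recip invfact

  eΛ-one : eΛ Λr.1# ≡ oneΛ
  eΛ-one = ≡.cong (λ c → (c , []) ∷ []) frac-1

  eΛ-p : ∀ k → eΛ (O.p k) ≡ pΛ k
  eΛ-p k = ≡.cong (λ c → (c , k ∷ []) ∷ []) frac-1

  eΛ-opposite : ∀ G → eΛ (O.opposite G) ≡ scaleΛ (-Q 1Q) (eΛ G)
  eΛ-opposite G = ≡.trans (eΛ-scale (F.- F.1#) G) (≡.cong (λ c → scaleΛ c (eΛ G)) (≡.trans (frac-neg F.1#) (≡.cong (λ c → -Q c) frac-1)))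

  eΛ-signed : ∀ j G → eΛ (O.Rec.signed j G) ≡ signΛ j (eΛ G)
  eΛ-signed j G = if-map eΛ (does (j ℕ.% 2 ℕ.≟ 0)) ≡.refl (eΛ-opposite G)

  eΛ-cofactors : ∀ n M M′ → (∀ i j → eΛ (M i j) ≡ M′ i j) → eΛ (O.Rec.cofactors n M) ≡ det n M′
  eΛ-cofactors zero M M′ e = eΛ-one
  eΛ-cofactors (suc n) M M′ e = eΛ-concat (λ j → O.Rec.signed j (M 0 j Λ.· O.Rec.cofactors n (λ i k → M (suc i) (skip j k))))
    (λ j → signΛ j (M′ 0 j *Λ det n (λ i k → M′ (suc i) (skip j k)))) (suc n)
    (λ j → ≡.trans (eΛ-signed j _) (≡.cong (signΛ j) (≡.trans (eΛ-· (M 0 j) _) (≡.cong₂ _*Λ_ (e 0 j)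
      (eΛ-cofactors n (λ i k → M (suc i) (skip j k)) (λ i k → M′ (suc i) (skip j k)) (λ i k → e (suc i) (skip j k)))))))

  eΛ-zipWith : ∀ ks Hs → eΛ (O.Rec.total (zipWith (λ k h → O.p (suc k) Λ.· h) ks Hs)) ≡ sumΛ (zipWith (λ k h → pΛ (suc k) *Λ h) ks (map eΛ Hs))
  eΛ-zipWith [] Hs = ≡.refl
  eΛ-zipWith (k ∷ ks) [] = ≡.refl
  eΛ-zipWith (k ∷ ks) (h ∷ Hs) = ≡.trans (eΛ-++ (O.p (suc k) Λ.· h) _)
    (≡.cong₂ _++_ (≡.trans (eΛ-· (O.p (suc k)) h) (≡.cong (_*Λ eΛ h) (eΛ-p (suc k)))) (eΛ-zipWith ks Hs))

  frac-recip : ∀ n → frac (recip n) ≡ invQ (fromℕQ (suc n))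
  frac-recip n = frac-inv (fromℕF (suc n)) (Good-fromℕ (suc n))

  eΛ-completes : ∀ n → map eΛ (O.Com.completes n) ≡ hs n
  eΛ-completes zero = ≡.cong (_∷ []) eΛ-one
  eΛ-completes (suc n) = ≡.cong₂ _∷_
    (≡.trans (eΛ-scale (recip n) _) (≡.cong₂ scaleΛ (frac-recip n)
      (≡.trans (eΛ-zipWith (applyUpTo (λ k → k) (suc n)) (O.Com.completes n)) (≡.cong (λ Hs → sumΛ (zipWith (λ k h → pΛ (suc k) *Λ h) (applyUpTo (λ k → k) (suc n)) Hs)) (eΛ-completes n)))))
    (eΛ-completes n)

  eΛ-H : ∀ n → eΛ (O.H n) ≡ headΛ (hs n)
  eΛ-H n = ≡.trans (head n) (≡.cong headΛ (eΛ-completes n))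
    where
    head : ∀ n → eΛ (O.H n) ≡ headΛ (map eΛ (O.Com.completes n))
    head zero = ≡.refl
    head (suc n) = ≡.refl

  eΛ-Hℤ : ∀ k → eΛ (onℤ [] O.H k) ≡ hℤ k
  eΛ-Hℤ (+ n) = eΛ-H n
  eΛ-Hℤ -[1+ n ] = ≡.refl

  eΛ-schur : ∀ lam → eΛ (O.schur lam) ≡ schur lam
  eΛ-schur lam = eΛ-cofactors (length lam) (O.Rec.jacobiTrudiMatrix (onℤ [] O.H) lam) (λ i j → hℤ ((+ at i lam) ℤ.- (+ i) ℤ.+ (+ j)))
    (λ i j → eΛ-Hℤ ((+ at i lam) ℤ.- (+ i) ℤ.+ (+ j)))

  sComp≡ : ∀ α → let β = zipWith ℕ._+_ α (delta (length α)) in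
    sComp α ≡ (if repeats β then [] else signΛ (inversions β) (schur (dropZerosEnd (zipWith _∸_ (sortDesc β) (delta (length α))))))
  sComp≡ α = ≡.cong₂ (λ b n → if b then [] else signΛ n (schur (dropZerosEnd (zipWith _∸_ (sortDesc β) (delta (length α))))))
    (foldr-pairs _ (λ _ _ _ → ≡.refl) β) (filter-pairs _ (λ _ _ → ≡.refl) β)
    where
    β : List ℕ
    β = zipWith ℕ._+_ α (delta (length α))

  eΛ-sComp : ∀ α → eΛ (O.sComp α) ≡ sComp α
  eΛ-sComp α = ≡.trans (if-map eΛ (repeats β) ≡.refl (≡.trans (eΛ-signed (inversions β) (O.schur lam)) (≡.cong (signΛ (inversions β)) (eΛ-schur lam)))) (≡.sym (sComp≡ α))
    where
    β lam : List ℕ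
    β = zipWith ℕ._+_ α (delta (length α))
    lam = dropZerosEnd (zipWith _∸_ (sortDesc β) (delta (length α)))

  eR-X/[1-q] : ∀ j → eR (O.X/[1-q] j) ≡ adamsR j ((invQ (1Q -Q qQ) , + 0 , 1 ∷ []) ∷ [])
  eR-X/[1-q] j = ≡.cong (λ c → (c , (+ j) ℤ.* + 0 , map (j ℕ.*_) (1 ∷ [])) ∷ []) (≡.trans (frac-adams₀ j inv1-q)
    (≡.cong (adamsQ j) (≡.trans (frac-inv (F.1# F.- qF) Good-1-q) (≡.cong invQ (frac-1- qF)))))

  eR-E₁ : ∀ j → eR (O.E₁ j) ≡ adamsR j ((1Q , + 0 , 1 ∷ []) ∷ (MQ *Q qint u , -[1+ 0 ] , []) ∷ [])
  eR-E₁ j = ≡.cong₂ (λ c d → (c , (+ j) ℤ.* + 0 , map (j ℕ.*_) (1 ∷ [])) ∷ (d , (+ j) ℤ.* -[1+ 0 ] , []) ∷ [])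
    (≡.trans (frac-adams₀ j F.1#) (≡.cong (adamsQ j) frac-1)) (≡.trans (frac-adams₀ j (M u)) (≡.cong (adamsQ j) (frac-M u)))

  eR-E₂ : ∀ j → eR (O.E₂ j) ≡ adamsR j ((-Q (tint u) , + 1 , 1 ∷ []) ∷ [])
  eR-E₂ j = ≡.cong (λ c → (c , (+ j) ℤ.* + 1 , map (j ℕ.*_) (1 ∷ [])) ∷ []) (≡.trans (frac-adams₀ j (-tintF u)) (≡.cong (adamsQ j) (frac--tint u)))

  eΛ-plethX : ∀ G → eΛ (O.plethX G) ≡ plethX (eΛ G)
  eΛ-plethX G = ≡.trans (e-coefficient (+ 0) (Evaluation.evaluate fractionRing monomials O.X/[1-q] G)) (≡.cong (coeffZ (+ 0)) (e-pleth O.X/[1-q] _ eR-X/[1-q] G))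

  eR-one : eR O.oneR ≡ oneR
  eR-one = ≡.cong (λ c → (c , + 0 , []) ∷ []) frac-1

  logarithmQ : ℕ → R
  logarithmQ N = foldr _++_ [] (applyUpTo (λ k → scaleR (invQ (fromℕQ (suc k))) (adamsR (suc k) ((-Q (tint u) , + 1 , 1 ∷ []) ∷ []))) N)

  eR-logarithm : ∀ N → eR (O.logarithm N) ≡ logarithmQ N
  eR-logarithm N = eR-concat (λ k → Rs.scale (recip k) (O.E₂ (suc k))) (λ k → scaleR (invQ (fromℕQ (suc k))) (adamsR (suc k) ((-Q (tint u) , + 1 , 1 ∷ []) ∷ []))) N
    (λ k → ≡.trans (eR-scale (recip k) (O.E₂ (suc k))) (≡.cong₂ scaleR (frac-recip k) (eR-E₂ (suc k))))

  eR-powR : ∀ L L′ → eR L ≡ L′ → ∀ n → eR (O.powR L n) ≡ powR L′ n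
  eR-powR L L′ e zero = eR-one
  eR-powR L L′ e (suc n) = ≡.trans (eR-· L (O.powR L n)) (≡.cong₂ _*R_ e (eR-powR L L′ e n))

  frac-invfact : ∀ n → frac (invfact n) ≡ invQ (fromℕQ (n !))
  frac-invfact n = frac-inv (fromℕF (n !)) (Good-fromℕ (n !) {{n ℕ.!≢0}})

  eR-Ω : ∀ N → eR (O.Ω N) ≡ ΩTrunc N ((-Q (tint u) , + 1 , 1 ∷ []) ∷ [])
  eR-Ω N = eR-concat (λ n → Rs.scale (invfact n) (O.powR (O.logarithm N) n)) (λ n → scaleR (invQ (fromℕQ (n !))) (powR (logarithmQ N) n)) (suc N)
    (λ n → ≡.trans (eR-scale (invfact n) (O.powR (O.logarithm N) n)) (≡.cong₂ scaleR (frac-invfact n) (eR-powR (O.logarithm N) (logarithmQ N) (eR-logarithm N) n)))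

  degree-eΛ : ∀ G → sum (map (λ x → sum (proj₂ x)) (eΛ G)) ≡ O.degree G
  degree-eΛ [] = ≡.refl
  degree-eΛ ((c , ms) ∷ G) = ≡.cong (sum ms ℕ.+_) (degree-eΛ G)

  eΛ-D : ∀ v G → eΛ (O.D v G) ≡ D u v (eΛ G)
  eΛ-D v G = ≡.trans (e-coefficient (+ v) (Evaluation.evaluate fractionRing monomials O.E₁ G Rs.· O.Ω (v ℕ.+ O.degree G))) (≡.cong (coeffZ (+ v))
    (≡.trans (eR-· (Evaluation.evaluate fractionRing monomials O.E₁ G) (O.Ω (v ℕ.+ O.degree G))) (≡.cong₂ _*R_ (e-pleth O.E₁ _ eR-E₁ G)
      (≡.trans (eR-Ω (v ℕ.+ O.degree G)) (≡.cong (λ m → ΩTrunc (v ℕ.+ m) ((-Q (tint u) , + 1 , 1 ∷ []) ∷ [])) (≡.sym (degree-eΛ G)))))))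

  term : ℕ → List ℕ → ℕ → Λ.Sum
  term v L i = Λ.scale (integerPower ((+ (u * at i L + v)) - (+ (u * (i + 1))))) (O.plethX (O.sComp (addAt i v L)))

  rhs : ℕ → List ℕ → ℕ → Λ.Sum
  rhs v L N = Λ.scale (power qF u F.- F.1#) (foldr _++_ [] (applyUpTo (term v L) N))

  D≈rhs : ∀ v M μ → suc v ℕ.≤ M → O.D (suc v) (O.plethX (O.schur μ)) Λr.≈ rhs (suc v) (μ ++ replicate M 0) (length (μ ++ replicate M 0))
  D≈rhs = PlethysticAction.Parameters.D≈rhs fractionRing qF tF q*t u (r u) (κ u) (σ u) (o u) adamsF-1 (r-κ u) (σ-r u)
    recip invfact recip-inverse invfact-0 invfact-suc

theoremI6 : (u v : ℕ) → 0 < u → 0 < v → (μ : List ℕ) → IsPartition μ →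
  D u v (plethX (schur μ))
    ≈Λ scaleΛ ((qQ ^Q u) -Q 1Q)
         (sumΛ (applyUpTo
           (λ i → scaleΛ (qPowℤ ((+ (u * at i (pad v μ) + v)) - (+ (u * (i + 1)))))
                         (plethX (sComp (addAt i v (pad v μ)))))
           (size μ + v)))
theoremI6 u (suc v) 0<u 0<v μ (positive , _) = ≡.subst₂ _≈Λ_ lhs≡ rhs≡ (eΛ-≈ (D≈rhs u v padding μ v<padding))
  where
  module O = Operators fractionRing (r u) (κ u) (σ u) (o u) recip invfact
  padding N : ℕ
  N = size μ + suc v
  padding = N ∸ length μ
  L : List ℕ
  L = pad (suc v) μ
  length≤size : ∀ {μ} → All (0 <_) μ → length μ ℕ.≤ size μ
  length≤size [] = z≤n
  length≤size (0<m ∷ ps) = ℕ.+-mono-≤ 0<m (length≤size ps)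
  -- All parts are positive, so there are at most |μ| of them. Filling up to length |μ| + v thus
  -- appends at least v zeros, as many as the vanishing of the remainder requires.
  v<padding : suc v ℕ.≤ padding
  v<padding = ℕ.≤-trans (ℕ.≤-reflexive (≡.sym (ℕ.m+n∸m≡n (size μ) (suc v)))) (ℕ.∸-monoʳ-≤ N (length≤size positive))
  length-L : length L ≡ N
  length-L = ≡.trans (List.length-++ μ) (≡.trans (≡.cong (λ k → length μ + k) (List.length-replicate padding))
    (ℕ.m+[n∸m]≡n (ℕ.≤-trans (length≤size positive) (ℕ.m≤m+n (size μ) (suc v)))))
  lhs≡ : eΛ (O.D (suc v) (O.plethX (O.schur μ))) ≡ D u (suc v) (plethX (schur μ))
  lhs≡ = ≡.trans (eΛ-D u (suc v) (O.plethX (O.schur μ))) (≡.cong (D u (suc v)) (≡.trans (eΛ-plethX u (O.schur μ)) (≡.cong plethX (eΛ-schur u μ))))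
  termQ : ℕ → Λ
  termQ i = scaleΛ (qPowℤ ((+ (u * at i L + suc v)) - (+ (u * (i + 1))))) (plethX (sComp (addAt i (suc v) L)))
  rhs≡ : eΛ (rhs u (suc v) L (length L)) ≡ scaleΛ ((qQ ^Q u) -Q 1Q) (sumΛ (applyUpTo termQ N))
  rhs≡ = ≡.trans (eΛ-scale (power qF u F.- F.1#) (foldr _++_ [] (applyUpTo (term u (suc v) L) (length L)))) (≡.cong₂ scaleΛ
    (≡.trans (frac-+ (power qF u) (F.- F.1#)) (≡.cong₂ _+Q_ (frac-power qF u) (≡.trans (frac-neg F.1#) (≡.cong (λ c → -Q c) frac-1))))
    (≡.trans (eΛ-concat (term u (suc v) L) termQ (length L) (λ i → ≡.trans
        (eΛ-scale (integerPower ((+ (u * at i L + suc v)) - (+ (u * (i + 1))))) (O.plethX (O.sComp (addAt i (suc v) L))))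
        (≡.cong₂ scaleΛ (frac-integerPower ((+ (u * at i L + suc v)) - (+ (u * (i + 1)))))
          (≡.trans (eΛ-plethX u (O.sComp (addAt i (suc v) L))) (≡.cong plethX (eΛ-sComp u (addAt i (suc v) L)))))))
      (≡.cong (λ k → sumΛ (applyUpTo termQ k)) length-L)))
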